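{- Over $\mathsf{ACA}_0^\omega+\mathsf{QF\text{ - }AC}^{0,1}$, the following are equivalent. (i) Every regulated function $f:[0,1]\to\mathbb{R}$ is not totally discontinuous, i.e. there is a point of $[0,1]$ at which $f$ is continuous. (ii) The principle $\mathsf{NIN}_{\mathsf{alt}}$: the unit interval $[0,1]$ is not height-countable.
   Context: $\mathsf{RCA}_0^\omega$ is Kohlenbach's base theory of higher-order Reverse Mathematics, in the language of all finite types: $\mathsf{E\text{ - }PRA}^\omega$ (quantifier-free induction, primitive recursion only of type $0$) plus $\mathsf{QF\text{ - }AC}^{1,0}$: $(\forall f\in\mathbb{N}^{\mathbb{N}})(\exists n\in\mathbb{N})\varphi(f,n)\to(\exists G:\mathbb{N}^{\mathbb{N}}\to\mathbb{N})(\forall f\in\mathbb{N}^{\mathbb{N}})\varphi(f,G(f))$ for quantifier-free $\varphi$. $\mathsf{ACA}_0^\omega$ is $\mathsf{RCA}_0^\omega$ plus $(\exists^2)$: $(\exists E:\mathbb{N}^{\mathbb{N}}\to\{0,1\})(\forall f\in\mathbb{N}^{\mathbb{N}})[(\exists n\in\mathbb{N})(f(n)=0)\leftrightarrow E(f)=0]$. $\mathsf{QF\text{ - }AC}^{0,1}$: for quantifier-free $\varphi$ with arbitrary parameters, if $(\forall n\in\mathbb{N})(\exists f\in\mathbb{N}^{\mathbb{N}})\varphi(n,f)$ then there is a sequence $(f_n)_{n\in\mathbb{N}}$ in $\mathbb{N}^{\mathbb{N}}$ with $(\forall n)\varphi(n,f_n)$. Reals are fast-converging Cauchy sequences of rationals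 with defined equality $=_{\mathbb{R}}$; functions on reals are third-order objects respecting $=_{\mathbb{R}}$, without codes. Subsets of $\mathbb{R}$ are given by characteristic functions. A set $A\subset\mathbb{R}$ is finite if there is $N\in\mathbb{N}$ such that for any finite sequence $(x_0,\dots,x_N)$ of distinct reals there is $i\le N$ with $x_i\notin A$. $A\subset\mathbb{R}$ is height-countable if there is a height function $H:\mathbb{R}\to\mathbb{N}$ for $A$, i.e. for all $n\in\mathbb{N}$ the set $\{x\in A:H(x)<n\}$ is finite. $f:[0,1]\to\mathbb{R}$ is regulated if the left and right limits $f(x-)$, $f(x+)$ exist everywhere. -}

module Defs where

open import Data.List using (List; []; _∷_; map)
open import Data.List.Membership.Propositional using (_∈_)
open import Data.List.Relation.Unary.Any using (here; there)
open import Data.Sum using (_⊎_)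
open import Relation.Binary.PropositionalEquality using (refl)

infixr 30 _⇒_
infix  40 _↑ _↑² _↑³ _↑F _[_] _[_]F
infixl 10 _,ₛ_
infixl 25 _·_
infixl 22 _⊛_
infixl 21 _⊕_ _⊖_
infixl 21 _-ℚ_ _-ℝ_
infix  19 _≐_ _≤̇_ _<̇_ _<ℚ_ _≤ℚ_ _<ℝ_ _≤ℝ_ _=ℝ_
infixr 17 _∧_
infixr 16 _∨_
infixr 15 _⊃_ _⊃⊂_
infixr 14 ∀[_]_ ∃[_]_
infixr 20 ƛ_
infix  18 ~_
infixl 10 _+ᵀ_
infix  5  _∣_⊢_

data Ty : Set where
  ι   : Ty
  _⇒_ : Ty → Ty → Ty

𝟏 𝟐 : Ty
𝟏 = ι ⇒ ι
𝟐 = 𝟏 ⇒ ι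

Ctx : Set
Ctx = List Ty

-- The combinators Π and Σ are replaced by λ-abstraction with β-equality, which
-- given extensionality is an equivalent presentation.  The only recursor is
-- the one of type ι.

data Tm (Γ : Ctx) : Ty → Set where
  var : ∀ {σ} → σ ∈ Γ → Tm Γ σ
  ƛ_  : ∀ {σ τ} → Tm (σ ∷ Γ) τ → Tm Γ (σ ⇒ τ)
  _·_ : ∀ {σ τ} → Tm Γ (σ ⇒ τ) → Tm Γ σ → Tm Γ τ
  O   : Tm Γ ι
  S   : Tm Γ (ι ⇒ ι)
  R   : Tm Γ (ι ⇒ ι ⇒ (ι ⇒ ι ⇒ ι) ⇒ ι)

-- Equality of type ι is the only primitive predicate.

data Fm (Γ : Ctx) : Set where
  _≐_   : Tm Γ ι → Tm Γ ι → Fm Γ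
  ⊥̇     : Fm Γ
  _∧_   : Fm Γ → Fm Γ → Fm Γ
  _∨_   : Fm Γ → Fm Γ → Fm Γ
  _⊃_   : Fm Γ → Fm Γ → Fm Γ
  ∀[_]_ : ∀ σ → Fm (σ ∷ Γ) → Fm Γ
  ∃[_]_ : ∀ σ → Fm (σ ∷ Γ) → Fm Γ

~_ : ∀ {Γ} → Fm Γ → Fm Γ
~ φ = φ ⊃ ⊥̇

_⊃⊂_ : ∀ {Γ} → Fm Γ → Fm Γ → Fm Γ
φ ⊃⊂ ψ = (φ ⊃ ψ) ∧ (ψ ⊃ φ)

data QF {Γ : Ctx} : Fm Γ → Set where
  eq  : ∀ s t → QF (s ≐ t)
  bot : QF ⊥̇
  and : ∀ {φ ψ} → QF φ → QF ψ → QF (φ ∧ ψ)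
  or  : ∀ {φ ψ} → QF φ → QF ψ → QF (φ ∨ ψ)
  imp : ∀ {φ ψ} → QF φ → QF ψ → QF (φ ⊃ ψ)

Ren Sub : Ctx → Ctx → Set
Ren Γ Δ = ∀ {σ} → σ ∈ Γ → σ ∈ Δ
Sub Γ Δ = ∀ {σ} → σ ∈ Γ → Tm Δ σ

extᴿ : ∀ {Γ Δ σ} → Ren Γ Δ → Ren (σ ∷ Γ) (σ ∷ Δ)
extᴿ ρ (here p)  = here p
extᴿ ρ (there x) = there (ρ x)

ren : ∀ {Γ Δ σ} → Ren Γ Δ → Tm Γ σ → Tm Δ σ
ren ρ (var x) = var (ρ x)
ren ρ (ƛ t)   = ƛ ren (extᴿ ρ) t
ren ρ (s · t) = ren ρ s · ren ρ t
ren ρ O       = O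
ren ρ S       = S
ren ρ R       = R

_↑ : ∀ {Γ σ τ} → Tm Γ σ → Tm (τ ∷ Γ) σ
t ↑ = ren there t

_↑² : ∀ {Γ σ τ₁ τ₂} → Tm Γ σ → Tm (τ₁ ∷ τ₂ ∷ Γ) σ
t ↑² = t ↑ ↑

_↑³ : ∀ {Γ σ τ₁ τ₂ τ₃} → Tm Γ σ → Tm (τ₁ ∷ τ₂ ∷ τ₃ ∷ Γ) σ
t ↑³ = t ↑ ↑ ↑

_,ₛ_ : ∀ {Γ Δ σ} → Sub Γ Δ → Tm Δ σ → Sub (σ ∷ Γ) Δ
(θ ,ₛ t) (here refl) = t
(θ ,ₛ t) (there x)   = θ x

extˢ : ∀ {Γ Δ σ} → Sub Γ Δ → Sub (σ ∷ Γ) (σ ∷ Δ)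
extˢ θ = (λ x → θ x ↑) ,ₛ var (here refl)

sub : ∀ {Γ Δ σ} → Sub Γ Δ → Tm Γ σ → Tm Δ σ
sub θ (var x) = θ x
sub θ (ƛ t)   = ƛ sub (extˢ θ) t
sub θ (s · t) = sub θ s · sub θ t
sub θ O       = O
sub θ S       = S
sub θ R       = R

renF : ∀ {Γ Δ} → Ren Γ Δ → Fm Γ → Fm Δ
renF ρ (s ≐ t)    = ren ρ s ≐ ren ρ t
renF ρ ⊥̇          = ⊥̇
renF ρ (φ ∧ ψ)    = renF ρ φ ∧ renF ρ ψ
renF ρ (φ ∨ ψ)    = renF ρ φ ∨ renF ρ ψ
renF ρ (φ ⊃ ψ)    = renF ρ φ ⊃ renF ρ ψ
renF ρ (∀[ σ ] φ) = ∀[ σ ] renF (extᴿ ρ) φ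
renF ρ (∃[ σ ] φ) = ∃[ σ ] renF (extᴿ ρ) φ

subF : ∀ {Γ Δ} → Sub Γ Δ → Fm Γ → Fm Δ
subF θ (s ≐ t)    = sub θ s ≐ sub θ t
subF θ ⊥̇          = ⊥̇
subF θ (φ ∧ ψ)    = subF θ φ ∧ subF θ ψ
subF θ (φ ∨ ψ)    = subF θ φ ∨ subF θ ψ
subF θ (φ ⊃ ψ)    = subF θ φ ⊃ subF θ ψ
subF θ (∀[ σ ] φ) = ∀[ σ ] subF (extˢ θ) φ
subF θ (∃[ σ ] φ) = ∃[ σ ] subF (extˢ θ) φ

_↑F : ∀ {Γ σ} → Fm Γ → Fm (σ ∷ Γ)
φ ↑F = renF there φ

_[_] : ∀ {Γ σ τ} → Tm (σ ∷ Γ) τ → Tm Γ σ → Tm Γ τ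
t [ s ] = sub (var ,ₛ s) t

_[_]F : ∀ {Γ σ} → Fm (σ ∷ Γ) → Tm Γ σ → Fm Γ
φ [ s ]F = subF (var ,ₛ s) φ

pattern v₀ = var (here refl)
pattern v₁ = var (there (here refl))
pattern v₂ = var (there (there (here refl)))
pattern v₃ = var (there (there (there (here refl))))

-- The variables of an axiom in context Γ are its parameters; asserting it in
-- every context amounts to asserting its universal closure.

Theory : Set₁
Theory = ∀ {Γ} → Fm Γ → Set

_+ᵀ_ : Theory → Theory → Theory
(T +ᵀ U) φ = T φ ⊎ U φ

data _∣_⊢_ (T : Theory) {Γ : Ctx} : List (Fm Γ) → Fm Γ → Set where
  ax  : ∀ {Φ φ} → T φ → T ∣ Φ ⊢ φ
  hyp : ∀ {Φ φ} → φ ∈ Φ → T ∣ Φ ⊢ φ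
  ⊃I  : ∀ {Φ φ ψ} → T ∣ φ ∷ Φ ⊢ ψ → T ∣ Φ ⊢ φ ⊃ ψ
  ⊃E  : ∀ {Φ φ ψ} → T ∣ Φ ⊢ φ ⊃ ψ → T ∣ Φ ⊢ φ → T ∣ Φ ⊢ ψ
  ∧I  : ∀ {Φ φ ψ} → T ∣ Φ ⊢ φ → T ∣ Φ ⊢ ψ → T ∣ Φ ⊢ φ ∧ ψ
  ∧E₁ : ∀ {Φ φ ψ} → T ∣ Φ ⊢ φ ∧ ψ → T ∣ Φ ⊢ φ
  ∧E₂ : ∀ {Φ φ ψ} → T ∣ Φ ⊢ φ ∧ ψ → T ∣ Φ ⊢ ψ
  ∨I₁ : ∀ {Φ φ ψ} → T ∣ Φ ⊢ φ → T ∣ Φ ⊢ φ ∨ ψ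
  ∨I₂ : ∀ {Φ φ ψ} → T ∣ Φ ⊢ ψ → T ∣ Φ ⊢ φ ∨ ψ
  ∨E  : ∀ {Φ φ ψ χ} → T ∣ Φ ⊢ φ ∨ ψ → T ∣ φ ∷ Φ ⊢ χ → T ∣ ψ ∷ Φ ⊢ χ → T ∣ Φ ⊢ χ
  raa : ∀ {Φ φ} → T ∣ (~ φ) ∷ Φ ⊢ ⊥̇ → T ∣ Φ ⊢ φ
  ∀I  : ∀ {Φ σ φ} → T ∣ map _↑F Φ ⊢ φ → T ∣ Φ ⊢ ∀[ σ ] φ
  ∀E  : ∀ {Φ σ φ} → T ∣ Φ ⊢ ∀[ σ ] φ → (t : Tm Γ σ) → T ∣ Φ ⊢ φ [ t ]F
  ∃I  : ∀ {Φ σ φ} (t : Tm Γ σ) → T ∣ Φ ⊢ φ [ t ]F → T ∣ Φ ⊢ ∃[ σ ] φ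
  ∃E  : ∀ {Φ σ φ ψ} → T ∣ Φ ⊢ ∃[ σ ] φ → T ∣ φ ∷ map _↑F Φ ⊢ ψ ↑F → T ∣ Φ ⊢ ψ

-- Equality at higher types is defined, extensionally.

Eq : ∀ {Γ} σ → Tm Γ σ → Tm Γ σ → Fm Γ
Eq ι       s t = s ≐ t
Eq (σ ⇒ τ) s t = ∀[ σ ] Eq τ (s ↑ · v₀) (t ↑ · v₀)

data E-PRAω {Γ : Ctx} : Fm Γ → Set where
  ≐-refl  : ∀ t → E-PRAω (t ≐ t)
  ≐-subst : ∀ φ s t → E-PRAω (s ≐ t ⊃ φ [ s ]F ⊃ φ [ t ]F)
  S≢0     : ∀ t → E-PRAω (~ (S · t ≐ O))
  S-inj   : ∀ s t → E-PRAω (S · s ≐ S · t ⊃ s ≐ t)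
  β       : ∀ {σ τ} (t : Tm (σ ∷ Γ) τ) s → E-PRAω (Eq τ ((ƛ t) · s) (t [ s ]))
  R-zero  : ∀ a f → E-PRAω (R · O · a · f ≐ a)
  R-suc   : ∀ n a f → E-PRAω (R · (S · n) · a · f ≐ f · (R · n · a · f) · n)
  ext     : ∀ {σ τ} (f : Tm Γ (σ ⇒ τ)) s t → E-PRAω (Eq σ s t ⊃ Eq τ (f · s) (f · t))
  QF-IA   : ∀ {φ} → QF φ →
            E-PRAω (φ [ O ]F
                    ∧ (∀[ ι ] φ ⊃ subF ((λ x → var (there x)) ,ₛ (S · v₀)) φ)
                    ⊃ (∀[ ι ] φ))

-- φ has the value as its variable 0 and the argument as its variable 1;
-- in the conclusion these become F · x and x, where x is variable 0 and F is
-- variable 1.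

data QF-AC (σ τ : Ty) {Γ : Ctx} : Fm Γ → Set where
  qf-ac : ∀ {φ : Fm (τ ∷ σ ∷ Γ)} → QF φ →
          QF-AC σ τ ((∀[ σ ] ∃[ τ ] φ)
                     ⊃ (∃[ σ ⇒ τ ] ∀[ σ ]
                         subF (((λ x → var (there (there x))) ,ₛ v₀) ,ₛ (v₁ · v₀)) φ))

data ∃² {Γ : Ctx} : Fm Γ → Set where
  ∃²-ax : ∃² (∃[ 𝟐 ] ∀[ 𝟏 ]
                (v₁ · v₀ ≐ O ∨ v₁ · v₀ ≐ S · O)
                ∧ ((∃[ ι ] v₁ · v₀ ≐ O) ⊃⊂ v₁ · v₀ ≐ O))

RCA₀ω ACA₀ω : Theory
RCA₀ω = E-PRAω +ᵀ QF-AC 𝟏 ι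
ACA₀ω = RCA₀ω +ᵀ ∃²

QF-AC⁰¹ : Theory
QF-AC⁰¹ = QF-AC ι 𝟏

-- The step function of R takes the recursive value first
-- (v₁ below) and the predecessor second (v₀).

_⊕_ _⊖_ _⊛_ : ∀ {Γ} → Tm Γ ι → Tm Γ ι → Tm Γ ι
s ⊕ t = R · t · s · (ƛ ƛ S · v₁)
s ⊖ t = R · t · s · (ƛ ƛ R · v₁ · O · (ƛ ƛ v₀))
s ⊛ t = (ƛ ƛ R · v₀ · O · (ƛ ƛ v₁ ⊕ v₃)) · s · t

_≤̇_ _<̇_ : ∀ {Γ} → Tm Γ ι → Tm Γ ι → Fm Γ
s ≤̇ t = s ⊖ t ≐ O
s <̇ t = S · s ≤̇ t

2^ : ∀ {Γ} → Tm Γ ι → Tm Γ ι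
2^ t = R · t · (S · O) · (ƛ ƛ v₁ ⊕ v₁)

-- tri t = 0 + 1 + ... + t, and root t is the largest r with tri r ≤ t.

tri root : ∀ {Γ} → Tm Γ ι → Tm Γ ι
tri  t = R · t · O · (ƛ ƛ v₁ ⊕ S · v₀)
root t = R · t · O · (ƛ ƛ v₁ ⊕ (S · O ⊖ (tri (S · v₁) ⊖ S · v₀)))

⟪_,_⟫ : ∀ {Γ} → Tm Γ ι → Tm Γ ι → Tm Γ ι
⟪ s , t ⟫ = tri (s ⊕ t) ⊕ t

fst snd : ∀ {Γ} → Tm Γ ι → Tm Γ ι
snd t = t ⊖ tri (root t)
fst t = root t ⊖ snd t

-- Rationals: every number ⟪ p , ⟪ m , d ⟫ ⟫ codes (p − m) / (d + 1); codes are
-- not unique.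

rat : ∀ {Γ} → Tm Γ ι → Tm Γ ι → Tm Γ ι → Tm Γ ι
rat p m d = ⟪ p , ⟪ m , d ⟫ ⟫

pos neg den : ∀ {Γ} → Tm Γ ι → Tm Γ ι
pos q = fst q
neg q = fst (snd q)
den q = S · snd (snd q)

_-ℚ_ : ∀ {Γ} → Tm Γ ι → Tm Γ ι → Tm Γ ι
q -ℚ r = rat (pos q ⊛ den r ⊕ neg r ⊛ den q)
             (neg q ⊛ den r ⊕ pos r ⊛ den q)
             (den q ⊛ den r ⊖ S · O)

absℚ : ∀ {Γ} → Tm Γ ι → Tm Γ ι
absℚ q = rat ((pos q ⊖ neg q) ⊕ (neg q ⊖ pos q)) O (den q ⊖ S · O)

_<ℚ_ _≤ℚ_ : ∀ {Γ} → Tm Γ ι → Tm Γ ι → Fm Γ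
q <ℚ r = pos q ⊛ den r ⊕ neg r ⊛ den q <̇ pos r ⊛ den q ⊕ neg q ⊛ den r
q ≤ℚ r = pos q ⊛ den r ⊕ neg r ⊛ den q ≤̇ pos r ⊛ den q ⊕ neg q ⊛ den r

-- 2⁻ n codes 1/2ⁿ and 2⁻⁺ n codes 2/2ⁿ.

2⁻ 2⁻⁺ : ∀ {Γ} → Tm Γ ι → Tm Γ ι
2⁻  n = rat (S · O) O (2^ n ⊖ S · O)
2⁻⁺ n = rat (S · (S · O)) O (2^ n ⊖ S · O)

Real : ∀ {Γ} → Tm Γ 𝟏 → Fm Γ
Real x = ∀[ ι ] ∀[ ι ] absℚ (x ↑² · v₁ -ℚ x ↑² · (v₁ ⊕ v₀)) <ℚ 2⁻ v₁

-- As |x n − x| ≤ 1/2ⁿ, equality and strict order compare approximations up to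
-- the sum 2/2ⁿ of two such errors.

_=ℝ_ _<ℝ_ _≤ℝ_ : ∀ {Γ} → Tm Γ 𝟏 → Tm Γ 𝟏 → Fm Γ
x =ℝ y = ∀[ ι ] absℚ (x ↑ · v₀ -ℚ y ↑ · v₀) ≤ℚ 2⁻⁺ v₀
x <ℝ y = ∃[ ι ] 2⁻⁺ v₀ <ℚ (y ↑ · v₀ -ℚ x ↑ · v₀)
x ≤ℝ y = ~ (y <ℝ x)

-- The index shift restores the rate of convergence.

_-ℝ_ : ∀ {Γ} → Tm Γ 𝟏 → Tm Γ 𝟏 → Tm Γ 𝟏
x -ℝ y = (ƛ ƛ ƛ v₂ · (S · v₀) -ℚ v₁ · (S · v₀)) · x · y

absℝ : ∀ {Γ} → Tm Γ 𝟏 → Tm Γ 𝟏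
absℝ x = (ƛ ƛ absℚ (v₁ · v₀)) · x

ratℝ : ∀ {Γ} → Tm Γ ι → Tm Γ 𝟏
ratℝ q = (ƛ ƛ v₁) · q

0ℝ 1ℝ : ∀ {Γ} → Tm Γ 𝟏
0ℝ = ratℝ (rat O O O)
1ℝ = ratℝ (rat (S · O) O O)

-- |x − y| < 1/2ᵏ

Near : ∀ {Γ} → Tm Γ 𝟏 → Tm Γ 𝟏 → Tm Γ ι → Fm Γ
Near x y k = absℝ (x -ℝ y) <ℝ ratℝ (2⁻ k)

∈I : ∀ {Γ} → Tm Γ 𝟏 → Fm Γ
∈I x = Real x ∧ 0ℝ ≤ℝ x ∧ x ≤ℝ 1ℝ

Function : ∀ {Γ} → Tm Γ (𝟏 ⇒ 𝟏) → Fm Γ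
Function f =
  (∀[ 𝟏 ] ∈I v₀ ⊃ Real (f ↑ · v₀))
  ∧ (∀[ 𝟏 ] ∀[ 𝟏 ] ∈I v₁ ∧ ∈I v₀ ∧ v₁ =ℝ v₀ ⊃ f ↑² · v₁ =ℝ f ↑² · v₀)

-- "y is the left (right) limit of f at x": for all k (v₂) there is N (v₁) such
-- that all z (v₀) in [0,1] on the given side of x with |z − x| < 1/2ᴺ satisfy
-- |f z − y| < 1/2ᵏ.

LeftLimit RightLimit : ∀ {Γ} → Tm Γ (𝟏 ⇒ 𝟏) → Tm Γ 𝟏 → Tm Γ 𝟏 → Fm Γ
LeftLimit f x y = ∀[ ι ] ∃[ ι ] ∀[ 𝟏 ]
  ∈I v₀ ∧ v₀ <ℝ x ↑³ ∧ Near v₀ (x ↑³) v₁ ⊃ Near (f ↑³ · v₀) (y ↑³) v₂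
RightLimit f x y = ∀[ ι ] ∃[ ι ] ∀[ 𝟏 ]
  ∈I v₀ ∧ x ↑³ <ℝ v₀ ∧ Near v₀ (x ↑³) v₁ ⊃ Near (f ↑³ · v₀) (y ↑³) v₂

-- At x = 0 the condition on left limits holds vacuously, as does the one on
-- right limits at x = 1.

Regulated : ∀ {Γ} → Tm Γ (𝟏 ⇒ 𝟏) → Fm Γ
Regulated f = ∀[ 𝟏 ] ∈I v₀ ⊃
  (∃[ 𝟏 ] Real v₀ ∧ LeftLimit (f ↑²) v₁ v₀)
  ∧ (∃[ 𝟏 ] Real v₀ ∧ RightLimit (f ↑²) v₁ v₀)

ContinuousAt : ∀ {Γ} → Tm Γ (𝟏 ⇒ 𝟏) → Tm Γ 𝟏 → Fm Γ
ContinuousAt f x = ∀[ ι ] ∃[ ι ] ∀[ 𝟏 ]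
  ∈I v₀ ∧ Near v₀ (x ↑³) v₁ ⊃ Near (f ↑³ · v₀) (f ↑³ · x ↑³) v₂

RegulatedNotTotallyDiscontinuous : Fm []
RegulatedNotTotallyDiscontinuous = ∀[ 𝟏 ⇒ 𝟏 ]
  Function v₀ ∧ Regulated v₀ ⊃ (∃[ 𝟏 ] ∈I v₀ ∧ ContinuousAt v₁ v₀)

-- A set A of reals enters through its membership formula, whose variable 0 is
-- the element.  When membership is decided by a characteristic function a with
-- values in {0,1}, this is the formula a · v₀ ≐ S · O.

-- A finite sequence (x₀,…,x_N) is given by N and an object of type ι ⇒ 𝟏 of
-- which only the first N + 1 entries matter.  In the last conjunct v₀ is i, v₁
-- is the sequence and v₂ is N.

Finite : ∀ {Γ} → Fm (𝟏 ∷ Γ) → Fm Γ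
Finite A = ∃[ ι ] ∀[ ι ⇒ 𝟏 ]
  (∀[ ι ] v₀ ≤̇ v₂ ⊃ Real (v₁ · v₀))
  ∧ (∀[ ι ] ∀[ ι ] v₁ <̇ v₀ ∧ v₀ ≤̇ v₃ ⊃ ~ (v₂ · v₁ =ℝ v₂ · v₀))
  ⊃ (∃[ ι ] v₀ ≤̇ v₂
            ∧ ~ subF ((λ x → var (there (there (there x)))) ,ₛ (v₁ · v₀)) A)

-- H : ℝ → ℕ is the variable 0 of the body, and n is bound inside it; A is
-- weakened past both while keeping its own element variable.

HeightCountable : ∀ {Γ} → Fm (𝟏 ∷ Γ) → Fm Γ
HeightCountable A = ∃[ 𝟐 ]
  (∀[ 𝟏 ] ∀[ 𝟏 ] Real v₁ ∧ Real v₀ ∧ v₁ =ℝ v₀ ⊃ v₂ · v₁ ≐ v₂ · v₀)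
  ∧ (∀[ ι ] Finite (renF (extᴿ (λ x → there (there x))) A ∧ v₂ · v₀ <̇ v₁))

NIN-alt : Fm []
NIN-alt = ~ HeightCountable (∈I v₀)

{-# OPTIONS --safe #-}

-- (i) ⇒ (ii).  If H is a height function for [0,1], then f x = 2⁻ᴴ⁽ˣ⁾ has
-- one-sided limits 0 everywhere and positive values, so it is continuous
-- nowhere.  That points of height below k do not accumulate at x needs a
-- sequence of witnesses, from QF-AC⁰¹, and a subsequence of distinct members.
--
-- (ii) ⇒ (i).  If a regulated f is continuous nowhere, let H x be the least k
-- for which f oscillates by 2⁻ᵏ at x over rational points; this condition is
-- arithmetical, so QF-AC¹⁰ and (∃²) provide H.  If infinitely many points had
-- height below n, QF-AC⁰¹ would choose ever longer finite lists of them, these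
-- would accumulate somewhere (bisection and counting), and f would have no
-- one-sided limit there.
--
-- The derivation itself is carried out in a second syntax with named
-- eigenvariables.  A statement proved for every term in place of x holds in
-- particular for a fresh name, hence universally, so the quantifier rules take
-- Agda functions and hypotheses need no renaming.
module Submission where

open import Defs
open import Algebra.Bundles using (CommutativeMonoid; CommutativeSemiring)
open import Algebra.Structures.Biased using (isCommutativeSemiringˡ)
open import Data.Bool using (Bool; T; false; true) renaming (_∧_ to _&&_)
open import Data.Empty using (⊥-elim)
open import Data.List using (List; []; _∷_; map)
open import Data.List.Membership.Propositional using (_∈_)
open import Data.List.Membership.Propositional.Properties using (∈-map⁺; ∈-map⁻)
open import Data.List.Relation.Unary.Any using (here; there)
open import Data.Nat using (_<_; _≟_; _≤_; _⊔_; suc; zero; z≤n; ℕ)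
open import Data.Nat.Properties using (<-irrefl; m≤m⊔n; m≤n⊔m; m⊔n≤o⇒m≤o; m⊔n≤o⇒n≤o; ≤-refl; ≤-trans)
open import Data.Product using (_,_; _×_; proj₁; proj₂)
open import Data.Sum using (inj₁; inj₂)
open import Level using (0ℓ)
open import Relation.Binary using (IsEquivalence)
open import Relation.Binary.PropositionalEquality using (_≡_; cong; cong₂; refl; subst; subst₂; sym; trans)
open import Relation.Nullary using (Dec; no; yes)
import Algebra.Solver.CommutativeMonoid
import Algebra.Solver.Ring.NaturalCoefficients.Default

-- Renaming and substitution of raw terms and formulas

-- The theory has induction and choice for quantifier-free formulas only, and a recursor of type 0.
-- The analysis has to fit into this, and `∃²` makes the room: every formula whose quantifiers range
-- over numbers becomes an equation `⌈ φ ⌉ ≈ 𝟎`, to which these axioms apply. Finite sets are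
-- therefore handled by counting the zeros of characteristic functions, and the bisection records
-- only rational endpoints. Choice also dictates the shape of the data. `QF-AC⁰¹` delivers one
-- element of Baire space for each number, so a point together with a number, or a whole list of
-- points, is packed into a single function. A functional obtained from `QF-AC¹⁰` respects pointwise
-- equality of sequences, but nothing in the axiom makes it respect equality of reals; the height
-- function does so because its values are pinned down as least numbers.

ren-cong : ∀ {Γ Δ σ} {ρ ρ' : Ren Γ Δ} → (∀ {τ} (x : τ ∈ Γ) → ρ x ≡ ρ' x) →
           (t : Tm Γ σ) → ren ρ t ≡ ren ρ' t
ren-cong e (var x) = cong var (e x)
ren-cong e (ƛ t)   = cong ƛ_ (ren-cong (λ { (here refl) → refl ; (there x) → cong there (e x) }) t)
ren-cong e (s · t) = cong₂ _·_ (ren-cong e s) (ren-cong e t)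
ren-cong e O       = refl
ren-cong e S       = refl
ren-cong e R       = refl

ren-ren : ∀ {Γ Δ Ξ σ} (ρ : Ren Γ Δ) (ρ' : Ren Δ Ξ) (t : Tm Γ σ) →
          ren ρ' (ren ρ t) ≡ ren (λ x → ρ' (ρ x)) t
ren-ren ρ ρ' (var x) = refl
ren-ren ρ ρ' (ƛ t)   = cong ƛ_ (trans (ren-ren (extᴿ ρ) (extᴿ ρ') t)
  (ren-cong (λ { (here refl) → refl ; (there x) → refl }) t))
ren-ren ρ ρ' (s · t) = cong₂ _·_ (ren-ren ρ ρ' s) (ren-ren ρ ρ' t)
ren-ren ρ ρ' O       = refl
ren-ren ρ ρ' S       = refl
ren-ren ρ ρ' R       = refl

sub-cong : ∀ {Γ Δ σ} {θ θ' : Sub Γ Δ} → (∀ {τ} (x : τ ∈ Γ) → θ x ≡ θ' x) →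
           (t : Tm Γ σ) → sub θ t ≡ sub θ' t
sub-cong e (var x) = e x
sub-cong e (ƛ t)   = cong ƛ_ (sub-cong (λ { (here refl) → refl ; (there x) → cong _↑ (e x) }) t)
sub-cong e (s · t) = cong₂ _·_ (sub-cong e s) (sub-cong e t)
sub-cong e O       = refl
sub-cong e S       = refl
sub-cong e R       = refl

sub-ren : ∀ {Γ Δ Ξ σ} (ρ : Ren Γ Δ) (θ : Sub Δ Ξ) (t : Tm Γ σ) →
          sub θ (ren ρ t) ≡ sub (λ x → θ (ρ x)) t
sub-ren ρ θ (var x) = refl
sub-ren ρ θ (ƛ t)   = cong ƛ_ (trans (sub-ren (extᴿ ρ) (extˢ θ) t)
  (sub-cong (λ { (here refl) → refl ; (there x) → refl }) t))
sub-ren ρ θ (s · t) = cong₂ _·_ (sub-ren ρ θ s) (sub-ren ρ θ t)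
sub-ren ρ θ O       = refl
sub-ren ρ θ S       = refl
sub-ren ρ θ R       = refl

ren-↑ : ∀ {Γ Δ σ τ} (ρ : Ren Γ Δ) (t : Tm Γ σ) → ren (extᴿ {σ = τ} ρ) (t ↑) ≡ (ren ρ t) ↑
ren-↑ ρ t = trans (ren-ren there (extᴿ ρ) t) (sym (ren-ren ρ there t))

ren-sub : ∀ {Γ Δ Ξ σ} (θ : Sub Γ Δ) (ρ : Ren Δ Ξ) (t : Tm Γ σ) →
          ren ρ (sub θ t) ≡ sub (λ x → ren ρ (θ x)) t
ren-sub θ ρ (var x) = refl
ren-sub θ ρ (ƛ t)   = cong ƛ_ (trans (ren-sub (extˢ θ) (extᴿ ρ) t)
  (sub-cong (λ { (here refl) → refl ; (there x) → ren-↑ ρ (θ x) }) t))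
ren-sub θ ρ (s · t) = cong₂ _·_ (ren-sub θ ρ s) (ren-sub θ ρ t)
ren-sub θ ρ O       = refl
ren-sub θ ρ S       = refl
ren-sub θ ρ R       = refl

sub-↑ : ∀ {Γ Δ σ τ} (θ : Sub Γ Δ) (t : Tm Γ σ) → sub (extˢ {σ = τ} θ) (t ↑) ≡ (sub θ t) ↑
sub-↑ θ t = trans (sub-ren there (extˢ θ) t) (sym (ren-sub θ there t))

sub-var : ∀ {Γ σ} (θ : Sub Γ Γ) → (∀ {τ} (x : τ ∈ Γ) → θ x ≡ var x) →
          (t : Tm Γ σ) → sub θ t ≡ t
sub-var θ e (var x) = e x
sub-var θ e (ƛ t)   = cong ƛ_ (sub-var (extˢ θ) (λ { (here refl) → refl ; (there x) → cong _↑ (e x) }) t)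
sub-var θ e (s · t) = cong₂ _·_ (sub-var θ e s) (sub-var θ e t)
sub-var θ e O       = refl
sub-var θ e S       = refl
sub-var θ e R       = refl

↑-[] : ∀ {Γ σ τ} (t : Tm Γ σ) (s : Tm Γ τ) → (t ↑) [ s ] ≡ t
↑-[] t s = trans (sub-ren there (var ,ₛ s) t) (sub-var (λ x → var x) (λ _ → refl) t)

-- Reduces renaming to substitution, so that evaluation has to be shown to commute with substitution
-- only.
ren≡sub : ∀ {Γ Δ σ} (ρ : Ren Γ Δ) (t : Tm Γ σ) → ren ρ t ≡ sub (λ x → var (ρ x)) t
ren≡sub ρ (var x) = refl
ren≡sub ρ (ƛ t)   = cong ƛ_ (trans (ren≡sub (extᴿ ρ) t)
  (sub-cong (λ { (here refl) → refl ; (there x) → refl }) t))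
ren≡sub ρ (s · t) = cong₂ _·_ (ren≡sub ρ s) (ren≡sub ρ t)
ren≡sub ρ O       = refl
ren≡sub ρ S       = refl
ren≡sub ρ R       = refl

subF-cong : ∀ {Γ Δ} {θ θ' : Sub Γ Δ} → (∀ {τ} (x : τ ∈ Γ) → θ x ≡ θ' x) →
            (φ : Fm Γ) → subF θ φ ≡ subF θ' φ
subF-cong e (s ≐ t)    = cong₂ _≐_ (sub-cong e s) (sub-cong e t)
subF-cong e ⊥̇          = refl
subF-cong e (φ ∧ ψ)    = cong₂ _∧_ (subF-cong e φ) (subF-cong e ψ)
subF-cong e (φ ∨ ψ)    = cong₂ _∨_ (subF-cong e φ) (subF-cong e ψ)
subF-cong e (φ ⊃ ψ)    = cong₂ _⊃_ (subF-cong e φ) (subF-cong e ψ)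
subF-cong e (∀[ σ ] φ) = cong (∀[ σ ]_) (subF-cong (λ { (here refl) → refl ; (there x) → cong _↑ (e x) }) φ)
subF-cong e (∃[ σ ] φ) = cong (∃[ σ ]_) (subF-cong (λ { (here refl) → refl ; (there x) → cong _↑ (e x) }) φ)

renF≡subF : ∀ {Γ Δ} (ρ : Ren Γ Δ) (φ : Fm Γ) → renF ρ φ ≡ subF (λ x → var (ρ x)) φ
renF≡subF ρ (s ≐ t)    = cong₂ _≐_ (ren≡sub ρ s) (ren≡sub ρ t)
renF≡subF ρ ⊥̇          = refl
renF≡subF ρ (φ ∧ ψ)    = cong₂ _∧_ (renF≡subF ρ φ) (renF≡subF ρ ψ)
renF≡subF ρ (φ ∨ ψ)    = cong₂ _∨_ (renF≡subF ρ φ) (renF≡subF ρ ψ)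
renF≡subF ρ (φ ⊃ ψ)    = cong₂ _⊃_ (renF≡subF ρ φ) (renF≡subF ρ ψ)
renF≡subF ρ (∀[ σ ] φ) = cong (∀[ σ ]_) (trans (renF≡subF (extᴿ ρ) φ)
  (subF-cong (λ { (here refl) → refl ; (there x) → refl }) φ))
renF≡subF ρ (∃[ σ ] φ) = cong (∃[ σ ]_) (trans (renF≡subF (extᴿ ρ) φ)
  (subF-cong (λ { (here refl) → refl ; (there x) → refl }) φ))

-- Characteristic terms of raw arithmetical formulas, relative to a term e for
-- the functional of (∃²): χ e φ is zero exactly when φ holds.

not : ∀ {Γ} → Tm Γ ι → Tm Γ ι
not t = R · t · (S · O) · (ƛ ƛ O)

χ : ∀ {Γ} → Tm Γ 𝟐 → Fm Γ → Tm Γ ι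
χ e (s ≐ t)    = (s ⊖ t) ⊕ (t ⊖ s)
χ e ⊥̇          = S · O
χ e (φ ∧ ψ)    = χ e φ ⊕ χ e ψ
-- The recursor serves as a test for zero. If `χ e φ` is zero, `not` makes the tested number
-- positive and the value is zero; otherwise the value is that of `χ e ψ`.
χ e (φ ∨ ψ)    = R · not (χ e φ) · χ e ψ · (ƛ ƛ O)
χ e (φ ⊃ ψ)    = R · χ e φ · χ e ψ · (ƛ ƛ O)
χ e (∀[ ι ] φ) = not (e · (ƛ not (χ (e ↑) φ)))
χ e (∃[ ι ] φ) = e · (ƛ χ (e ↑) φ)
-- Junk values: quantifiers over functions are excluded by `isAr` wherever the meaning of `χ`
-- matters.
χ e (∀[ _ ⇒ _ ] φ) = O
χ e (∃[ _ ⇒ _ ] φ) = O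

sub-χ : ∀ {Γ Δ} (θ : Sub Γ Δ) (e : Tm Γ 𝟐) (φ : Fm Γ) →
        sub θ (χ e φ) ≡ χ (sub θ e) (subF θ φ)
sub-χ θ e (s ≐ t)    = refl
sub-χ θ e ⊥̇          = refl
sub-χ θ e (φ ∧ ψ)    = cong₂ _⊕_ (sub-χ θ e φ) (sub-χ θ e ψ)
sub-χ θ e (φ ∨ ψ)    = cong₂ (λ a b → R · not a · b · (ƛ ƛ O)) (sub-χ θ e φ) (sub-χ θ e ψ)
sub-χ θ e (φ ⊃ ψ)    = cong₂ (λ a b → R · a · b · (ƛ ƛ O)) (sub-χ θ e φ) (sub-χ θ e ψ)
sub-χ θ e (∀[ ι ] φ) = cong (λ a → not (sub θ e · (ƛ not a)))
  (trans (sub-χ (extˢ θ) (e ↑) φ) (cong (λ a → χ a (subF (extˢ θ) φ)) (sub-↑ θ e)))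
sub-χ θ e (∃[ ι ] φ) = cong (λ a → sub θ e · (ƛ a))
  (trans (sub-χ (extˢ θ) (e ↑) φ) (cong (λ a → χ a (subF (extˢ θ) φ)) (sub-↑ θ e)))
sub-χ θ e (∀[ _ ⇒ _ ] φ) = refl
sub-χ θ e (∃[ _ ⇒ _ ] φ) = refl

-- A second syntax for reasoning inside the theory.  It has the arithmetical
-- operations of Defs as function symbols, so that terms stay small, names nm n
-- of every type as eigenvariables, an operation clo that embeds closed terms
-- under binders so that substitution need not traverse them,
-- characteristic terms ⌈ φ ⌉, and defined predicates atom P ts, whose
-- definition P substitution leaves alone.

data Un : Set where
  twoᵘ sndᵘ fstᵘ triᵘ rootᵘ absᵘ halfᵘ dblᵘ : Un

data Bi : Set where
  plusᵇ monusᵇ timesᵇ pairᵇ subᵇ addᵇ : Bi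

data Rl : Set where
  ltʳ leʳ : Rl

infixl 25 _∙_
infix  19 _≈_
infixr 17 _∧′_
infixr 16 _∨′_
infixr 15 _⇒′_

infixr 5 _∷ᵃ_

data Fo (Δ : Ctx) : Set
data Tes (Δ : Ctx) : Ctx → Set

data Te (Δ : Ctx) : Ty → Set where
  bv  : ∀ {σ} → σ ∈ Δ → Te Δ σ
  nm  : ∀ {σ} → ℕ → Te Δ σ
  clo : ∀ {σ} → Te [] σ → Te Δ σ
  lam : ∀ {σ τ} → Te (σ ∷ Δ) τ → Te Δ (σ ⇒ τ)
  _∙_ : ∀ {σ τ} → Te Δ (σ ⇒ τ) → Te Δ σ → Te Δ τ
  𝟎   : Te Δ ι
  suc′ : Te Δ (ι ⇒ ι)
  rec′ : Te Δ (ι ⇒ ι ⇒ (ι ⇒ ι ⇒ ι) ⇒ ι)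
  un  : Un → Te Δ ι → Te Δ ι
  bin : Bi → Te Δ ι → Te Δ ι → Te Δ ι
  ⌈_⌉ : Fo Δ → Te Δ ι

data Fo Δ where
  _≈_ : Te Δ ι → Te Δ ι → Fo Δ
  rel : Rl → Te Δ ι → Te Δ ι → Fo Δ
  ⊥′  : Fo Δ
  _∧′_ _∨′_ _⇒′_ : Fo Δ → Fo Δ → Fo Δ
  ∀′ ∃′ : ∀ σ → Fo (σ ∷ Δ) → Fo Δ
  atom : ∀ {Ξ} → Fo Ξ → Tes Δ Ξ → Fo Δ

data Tes Δ where
  ∅ᵃ   : Tes Δ []
  _∷ᵃ_ : ∀ {σ Ξ} → Te Δ σ → Tes Δ Ξ → Tes Δ (σ ∷ Ξ)

renTe : ∀ {Δ Δ' σ} → Ren Δ Δ' → Te Δ σ → Te Δ' σ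
renFo : ∀ {Δ Δ'} → Ren Δ Δ' → Fo Δ → Fo Δ'
renTes : ∀ {Δ Δ' Ξ} → Ren Δ Δ' → Tes Δ Ξ → Tes Δ' Ξ
renTe ρ (bv x)      = bv (ρ x)
renTe ρ (nm n)      = nm n
renTe ρ (clo t)     = clo t
renTe ρ (lam t)     = lam (renTe (extᴿ ρ) t)
renTe ρ (s ∙ t)     = renTe ρ s ∙ renTe ρ t
renTe ρ 𝟎           = 𝟎
renTe ρ suc′        = suc′
renTe ρ rec′        = rec′
renTe ρ (un f t)    = un f (renTe ρ t)
renTe ρ (bin f s t) = bin f (renTe ρ s) (renTe ρ t)
renTe ρ ⌈ φ ⌉       = ⌈ renFo ρ φ ⌉
renFo ρ (s ≈ t)     = renTe ρ s ≈ renTe ρ t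
renFo ρ (rel r s t) = rel r (renTe ρ s) (renTe ρ t)
renFo ρ ⊥′          = ⊥′
renFo ρ (φ ∧′ ψ)    = renFo ρ φ ∧′ renFo ρ ψ
renFo ρ (φ ∨′ ψ)    = renFo ρ φ ∨′ renFo ρ ψ
renFo ρ (φ ⇒′ ψ)    = renFo ρ φ ⇒′ renFo ρ ψ
renFo ρ (∀′ σ φ)    = ∀′ σ (renFo (extᴿ ρ) φ)
renFo ρ (∃′ σ φ)    = ∃′ σ (renFo (extᴿ ρ) φ)
renFo ρ (atom P ts) = atom P (renTes ρ ts)
renTes ρ ∅ᵃ         = ∅ᵃ
renTes ρ (t ∷ᵃ ts)  = renTe ρ t ∷ᵃ renTes ρ ts

-- On a closed term the shift is clo, so that instantiating it gives back the
-- term itself.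

sh : ∀ {Δ σ τ} → Te Δ σ → Te (τ ∷ Δ) σ
sh {[]}    t = clo t
sh {_ ∷ _} t = renTe there t

open′ : ∀ {Δ σ} → Te [] σ → Te Δ σ
open′ {[]}    t = t
open′ {_ ∷ _} t = clo t

Sb : Ctx → Ctx → Set
Sb Δ Δ' = ∀ {σ} → σ ∈ Δ → Te Δ' σ

exts : ∀ {Δ Δ' τ} → Sb Δ Δ' → Sb (τ ∷ Δ) (τ ∷ Δ')
exts θ (here refl) = bv (here refl)
exts θ (there x)   = sh (θ x)

subTe : ∀ {Δ Δ' σ} → Sb Δ Δ' → Te Δ σ → Te Δ' σ
subFo : ∀ {Δ Δ'} → Sb Δ Δ' → Fo Δ → Fo Δ'
subTes : ∀ {Δ Δ' Ξ} → Sb Δ Δ' → Tes Δ Ξ → Tes Δ' Ξ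
subTe θ (bv x)      = θ x
subTe θ (nm n)      = nm n
subTe θ (clo t)     = open′ t
subTe θ (lam t)     = lam (subTe (exts θ) t)
subTe θ (s ∙ t)     = subTe θ s ∙ subTe θ t
subTe θ 𝟎           = 𝟎
subTe θ suc′        = suc′
subTe θ rec′        = rec′
subTe θ (un f t)    = un f (subTe θ t)
subTe θ (bin f s t) = bin f (subTe θ s) (subTe θ t)
subTe θ ⌈ φ ⌉       = ⌈ subFo θ φ ⌉
subFo θ (s ≈ t)     = subTe θ s ≈ subTe θ t
subFo θ (rel r s t) = rel r (subTe θ s) (subTe θ t)
subFo θ ⊥′          = ⊥′
subFo θ (φ ∧′ ψ)    = subFo θ φ ∧′ subFo θ ψ
subFo θ (φ ∨′ ψ)    = subFo θ φ ∨′ subFo θ ψ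
subFo θ (φ ⇒′ ψ)    = subFo θ φ ⇒′ subFo θ ψ
subFo θ (∀′ σ φ)    = ∀′ σ (subFo (exts θ) φ)
subFo θ (∃′ σ φ)    = ∃′ σ (subFo (exts θ) φ)
subFo θ (atom P ts) = atom P (subTes θ ts)
subTes θ ∅ᵃ         = ∅ᵃ
subTes θ (t ∷ᵃ ts)  = subTe θ t ∷ᵃ subTes θ ts

args : ∀ {Δ Ξ} → Tes Δ Ξ → Sb Ξ Δ
args (t ∷ᵃ ts) (here refl) = t
args (t ∷ᵃ ts) (there x)   = args ts x

inst : ∀ {σ} → Te [] σ → Sb (σ ∷ []) []
inst a (here refl) = a
inst a (there ())

infix 40 _[_]ᵗ _[_]ᶠ

_[_]ᵗ : ∀ {σ τ} → Te (σ ∷ []) τ → Te [] σ → Te [] τ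
t [ a ]ᵗ = subTe (inst a) t

_[_]ᶠ : ∀ {σ} → Fo (σ ∷ []) → Te [] σ → Fo []
φ [ a ]ᶠ = subFo (inst a) φ

-- Evaluation into the raw syntax

infixl 21 _+ℚ_

-- The statement of the theorem involves only differences of rationals. Sums are added because up to
-- equality of value they form a commutative monoid, which makes estimates accessible to a solver.
_+ℚ_ : ∀ {Γ} → Tm Γ ι → Tm Γ ι → Tm Γ ι
q +ℚ r = rat (pos q ⊛ den r ⊕ pos r ⊛ den q)
             (neg q ⊛ den r ⊕ neg r ⊛ den q)
             (den q ⊛ den r ⊖ S · O)

opaque
  ⟦_⟧ᵘ : Un → ∀ {Γ} → Tm Γ ι → Tm Γ ι
  ⟦ twoᵘ ⟧ᵘ  = 2^
  ⟦ sndᵘ ⟧ᵘ  = snd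
  ⟦ fstᵘ ⟧ᵘ  = fst
  ⟦ triᵘ ⟧ᵘ  = tri
  ⟦ rootᵘ ⟧ᵘ = root
  ⟦ absᵘ ⟧ᵘ  = absℚ
  ⟦ halfᵘ ⟧ᵘ = 2⁻
  ⟦ dblᵘ ⟧ᵘ  = 2⁻⁺

  ⟦_⟧ᵇ : Bi → ∀ {Γ} → Tm Γ ι → Tm Γ ι → Tm Γ ι
  ⟦ plusᵇ ⟧ᵇ  = _⊕_
  ⟦ monusᵇ ⟧ᵇ = _⊖_
  ⟦ timesᵇ ⟧ᵇ = _⊛_
  ⟦ pairᵇ ⟧ᵇ  = ⟪_,_⟫
  ⟦ subᵇ ⟧ᵇ   = _-ℚ_
  ⟦ addᵇ ⟧ᵇ   = _+ℚ_

  ⟦_⟧ʳ : Rl → ∀ {Γ} → Tm Γ ι → Tm Γ ι → Fm Γ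
  ⟦ ltʳ ⟧ʳ = _<ℚ_
  ⟦ leʳ ⟧ʳ = _≤ℚ_

opaque
  unfolding ⟦_⟧ᵘ ⟦_⟧ᵇ ⟦_⟧ʳ

  sub-un : ∀ {Γ Δ} (θ : Sub Γ Δ) f t → sub θ (⟦ f ⟧ᵘ t) ≡ ⟦ f ⟧ᵘ (sub θ t)
  sub-un θ twoᵘ t  = refl
  sub-un θ sndᵘ t  = refl
  sub-un θ fstᵘ t  = refl
  sub-un θ triᵘ t  = refl
  sub-un θ rootᵘ t = refl
  sub-un θ absᵘ t  = refl
  sub-un θ halfᵘ t = refl
  sub-un θ dblᵘ t  = refl

  sub-bin : ∀ {Γ Δ} (θ : Sub Γ Δ) f s t → sub θ (⟦ f ⟧ᵇ s t) ≡ ⟦ f ⟧ᵇ (sub θ s) (sub θ t)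
  sub-bin θ plusᵇ s t  = refl
  sub-bin θ monusᵇ s t = refl
  sub-bin θ timesᵇ s t = refl
  sub-bin θ pairᵇ s t  = refl
  sub-bin θ subᵇ s t   = refl
  sub-bin θ addᵇ s t   = refl

  sub-rel : ∀ {Γ Δ} (θ : Sub Γ Δ) r s t → subF θ (⟦ r ⟧ʳ s t) ≡ ⟦ r ⟧ʳ (sub θ s) (sub θ t)
  sub-rel θ ltʳ s t = refl
  sub-rel θ leʳ s t = refl

Env : Ctx → Set
Env Γ = ∀ σ → ℕ → Tm Γ σ

∅ˢ : ∀ {Γ} → Sub [] Γ
∅ˢ ()

_⇑ : ∀ {Γ τ} → Env Γ → Env (τ ∷ Γ)
(ε ⇑) σ n = ε σ n ↑

eval : ∀ {Γ Δ σ} → Env Γ → Sub Δ Γ → Te Δ σ → Tm Γ σ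
evalF : ∀ {Γ Δ} → Env Γ → Sub Δ Γ → Fo Δ → Fm Γ
evals : ∀ {Γ Δ Ξ} → Env Γ → Sub Δ Γ → Tes Δ Ξ → Sub Ξ Γ
eval ε δ (bv x)      = δ x
eval ε δ (nm n)      = ε _ n
eval ε δ (clo t)     = eval ε ∅ˢ t
eval ε δ (lam t)     = ƛ eval (ε ⇑) (extˢ δ) t
eval ε δ (s ∙ t)     = eval ε δ s · eval ε δ t
eval ε δ 𝟎           = O
eval ε δ suc′        = S
eval ε δ rec′        = R
eval ε δ (un f t)    = ⟦ f ⟧ᵘ (eval ε δ t)
eval ε δ (bin f s t) = ⟦ f ⟧ᵇ (eval ε δ s) (eval ε δ t)
eval ε δ ⌈ φ ⌉       = χ (ε 𝟐 0) (evalF ε δ φ)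
evalF ε δ (s ≈ t)     = eval ε δ s ≐ eval ε δ t
evalF ε δ (rel r s t) = ⟦ r ⟧ʳ (eval ε δ s) (eval ε δ t)
evalF ε δ ⊥′          = ⊥̇
evalF ε δ (φ ∧′ ψ)    = evalF ε δ φ ∧ evalF ε δ ψ
evalF ε δ (φ ∨′ ψ)    = evalF ε δ φ ∨ evalF ε δ ψ
evalF ε δ (φ ⇒′ ψ)    = evalF ε δ φ ⊃ evalF ε δ ψ
evalF ε δ (∀′ σ φ)    = ∀[ σ ] evalF (ε ⇑) (extˢ δ) φ
evalF ε δ (∃′ σ φ)    = ∃[ σ ] evalF (ε ⇑) (extˢ δ) φ
evalF ε δ (atom P ts) = evalF ε (evals ε δ ts) P
evals ε δ ∅ᵃ          = ∅ˢ
evals ε δ (t ∷ᵃ ts)   = evals ε δ ts ,ₛ eval ε δ t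

-- Name 0 of type 𝟐 stands for the functional of (∃²); ⌈ φ ⌉ uses it implicitly.

bound : ∀ {Δ σ} → Te Δ σ → ℕ
boundF : ∀ {Δ} → Fo Δ → ℕ
bound* : ∀ {Δ Ξ} → Tes Δ Ξ → ℕ
bound (bv x)      = 0
bound (nm n)      = suc n
bound (clo t)     = bound t
bound (lam t)     = bound t
bound (s ∙ t)     = bound s ⊔ bound t
bound 𝟎           = 0
bound suc′        = 0
bound rec′        = 0
bound (un f t)    = bound t
bound (bin f s t) = bound s ⊔ bound t
bound ⌈ φ ⌉       = 1 ⊔ boundF φ
boundF (s ≈ t)     = bound s ⊔ bound t
boundF (rel r s t) = bound s ⊔ bound t
boundF ⊥′          = 0
boundF (φ ∧′ ψ)    = boundF φ ⊔ boundF ψ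
boundF (φ ∨′ ψ)    = boundF φ ⊔ boundF ψ
boundF (φ ⇒′ ψ)    = boundF φ ⊔ boundF ψ
boundF (∀′ σ φ)    = boundF φ
boundF (∃′ σ φ)    = boundF φ
boundF (atom P ts) = boundF P ⊔ bound* ts
bound* ∅ᵃ          = 0
bound* (t ∷ᵃ ts)   = bound t ⊔ bound* ts

-- Coincidence and substitution lemmas for evaluation

Agree : ∀ {Γ} → ℕ → Env Γ → Env Γ → Set
Agree k ε ε' = ∀ σ n → n < k → ε σ n ≡ ε' σ n

_≗ˢ_ : ∀ {Γ Δ} → Sub Δ Γ → Sub Δ Γ → Set
_≗ˢ_ {Δ = Δ} δ δ' = ∀ {σ} (x : σ ∈ Δ) → δ x ≡ δ' x

⇑-agree : ∀ {Γ k τ} {ε ε' : Env Γ} → Agree k ε ε' → Agree k (_⇑ {τ = τ} ε) (ε' ⇑)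
⇑-agree a σ n p = cong _↑ (a σ n p)

extˢ-cong : ∀ {Γ Δ τ} {δ δ' : Sub Δ Γ} → δ ≗ˢ δ' → extˢ {σ = τ} δ ≗ˢ extˢ δ'
extˢ-cong e (here refl) = refl
extˢ-cong e (there x)   = cong _↑ (e x)

module _ {k : ℕ} where
  private
    l : ∀ m n → m ⊔ n ≤ k → m ≤ k
    l m n = m⊔n≤o⇒m≤o m n
    r : ∀ m n → m ⊔ n ≤ k → n ≤ k
    r m n = m⊔n≤o⇒n≤o m n

  -- Coincidence lemma. The bound on names matters: reassigning a name at or above it, as the
  -- quantifier rules do, leaves hypotheses and goals unchanged.
  eval-agree : ∀ {Γ Δ σ} {ε ε' : Env Γ} {δ δ' : Sub Δ Γ} → Agree k ε ε' → δ ≗ˢ δ' →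
               (t : Te Δ σ) → bound t ≤ k → eval ε δ t ≡ eval ε' δ' t
  evalF-agree : ∀ {Γ Δ} {ε ε' : Env Γ} {δ δ' : Sub Δ Γ} → Agree k ε ε' → δ ≗ˢ δ' →
                (φ : Fo Δ) → boundF φ ≤ k → evalF ε δ φ ≡ evalF ε' δ' φ
  evals-agree : ∀ {Γ Δ Ξ} {ε ε' : Env Γ} {δ δ' : Sub Δ Γ} → Agree k ε ε' → δ ≗ˢ δ' →
                (ts : Tes Δ Ξ) → bound* ts ≤ k → evals ε δ ts ≗ˢ evals ε' δ' ts
  eval-agree a e (bv x) p      = e x
  eval-agree a e (nm n) p      = a _ n p
  eval-agree a e (clo t) p     = eval-agree a (λ ()) t p
  eval-agree a e (lam t) p     = cong ƛ_ (eval-agree (⇑-agree a) (extˢ-cong e) t p)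
  eval-agree a e (s ∙ t) p     = cong₂ _·_ (eval-agree a e s (l (bound s) _ p)) (eval-agree a e t (r (bound s) _ p))
  eval-agree a e 𝟎 p           = refl
  eval-agree a e suc′ p        = refl
  eval-agree a e rec′ p        = refl
  eval-agree a e (un f t) p    = cong ⟦ f ⟧ᵘ (eval-agree a e t p)
  eval-agree a e (bin f s t) p = cong₂ ⟦ f ⟧ᵇ (eval-agree a e s (l (bound s) _ p)) (eval-agree a e t (r (bound s) _ p))
  eval-agree a e ⌈ φ ⌉ p       = cong₂ χ (a 𝟐 0 (l 1 (boundF φ) p)) (evalF-agree a e φ (r 1 (boundF φ) p))
  evalF-agree a e (s ≈ t) p     = cong₂ _≐_ (eval-agree a e s (l (bound s) _ p)) (eval-agree a e t (r (bound s) _ p))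
  evalF-agree a e (rel f s t) p = cong₂ ⟦ f ⟧ʳ (eval-agree a e s (l (bound s) _ p)) (eval-agree a e t (r (bound s) _ p))
  evalF-agree a e ⊥′ p          = refl
  evalF-agree a e (φ ∧′ ψ) p    = cong₂ _∧_ (evalF-agree a e φ (l (boundF φ) _ p)) (evalF-agree a e ψ (r (boundF φ) _ p))
  evalF-agree a e (φ ∨′ ψ) p    = cong₂ _∨_ (evalF-agree a e φ (l (boundF φ) _ p)) (evalF-agree a e ψ (r (boundF φ) _ p))
  evalF-agree a e (φ ⇒′ ψ) p    = cong₂ _⊃_ (evalF-agree a e φ (l (boundF φ) _ p)) (evalF-agree a e ψ (r (boundF φ) _ p))
  evalF-agree a e (∀′ σ φ) p    = cong (∀[ σ ]_) (evalF-agree (⇑-agree a) (extˢ-cong e) φ p)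
  evalF-agree a e (∃′ σ φ) p    = cong (∃[ σ ]_) (evalF-agree (⇑-agree a) (extˢ-cong e) φ p)
  evalF-agree a e (atom P ts) p = evalF-agree a (evals-agree a e ts (r (boundF P) _ p)) P (l (boundF P) _ p)
  evals-agree a e (t ∷ᵃ ts) p (here refl) = eval-agree a e t (l (bound t) _ p)
  evals-agree a e (t ∷ᵃ ts) p (there x)   = evals-agree a e ts (r (bound t) _ p) x

eval-cong : ∀ {Γ Δ σ} {ε ε' : Env Γ} {δ δ' : Sub Δ Γ} → (∀ σ n → ε σ n ≡ ε' σ n) → δ ≗ˢ δ' →
            (t : Te Δ σ) → eval ε δ t ≡ eval ε' δ' t
eval-cong a e t = eval-agree (λ σ n _ → a σ n) e t ≤-refl

evalF-cong : ∀ {Γ Δ} {ε ε' : Env Γ} {δ δ' : Sub Δ Γ} → (∀ σ n → ε σ n ≡ ε' σ n) → δ ≗ˢ δ' →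
             (φ : Fo Δ) → evalF ε δ φ ≡ evalF ε' δ' φ
evalF-cong a e φ = evalF-agree (λ σ n _ → a σ n) e φ ≤-refl

module _ where
  private
    ext-sub : ∀ {Γ Γ' Δ τ} (ξ : Sub Γ Γ') (δ : Sub Δ Γ) →
              (λ {σ} (x : σ ∈ τ ∷ Δ) → sub (extˢ ξ) (extˢ δ x)) ≗ˢ extˢ (λ x → sub ξ (δ x))
    ext-sub ξ δ (here refl) = refl
    ext-sub ξ δ (there x)   = sub-↑ ξ (δ x)

  sub-eval : ∀ {Γ Γ' Δ σ} (ξ : Sub Γ Γ') (ε : Env Γ) (δ : Sub Δ Γ) (t : Te Δ σ) →
             sub ξ (eval ε δ t) ≡ eval (λ σ n → sub ξ (ε σ n)) (λ x → sub ξ (δ x)) t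
  subF-evalF : ∀ {Γ Γ' Δ} (ξ : Sub Γ Γ') (ε : Env Γ) (δ : Sub Δ Γ) (φ : Fo Δ) →
               subF ξ (evalF ε δ φ) ≡ evalF (λ σ n → sub ξ (ε σ n)) (λ x → sub ξ (δ x)) φ
  sub-evals : ∀ {Γ Γ' Δ Ξ} (ξ : Sub Γ Γ') (ε : Env Γ) (δ : Sub Δ Γ) (ts : Tes Δ Ξ) →
              (λ {σ} (x : σ ∈ Ξ) → sub ξ (evals ε δ ts x)) ≗ˢ evals (λ σ n → sub ξ (ε σ n)) (λ x → sub ξ (δ x)) ts
  sub-eval ξ ε δ (bv x)      = refl
  sub-eval ξ ε δ (nm n)      = refl
  sub-eval ξ ε δ (clo t)     = trans (sub-eval ξ ε ∅ˢ t) (eval-cong (λ _ _ → refl) (λ ()) t)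
  sub-eval ξ ε δ (lam t)     = cong ƛ_ (trans (sub-eval (extˢ ξ) (ε ⇑) (extˢ δ) t)
                                 (eval-cong (λ σ n → sub-↑ ξ (ε σ n)) (ext-sub ξ δ) t))
  sub-eval ξ ε δ (s ∙ t)     = cong₂ _·_ (sub-eval ξ ε δ s) (sub-eval ξ ε δ t)
  sub-eval ξ ε δ 𝟎           = refl
  sub-eval ξ ε δ suc′        = refl
  sub-eval ξ ε δ rec′        = refl
  sub-eval ξ ε δ (un f t)    = trans (sub-un ξ f _) (cong ⟦ f ⟧ᵘ (sub-eval ξ ε δ t))
  sub-eval ξ ε δ (bin f s t) = trans (sub-bin ξ f _ _) (cong₂ ⟦ f ⟧ᵇ (sub-eval ξ ε δ s) (sub-eval ξ ε δ t))
  sub-eval ξ ε δ ⌈ φ ⌉       = trans (sub-χ ξ (ε 𝟐 0) (evalF ε δ φ)) (cong (χ (sub ξ (ε 𝟐 0))) (subF-evalF ξ ε δ φ))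
  subF-evalF ξ ε δ (s ≈ t)     = cong₂ _≐_ (sub-eval ξ ε δ s) (sub-eval ξ ε δ t)
  subF-evalF ξ ε δ (rel r s t) = trans (sub-rel ξ r _ _) (cong₂ ⟦ r ⟧ʳ (sub-eval ξ ε δ s) (sub-eval ξ ε δ t))
  subF-evalF ξ ε δ ⊥′          = refl
  subF-evalF ξ ε δ (φ ∧′ ψ)    = cong₂ _∧_ (subF-evalF ξ ε δ φ) (subF-evalF ξ ε δ ψ)
  subF-evalF ξ ε δ (φ ∨′ ψ)    = cong₂ _∨_ (subF-evalF ξ ε δ φ) (subF-evalF ξ ε δ ψ)
  subF-evalF ξ ε δ (φ ⇒′ ψ)    = cong₂ _⊃_ (subF-evalF ξ ε δ φ) (subF-evalF ξ ε δ ψ)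
  subF-evalF ξ ε δ (∀′ σ φ)    = cong (∀[ σ ]_) (trans (subF-evalF (extˢ ξ) (ε ⇑) (extˢ δ) φ)
                                   (evalF-cong (λ σ n → sub-↑ ξ (ε σ n)) (ext-sub ξ δ) φ))
  subF-evalF ξ ε δ (∃′ σ φ)    = cong (∃[ σ ]_) (trans (subF-evalF (extˢ ξ) (ε ⇑) (extˢ δ) φ)
                                   (evalF-cong (λ σ n → sub-↑ ξ (ε σ n)) (ext-sub ξ δ) φ))
  subF-evalF ξ ε δ (atom P ts) = trans (subF-evalF ξ ε (evals ε δ ts) P) (evalF-cong (λ _ _ → refl) (sub-evals ξ ε δ ts) P)
  sub-evals ξ ε δ (t ∷ᵃ ts) (here refl) = sub-eval ξ ε δ t
  sub-evals ξ ε δ (t ∷ᵃ ts) (there x)   = sub-evals ξ ε δ ts x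

ren-eval : ∀ {Γ Γ' Δ σ} (ρ : Ren Γ Γ') (ε : Env Γ) (δ : Sub Δ Γ) (t : Te Δ σ) →
           ren ρ (eval ε δ t) ≡ eval (λ σ n → ren ρ (ε σ n)) (λ x → ren ρ (δ x)) t
ren-eval ρ ε δ t = trans (ren≡sub ρ (eval ε δ t)) (trans (sub-eval _ ε δ t)
  (eval-cong (λ σ n → sym (ren≡sub ρ (ε σ n))) (λ x → sym (ren≡sub ρ (δ x))) t))

renF-evalF : ∀ {Γ Γ' Δ} (ρ : Ren Γ Γ') (ε : Env Γ) (δ : Sub Δ Γ) (φ : Fo Δ) →
             renF ρ (evalF ε δ φ) ≡ evalF (λ σ n → ren ρ (ε σ n)) (λ x → ren ρ (δ x)) φ
renF-evalF ρ ε δ φ = trans (renF≡subF ρ (evalF ε δ φ)) (trans (subF-evalF _ ε δ φ)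
  (evalF-cong (λ σ n → sym (ren≡sub ρ (ε σ n))) (λ x → sym (ren≡sub ρ (δ x))) φ))

module _ where
  private
    ext-ren : ∀ {Γ Δ Δ' τ} (ρ : Ren Δ Δ') (δ : Sub Δ' Γ) →
              (λ {σ} (x : σ ∈ τ ∷ Δ) → extˢ δ (extᴿ ρ x)) ≗ˢ extˢ (λ x → δ (ρ x))
    ext-ren ρ δ (here refl) = refl
    ext-ren ρ δ (there x)   = refl

  eval-renTe : ∀ {Γ Δ Δ' σ} (ε : Env Γ) (ρ : Ren Δ Δ') (δ : Sub Δ' Γ) (t : Te Δ σ) →
               eval ε δ (renTe ρ t) ≡ eval ε (λ x → δ (ρ x)) t
  evalF-renFo : ∀ {Γ Δ Δ'} (ε : Env Γ) (ρ : Ren Δ Δ') (δ : Sub Δ' Γ) (φ : Fo Δ) →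
                evalF ε δ (renFo ρ φ) ≡ evalF ε (λ x → δ (ρ x)) φ
  evals-renTes : ∀ {Γ Δ Δ' Ξ} (ε : Env Γ) (ρ : Ren Δ Δ') (δ : Sub Δ' Γ) (ts : Tes Δ Ξ) →
                 evals ε δ (renTes ρ ts) ≗ˢ evals ε (λ x → δ (ρ x)) ts
  eval-renTe ε ρ δ (bv x)      = refl
  eval-renTe ε ρ δ (nm n)      = refl
  eval-renTe ε ρ δ (clo t)     = refl
  eval-renTe ε ρ δ (lam t)     = cong ƛ_ (trans (eval-renTe (ε ⇑) (extᴿ ρ) (extˢ δ) t)
                                   (eval-cong (λ _ _ → refl) (ext-ren ρ δ) t))
  eval-renTe ε ρ δ (s ∙ t)     = cong₂ _·_ (eval-renTe ε ρ δ s) (eval-renTe ε ρ δ t)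
  eval-renTe ε ρ δ 𝟎           = refl
  eval-renTe ε ρ δ suc′        = refl
  eval-renTe ε ρ δ rec′        = refl
  eval-renTe ε ρ δ (un f t)    = cong ⟦ f ⟧ᵘ (eval-renTe ε ρ δ t)
  eval-renTe ε ρ δ (bin f s t) = cong₂ ⟦ f ⟧ᵇ (eval-renTe ε ρ δ s) (eval-renTe ε ρ δ t)
  eval-renTe ε ρ δ ⌈ φ ⌉       = cong (χ (ε 𝟐 0)) (evalF-renFo ε ρ δ φ)
  evalF-renFo ε ρ δ (s ≈ t)     = cong₂ _≐_ (eval-renTe ε ρ δ s) (eval-renTe ε ρ δ t)
  evalF-renFo ε ρ δ (rel r s t) = cong₂ ⟦ r ⟧ʳ (eval-renTe ε ρ δ s) (eval-renTe ε ρ δ t)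
  evalF-renFo ε ρ δ ⊥′          = refl
  evalF-renFo ε ρ δ (φ ∧′ ψ)    = cong₂ _∧_ (evalF-renFo ε ρ δ φ) (evalF-renFo ε ρ δ ψ)
  evalF-renFo ε ρ δ (φ ∨′ ψ)    = cong₂ _∨_ (evalF-renFo ε ρ δ φ) (evalF-renFo ε ρ δ ψ)
  evalF-renFo ε ρ δ (φ ⇒′ ψ)    = cong₂ _⊃_ (evalF-renFo ε ρ δ φ) (evalF-renFo ε ρ δ ψ)
  evalF-renFo ε ρ δ (∀′ σ φ)    = cong (∀[ σ ]_) (trans (evalF-renFo (ε ⇑) (extᴿ ρ) (extˢ δ) φ)
                                   (evalF-cong (λ _ _ → refl) (ext-ren ρ δ) φ))
  evalF-renFo ε ρ δ (∃′ σ φ)    = cong (∃[ σ ]_) (trans (evalF-renFo (ε ⇑) (extᴿ ρ) (extˢ δ) φ)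
                                   (evalF-cong (λ _ _ → refl) (ext-ren ρ δ) φ))
  evalF-renFo ε ρ δ (atom P ts) = evalF-cong (λ _ _ → refl) (evals-renTes ε ρ δ ts) P
  evals-renTes ε ρ δ (t ∷ᵃ ts) (here refl) = eval-renTe ε ρ δ t
  evals-renTes ε ρ δ (t ∷ᵃ ts) (there x)   = evals-renTes ε ρ δ ts x

eval-sh′ : ∀ {Γ Δ σ τ} (ε : Env Γ) (δ : Sub (τ ∷ Δ) Γ) (t : Te Δ σ) →
           eval ε δ (sh t) ≡ eval ε (λ x → δ (there x)) t
eval-sh′ {Δ = []}    ε δ t = eval-cong (λ _ _ → refl) (λ ()) t
eval-sh′ {Δ = _ ∷ _} ε δ t = eval-renTe ε there δ t

eval-sh : ∀ {Γ Δ σ τ} (ε : Env Γ) (δ : Sub Δ Γ) (t : Te Δ σ) →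
          eval (_⇑ {τ = τ} ε) (extˢ δ) (sh t) ≡ eval ε δ t ↑
eval-sh ε δ t = trans (eval-sh′ (ε ⇑) (extˢ δ) t) (sym (ren-eval there ε δ t))

eval-open : ∀ {Γ Δ σ} (ε : Env Γ) (δ : Sub Δ Γ) (t : Te [] σ) →
            eval ε δ (open′ t) ≡ eval ε ∅ˢ t
eval-open {Δ = []}    ε δ t = eval-cong (λ _ _ → refl) (λ ()) t
eval-open {Δ = _ ∷ _} ε δ t = refl

module _ where
  private
    ext-exts : ∀ {Γ Δ Δ' τ} (ε : Env Γ) (θ : Sb Δ Δ') (δ : Sub Δ' Γ) →
               (λ {σ} (x : σ ∈ τ ∷ Δ) → eval (ε ⇑) (extˢ δ) (exts θ x)) ≗ˢ extˢ (λ x → eval ε δ (θ x))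
    ext-exts ε θ δ (here refl) = refl
    ext-exts ε θ δ (there x)   = eval-sh ε δ (θ x)

  eval-subTe : ∀ {Γ Δ Δ' σ} (ε : Env Γ) (θ : Sb Δ Δ') (δ : Sub Δ' Γ) (t : Te Δ σ) →
               eval ε δ (subTe θ t) ≡ eval ε (λ x → eval ε δ (θ x)) t
  evalF-subFo : ∀ {Γ Δ Δ'} (ε : Env Γ) (θ : Sb Δ Δ') (δ : Sub Δ' Γ) (φ : Fo Δ) →
                evalF ε δ (subFo θ φ) ≡ evalF ε (λ x → eval ε δ (θ x)) φ
  evals-subTes : ∀ {Γ Δ Δ' Ξ} (ε : Env Γ) (θ : Sb Δ Δ') (δ : Sub Δ' Γ) (ts : Tes Δ Ξ) →
                 evals ε δ (subTes θ ts) ≗ˢ evals ε (λ x → eval ε δ (θ x)) ts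
  eval-subTe ε θ δ (bv x)      = refl
  eval-subTe ε θ δ (nm n)      = refl
  eval-subTe ε θ δ (clo t)     = eval-open ε δ t
  eval-subTe ε θ δ (lam t)     = cong ƛ_ (trans (eval-subTe (ε ⇑) (exts θ) (extˢ δ) t)
                                   (eval-cong (λ _ _ → refl) (ext-exts ε θ δ) t))
  eval-subTe ε θ δ (s ∙ t)     = cong₂ _·_ (eval-subTe ε θ δ s) (eval-subTe ε θ δ t)
  eval-subTe ε θ δ 𝟎           = refl
  eval-subTe ε θ δ suc′        = refl
  eval-subTe ε θ δ rec′        = refl
  eval-subTe ε θ δ (un f t)    = cong ⟦ f ⟧ᵘ (eval-subTe ε θ δ t)
  eval-subTe ε θ δ (bin f s t) = cong₂ ⟦ f ⟧ᵇ (eval-subTe ε θ δ s) (eval-subTe ε θ δ t)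
  eval-subTe ε θ δ ⌈ φ ⌉       = cong (χ (ε 𝟐 0)) (evalF-subFo ε θ δ φ)
  evalF-subFo ε θ δ (s ≈ t)     = cong₂ _≐_ (eval-subTe ε θ δ s) (eval-subTe ε θ δ t)
  evalF-subFo ε θ δ (rel r s t) = cong₂ ⟦ r ⟧ʳ (eval-subTe ε θ δ s) (eval-subTe ε θ δ t)
  evalF-subFo ε θ δ ⊥′          = refl
  evalF-subFo ε θ δ (φ ∧′ ψ)    = cong₂ _∧_ (evalF-subFo ε θ δ φ) (evalF-subFo ε θ δ ψ)
  evalF-subFo ε θ δ (φ ∨′ ψ)    = cong₂ _∨_ (evalF-subFo ε θ δ φ) (evalF-subFo ε θ δ ψ)
  evalF-subFo ε θ δ (φ ⇒′ ψ)    = cong₂ _⊃_ (evalF-subFo ε θ δ φ) (evalF-subFo ε θ δ ψ)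
  evalF-subFo ε θ δ (∀′ σ φ)    = cong (∀[ σ ]_) (trans (evalF-subFo (ε ⇑) (exts θ) (extˢ δ) φ)
                                    (evalF-cong (λ _ _ → refl) (ext-exts ε θ δ) φ))
  evalF-subFo ε θ δ (∃′ σ φ)    = cong (∃[ σ ]_) (trans (evalF-subFo (ε ⇑) (exts θ) (extˢ δ) φ)
                                    (evalF-cong (λ _ _ → refl) (ext-exts ε θ δ) φ))
  evalF-subFo ε θ δ (atom P ts) = evalF-cong (λ _ _ → refl) (evals-subTes ε θ δ ts) P
  evals-subTes ε θ δ (t ∷ᵃ ts) (here refl) = eval-subTe ε θ δ t
  evals-subTes ε θ δ (t ∷ᵃ ts) (there x)   = evals-subTes ε θ δ ts x

evals-args : ∀ {Γ Δ Ξ} (ε : Env Γ) (δ : Sub Δ Γ) (ts : Tes Δ Ξ) →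
             evals ε δ ts ≗ˢ (λ x → eval ε δ (args ts x))
evals-args ε δ (t ∷ᵃ ts) (here refl) = refl
evals-args ε δ (t ∷ᵃ ts) (there x)   = evals-args ε δ ts x

-- Derivability of formulas with names

𝕋 : Theory
𝕋 = ACA₀ω +ᵀ QF-AC⁰¹

⊢-mono : ∀ {Th : Theory} {Γ} {Φ Ψ : List (Fm Γ)} {φ} → (∀ {χ} → χ ∈ Φ → χ ∈ Ψ) → Th ∣ Φ ⊢ φ → Th ∣ Ψ ⊢ φ
⊢-mono {Th} {Γ} m d = go m d
  where
  ∷-mono : ∀ {Γ} {Φ Ψ : List (Fm Γ)} {φ} → (∀ {χ} → χ ∈ Φ → χ ∈ Ψ) → ∀ {χ} → χ ∈ φ ∷ Φ → χ ∈ φ ∷ Ψ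
  ∷-mono m (here p)  = here p
  ∷-mono m (there x) = there (m x)
  map-mono : ∀ {Γ σ} {Φ Ψ : List (Fm Γ)} → (∀ {χ} → χ ∈ Φ → χ ∈ Ψ) →
             ∀ {χ} → χ ∈ map (_↑F {σ = σ}) Φ → χ ∈ map _↑F Ψ
  map-mono m x with ∈-map⁻ _↑F x
  ... | y , y∈ , refl = ∈-map⁺ _↑F (m y∈)
  go : ∀ {Γ} {Φ Ψ : List (Fm Γ)} {φ} → (∀ {χ} → χ ∈ Φ → χ ∈ Ψ) → Th ∣ Φ ⊢ φ → Th ∣ Ψ ⊢ φ
  go m (ax a)       = ax a
  go m (hyp x)      = hyp (m x)
  go m (⊃I d)       = ⊃I (go (∷-mono m) d)
  go m (⊃E d e)     = ⊃E (go m d) (go m e)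
  go m (∧I d e)     = ∧I (go m d) (go m e)
  go m (∧E₁ d)      = ∧E₁ (go m d)
  go m (∧E₂ d)      = ∧E₂ (go m d)
  go m (∨I₁ d)      = ∨I₁ (go m d)
  go m (∨I₂ d)      = ∨I₂ (go m d)
  go m (∨E d e f)   = ∨E (go m d) (go (∷-mono m) e) (go (∷-mono m) f)
  go m (raa d)      = raa (go (∷-mono m) d)
  go m (∀I d)       = ∀I (go (map-mono m) d)
  go m (∀E d t)     = ∀E (go m d) t
  go m (∃I t d)     = ∃I t (go m d)
  go m (∃E d e)     = ∃E (go m d) (go (∷-mono (map-mono m)) e)

-- The body of `∃²` with its functional as a parameter. The existential is eliminated only once, at
-- the very end; until then this property of name 0 is a standing hypothesis.
Espec : ∀ {Γ} → Tm Γ 𝟐 → Fm Γ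
Espec e = ∀[ 𝟏 ] (e ↑ · v₀ ≐ O ∨ e ↑ · v₀ ≐ S · O) ∧ ((∃[ ι ] v₁ · v₀ ≐ O) ⊃⊂ e ↑ · v₀ ≐ O)

Espec-↑ : ∀ {Γ σ} (e : Tm Γ 𝟐) → Espec e ↑F ≡ Espec (_↑ {τ = σ} e)
Espec-↑ e = cong (λ a → ∀[ 𝟏 ] (a · v₀ ≐ O ∨ a · v₀ ≐ S · O) ∧ ((∃[ ι ] v₁ · v₀ ≐ O) ⊃⊂ a · v₀ ≐ O)) (ren-↑ there e)

⟦_⟧ : Fo [] → ∀ {Γ} → Env Γ → Fm Γ
⟦ φ ⟧ ε = evalF ε ∅ˢ φ

hyps : List (Fo []) → ∀ {Γ} → Env Γ → List (Fm Γ)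
hyps Φ ε = Espec (ε 𝟐 0) ∷ map (λ φ → ⟦ φ ⟧ ε) Φ

infix 4 _⊩_

record _⊩_ (Φ : List (Fo [])) (φ : Fo []) : Set where
  constructor mk
  field run : ∀ {Γ} (ε : Env Γ) → 𝕋 ∣ hyps Φ ε ⊢ ⟦ φ ⟧ ε
open _⊩_ public

private variable
  Φ Ψ : List (Fo [])
  φ ψ θ : Fo []
  σ τ : Ty

w : Φ ⊩ φ → ψ ∷ Φ ⊩ φ
w d = mk λ ε → ⊢-mono (λ { (here p) → here p ; (there x) → there (there x) }) (run d ε)

w² : Φ ⊩ φ → θ ∷ ψ ∷ Φ ⊩ φ
w² d = w (w d)

w³ : ∀ {α} → Φ ⊩ φ → α ∷ θ ∷ ψ ∷ Φ ⊩ φ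
w³ d = w (w² d)

w⁴ : ∀ {α β} → Φ ⊩ φ → β ∷ α ∷ θ ∷ ψ ∷ Φ ⊩ φ
w⁴ d = w (w³ d)

w⁵ : ∀ {α β γ} → Φ ⊩ φ → γ ∷ β ∷ α ∷ θ ∷ ψ ∷ Φ ⊩ φ
w⁵ d = w (w⁴ d)

h₀ : φ ∷ Φ ⊩ φ
h₀ = mk λ ε → hyp (there (here refl))

-- The property of the functional heads every list made by `hyps`, whereas a discharged hypothesis
-- must come first; this exchanges the two.
swap-∈ : ∀ {Γ} {a b : Fm Γ} {Ψ} {χ} → χ ∈ a ∷ b ∷ Ψ → χ ∈ b ∷ a ∷ Ψ
swap-∈ (here p)          = there (here p)
swap-∈ (there (here p))  = here p
swap-∈ (there (there x)) = there (there x)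

-- Different formulas of the second syntax may have the same evaluations, for instance a function
-- symbol and the recursor term behind it, and only evaluations enter derivations.
conv : (∀ {Γ} (ε : Env Γ) → ⟦ φ ⟧ ε ≡ ⟦ ψ ⟧ ε) → Φ ⊩ φ → Φ ⊩ ψ
conv e d = mk λ ε → subst (_ ∣ _ ⊢_) (e ε) (run d ε)

infixl 6 _▹_
infixr 5 _&_
infixl 9 _at_

assume : (φ ∷ Φ ⊩ φ → φ ∷ Φ ⊩ ψ) → Φ ⊩ φ ⇒′ ψ
assume f = mk λ ε → ⊃I (⊢-mono swap-∈ (run (f h₀) ε))

_▹_ : Φ ⊩ φ ⇒′ ψ → Φ ⊩ φ → Φ ⊩ ψ
d ▹ e = mk λ ε → ⊃E (run d ε) (run e ε)

_&_ : Φ ⊩ φ → Φ ⊩ ψ → Φ ⊩ φ ∧′ ψ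
d & e = mk λ ε → ∧I (run d ε) (run e ε)

π₁ : Φ ⊩ φ ∧′ ψ → Φ ⊩ φ
π₁ d = mk λ ε → ∧E₁ (run d ε)

π₂ : Φ ⊩ φ ∧′ ψ → Φ ⊩ ψ
π₂ d = mk λ ε → ∧E₂ (run d ε)

left : Φ ⊩ φ → Φ ⊩ φ ∨′ ψ
left d = mk λ ε → ∨I₁ (run d ε)

right : Φ ⊩ ψ → Φ ⊩ φ ∨′ ψ
right d = mk λ ε → ∨I₂ (run d ε)

cases : Φ ⊩ φ ∨′ ψ → (φ ∷ Φ ⊩ φ → φ ∷ Φ ⊩ θ) → (ψ ∷ Φ ⊩ ψ → ψ ∷ Φ ⊩ θ) → Φ ⊩ θ
cases d f g = mk λ ε → ∨E (run d ε) (⊢-mono swap-∈ (run (f h₀) ε)) (⊢-mono swap-∈ (run (g h₀) ε))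

infix 18 ¬′_
¬′_ : ∀ {Δ} → Fo Δ → Fo Δ
¬′ φ = φ ⇒′ ⊥′

infixr 15 _⇔′_
_⇔′_ : ∀ {Δ} → Fo Δ → Fo Δ → Fo Δ
φ ⇔′ ψ = (φ ⇒′ ψ) ∧′ (ψ ⇒′ φ)

byContra : (¬′ φ ∷ Φ ⊩ ¬′ φ → ¬′ φ ∷ Φ ⊩ ⊥′) → Φ ⊩ φ
byContra f = mk λ ε → raa (⊢-mono swap-∈ (run (f h₀) ε))

absurd : Φ ⊩ ⊥′ → Φ ⊩ φ
absurd d = byContra λ _ → w d

em : (φ : Fo []) → (φ ∷ Φ ⊩ φ → φ ∷ Φ ⊩ θ) → (¬′ φ ∷ Φ ⊩ ¬′ φ → ¬′ φ ∷ Φ ⊩ θ) → Φ ⊩ θ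
em φ f g = cases (byContra λ n → n ▹ right (assume λ p → w n ▹ left p)) f g

-- Instantiation

map-cong′ : ∀ {A B : Set} {f g : A → B} (xs : List A) → (∀ {x} → x ∈ xs → f x ≡ g x) → map f xs ≡ map g xs
map-cong′ []       e = refl
map-cong′ (x ∷ xs) e = cong₂ _∷_ (e (here refl)) (map-cong′ xs (λ p → e (there p)))

⟦[]⟧ : ∀ {Γ} (ε : Env Γ) (φ : Fo (σ ∷ [])) (t : Te [] σ) →
       evalF (ε ⇑) (extˢ ∅ˢ) φ [ eval ε ∅ˢ t ]F ≡ ⟦ φ [ t ]ᶠ ⟧ ε
⟦[]⟧ ε φ t = trans (subF-evalF _ (ε ⇑) _ φ) (trans
  (evalF-cong (λ τ n → ↑-[] (ε τ n) _) (λ { (here refl) → refl ; (there ()) }) φ)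
  (sym (evalF-subFo ε (inst t) ∅ˢ φ)))

⟦[]ᵗ⟧ : ∀ {Γ} (ε : Env Γ) (s : Te (σ ∷ []) τ) (t : Te [] σ) →
        eval (ε ⇑) (extˢ ∅ˢ) s [ eval ε ∅ˢ t ] ≡ eval ε ∅ˢ (s [ t ]ᵗ)
⟦[]ᵗ⟧ ε s t = trans (sub-eval _ (ε ⇑) _ s) (trans
  (eval-cong (λ τ n → ↑-[] (ε τ n) _) (λ { (here refl) → refl ; (there ()) }) s)
  (sym (eval-subTe ε (inst t) ∅ˢ s)))

_at_ : ∀ {φ : Fo (σ ∷ [])} → Φ ⊩ ∀′ σ φ → (t : Te [] σ) → Φ ⊩ φ [ t ]ᶠ
_at_ {φ = φ} d t = mk λ ε → subst (_ ∣ _ ⊢_) (⟦[]⟧ ε φ t) (∀E (run d ε) (eval ε ∅ˢ t))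

witness : ∀ {φ : Fo (σ ∷ [])} (t : Te [] σ) → Φ ⊩ φ [ t ]ᶠ → Φ ⊩ ∃′ σ φ
witness {φ = φ} t d = mk λ ε → ∃I (eval ε ∅ˢ t) (subst (_ ∣ _ ⊢_) (sym (⟦[]⟧ ε φ t)) (run d ε))

⟦atom⟧ : ∀ {Γ Ξ} (ε : Env Γ) (P : Fo Ξ) (ts : Tes [] Ξ) → ⟦ atom P ts ⟧ ε ≡ ⟦ subFo (args ts) P ⟧ ε
⟦atom⟧ ε P ts = trans (evalF-cong (λ _ _ → refl) (evals-args ε ∅ˢ ts) P) (sym (evalF-subFo ε (args ts) ∅ˢ P))

unfold : ∀ {Ξ} {P : Fo Ξ} {ts} → Φ ⊩ atom P ts → Φ ⊩ subFo (args ts) P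
unfold {P = P} {ts} = conv λ ε → ⟦atom⟧ ε P ts

fold : ∀ {Ξ} {P : Fo Ξ} {ts} → Φ ⊩ subFo (args ts) P → Φ ⊩ atom P ts
fold {P = P} {ts} = conv λ ε → sym (⟦atom⟧ ε P ts)

-- Fresh names and the quantifier rules

_≟ᵗ_ : (σ τ : Ty) → Dec (σ ≡ τ)
ι        ≟ᵗ ι          = yes refl
ι        ≟ᵗ (_ ⇒ _)    = no λ ()
(_ ⇒ _)  ≟ᵗ ι          = no λ ()
(σ ⇒ τ) ≟ᵗ (σ' ⇒ τ') with σ ≟ᵗ σ' | τ ≟ᵗ τ'
... | yes refl | yes refl = yes refl
... | no n     | _        = no λ { refl → n refl }
... | _        | no n     = no λ { refl → n refl }

fresh : ∀ {Γ} σ → ℕ → Env Γ → Env (σ ∷ Γ)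
fresh σ k ε τ n with n ≟ k | σ ≟ᵗ τ
... | yes _ | yes refl = v₀
... | yes _ | no _     = ε τ n ↑
... | no _  | _        = ε τ n ↑

fresh-new : ∀ {Γ} σ k (ε : Env Γ) → fresh σ k ε σ k ≡ v₀
fresh-new σ k ε with k ≟ k | σ ≟ᵗ σ
... | yes _ | yes refl = refl
... | yes _ | no n     = ⊥-elim (n refl)
... | no n  | _        = ⊥-elim (n refl)

fresh-old : ∀ {Γ} σ k (ε : Env Γ) → Agree k (ε ⇑) (fresh σ k ε)
fresh-old σ k ε τ n n<k with n ≟ k | σ ≟ᵗ τ
... | yes refl | _    = ⊥-elim (<-irrefl refl n<k)
... | no _     | _    = refl

bounds : List (Fo []) → ℕ
-- At least 1, so that name 0, which stands for the functional of `∃²`, never becomes an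
-- eigenvariable.
bounds []      = 1
bounds (φ ∷ Φ) = boundF φ ⊔ bounds Φ

1≤bounds : ∀ Φ → 1 ≤ bounds Φ
1≤bounds []      = ≤-refl
1≤bounds (φ ∷ Φ) = ≤-trans (1≤bounds Φ) (m≤n⊔m (boundF φ) _)

∈-bounds : ∀ {Φ φ} → φ ∈ Φ → boundF φ ≤ bounds Φ
∈-bounds {φ ∷ Φ} (here refl) = m≤m⊔n _ _
∈-bounds {ψ ∷ Φ} (there x)   = ≤-trans (∈-bounds x) (m≤n⊔m (boundF ψ) _)

↑F-fresh : ∀ {Γ} σ k (ε : Env Γ) φ → boundF φ ≤ k → ⟦ φ ⟧ ε ↑F ≡ ⟦ φ ⟧ (fresh σ k ε)
↑F-fresh σ k ε φ p = trans (renF-evalF there ε ∅ˢ φ) (evalF-agree (fresh-old σ k ε) (λ ()) φ p)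

hyps-fresh : ∀ {Γ} σ k (ε : Env Γ) Φ → bounds Φ ≤ k → map _↑F (hyps Φ ε) ≡ hyps Φ (fresh σ k ε)
hyps-fresh σ k ε Φ p = cong₂ _∷_
  (trans (Espec-↑ (ε 𝟐 0)) (cong Espec (fresh-old σ k ε 𝟐 0 (≤-trans (1≤bounds Φ) p))))
  (trans (map-map Φ) (map-cong′ Φ (λ {φ} x → ↑F-fresh σ k ε φ (≤-trans (∈-bounds x) p))))
  where
  map-map : ∀ Φ → map _↑F (map (λ φ → ⟦ φ ⟧ ε) Φ) ≡ map (λ φ → ⟦ φ ⟧ ε ↑F) Φ
  map-map []      = refl
  map-map (φ ∷ Φ) = cong (_ ∷_) (map-map Φ)

⟦⟧-fresh : ∀ {Γ} k (ε : Env Γ) (φ : Fo (σ ∷ [])) → boundF φ ≤ k →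
           ⟦ φ [ nm k ]ᶠ ⟧ (fresh σ k ε) ≡ evalF (ε ⇑) (extˢ ∅ˢ) φ
⟦⟧-fresh {σ} k ε φ p = trans (evalF-subFo (fresh σ k ε) (inst (nm k)) ∅ˢ φ)
  (sym (evalF-agree (fresh-old σ k ε) (λ { (here refl) → sym (fresh-new σ k ε) ; (there ()) }) φ p))

-- The function is used at a single name, chosen above all names of the hypotheses and of the
-- matrix, so that assigning it to the bound variable disturbs nothing else.
gen : ∀ {φ : Fo (σ ∷ [])} → ((x : Te [] σ) → Φ ⊩ φ [ x ]ᶠ) → Φ ⊩ ∀′ σ φ
gen {σ} {Φ} {φ} f = mk λ ε → ∀I (subst₂ (𝕋 ∣_⊢_)
    (sym (hyps-fresh σ k ε Φ (m≤m⊔n _ _)))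
    (⟦⟧-fresh k ε φ (m≤n⊔m (bounds Φ) _))
    (run (f (nm k)) (fresh σ k ε)))
  where
  k : ℕ
  k = bounds Φ ⊔ boundF φ

obtain : ∀ {φ : Fo (σ ∷ [])} → Φ ⊩ ∃′ σ φ →
         ((x : Te [] σ) → φ [ x ]ᶠ ∷ Φ ⊩ φ [ x ]ᶠ → φ [ x ]ᶠ ∷ Φ ⊩ ψ) → Φ ⊩ ψ
obtain {σ} {Φ} {ψ} {φ} d f = mk λ ε → ∃E (run d ε) (subst₂ (𝕋 ∣_⊢_)
    (cong₂ _∷_ (⟦⟧-fresh k ε φ b₁) (sym (hyps-fresh σ k ε Φ b₂)))
    (sym (↑F-fresh σ k ε ψ b₃))
    (⊢-mono swap-∈ (run (f (nm k) h₀) (fresh σ k ε))))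
  where
  k : ℕ
  k = bounds Φ ⊔ (boundF φ ⊔ boundF ψ)
  b₁ : boundF φ ≤ k
  b₁ = ≤-trans (m≤m⊔n _ (boundF ψ)) (m≤n⊔m (bounds Φ) _)
  b₂ : bounds Φ ≤ k
  b₂ = m≤m⊔n _ _
  b₃ : boundF ψ ≤ k
  b₃ = ≤-trans (m≤n⊔m (boundF φ) _) (m≤n⊔m (bounds Φ) _)

exhibit : ∀ {Ξ} {φ : Fo (σ ∷ Ξ)} {ts} (t : Te [] σ) → Φ ⊩ subFo (exts (args ts)) φ [ t ]ᶠ → Φ ⊩ atom (∃′ σ φ) ts
exhibit t d = fold (witness t d)

pick : ∀ {Ξ} {φ : Fo (σ ∷ Ξ)} {ts} → Φ ⊩ atom (∃′ σ φ) ts → (∀ x → let χ = subFo (exts (args ts)) φ [ x ]ᶠ in χ ∷ Φ ⊩ χ → χ ∷ Φ ⊩ ψ) → Φ ⊩ ψ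
pick d = obtain (unfold d)

-- The axioms

pattern b₀ = bv (here refl)
pattern b₁ = bv (there (here refl))
pattern b₂ = bv (there (there (here refl)))
pattern b₃ = bv (there (there (there (here refl))))
pattern b₄ = bv (there (there (there (there (here refl)))))
pattern b₅ = bv (there (there (there (there (there (here refl))))))
pattern su t = suc′ ∙ t
infixl 21 _⊹_ _∸′_
infixl 22 _×′_
pattern _⊹_ s t = bin plusᵇ s t
pattern _∸′_ s t = bin monusᵇ s t
pattern _×′_ s t = bin timesᵇ s t
pattern pair s t = bin pairᵇ s t

𝟏′ : ∀ {Δ} → Te Δ ι
𝟏′ = su 𝟎

pra : ∀ {Φ φ} → (∀ {Γ} (ε : Env Γ) → E-PRAω (⟦ φ ⟧ ε)) → Φ ⊩ φ
pra a = mk λ ε → ax (inj₁ (inj₁ (inj₁ (a ε))))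

rfl : ∀ {t} → Φ ⊩ t ≈ t
rfl = pra λ ε → ≐-refl _

replace : (φ : Fo (ι ∷ [])) → ∀ {s t} → Φ ⊩ s ≈ t → Φ ⊩ φ [ s ]ᶠ → Φ ⊩ φ [ t ]ᶠ
replace φ {s} {t} p d = mk λ ε → subst (_ ∣ _ ⊢_) (⟦[]⟧ ε φ t)
  (⊃E (⊃E (ax (inj₁ (inj₁ (inj₁ (≐-subst _ _ _))))) (run p ε)) (subst (_ ∣ _ ⊢_) (sym (⟦[]⟧ ε φ s)) (run d ε)))

≈sym : ∀ {s t} → Φ ⊩ s ≈ t → Φ ⊩ t ≈ s
≈sym {s = s} p = replace (b₀ ≈ clo s) p rfl

≈trans : ∀ {s t u} → Φ ⊩ s ≈ t → Φ ⊩ t ≈ u → Φ ⊩ s ≈ u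
≈trans {s = s} p q = replace (clo s ≈ b₀) q p

ctx : (c : Te (ι ∷ []) ι) → ∀ {s t} → Φ ⊩ s ≈ t → Φ ⊩ c [ s ]ᵗ ≈ c [ t ]ᵗ
ctx c {s} p = replace (clo (c [ s ]ᵗ) ≈ c) p rfl

su≢0 : ∀ {t} → Φ ⊩ su t ≈ 𝟎 → Φ ⊩ ⊥′
su≢0 p = mk λ ε → ⊃E (ax (inj₁ (inj₁ (inj₁ (S≢0 _))))) (run p ε)

rec-zero : ∀ {a f} → Φ ⊩ rec′ ∙ 𝟎 ∙ a ∙ f ≈ a
rec-zero = pra λ ε → R-zero _ _

rec-suc : ∀ {n a f} → Φ ⊩ rec′ ∙ su n ∙ a ∙ f ≈ f ∙ (rec′ ∙ n ∙ a ∙ f) ∙ n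
rec-suc = pra λ ε → R-suc _ _ _

Eq′ : ∀ {Δ} σ → Te Δ σ → Te Δ σ → Fo Δ
Eq′ ι       s t = s ≈ t
Eq′ (σ ⇒ τ) s t = ∀′ σ (Eq′ τ (sh s ∙ b₀) (sh t ∙ b₀))

evalF-Eq : ∀ {Γ Δ} σ (ε : Env Γ) (δ : Sub Δ Γ) (s t : Te Δ σ) →
           evalF ε δ (Eq′ σ s t) ≡ Eq σ (eval ε δ s) (eval ε δ t)
evalF-Eq ι       ε δ s t = refl
evalF-Eq (σ ⇒ τ) ε δ s t = cong (∀[ σ ]_) (trans (evalF-Eq τ (ε ⇑) (extˢ δ) (sh s ∙ b₀) (sh t ∙ b₀))
  (cong₂ (λ a b → Eq τ (a · v₀) (b · v₀)) (eval-sh ε δ s) (eval-sh ε δ t)))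

beta : (t : Te (σ ∷ []) τ) (s : Te [] σ) → Φ ⊩ Eq′ τ (lam t ∙ s) (t [ s ]ᵗ)
beta {τ = τ} t s = mk λ ε → subst (_ ∣ _ ⊢_)
  (sym (trans (evalF-Eq τ ε ∅ˢ (lam t ∙ s) (t [ s ]ᵗ)) (cong (Eq τ _) (sym (⟦[]ᵗ⟧ ε t s)))))
  (ax (inj₁ (inj₁ (inj₁ (β _ _)))))

exten : ∀ {f : Te [] (σ ⇒ τ)} {s t} → Φ ⊩ Eq′ σ s t → Φ ⊩ Eq′ τ (f ∙ s) (f ∙ t)
exten {σ} {τ} {f = f} {s} {t} p = mk λ ε → subst (_ ∣ _ ⊢_) (sym (evalF-Eq τ ε ∅ˢ (f ∙ s) (f ∙ t)))
  (⊃E (ax (inj₁ (inj₁ (inj₁ (ext _ _ _))))) (subst (_ ∣ _ ⊢_) (evalF-Eq σ ε ∅ˢ s t) (run p ε)))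

-- Boolean-valued, so that for a concrete formula the implicit side condition computes to the unit
-- type and is filled in silently.
isQF : ∀ {Δ} → Fo Δ → Bool
isQF (s ≈ t)     = true
isQF (rel r s t) = true
isQF ⊥′          = true
isQF (φ ∧′ ψ)    = isQF φ && isQF ψ
isQF (φ ∨′ ψ)    = isQF φ && isQF ψ
isQF (φ ⇒′ ψ)    = isQF φ && isQF ψ
isQF (∀′ σ φ)    = false
isQF (∃′ σ φ)    = false
isQF (atom P ts) = isQF P

T-&& : ∀ {a b} → T (a && b) → T a × T b
T-&& {true} {true} _ = _ , _

opaque
  unfolding ⟦_⟧ʳ

  QF-rel : ∀ {Γ} r (s t : Tm Γ ι) → QF (⟦ r ⟧ʳ s t)
  QF-rel ltʳ s t = eq _ _
  QF-rel leʳ s t = eq _ _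

evalF-QF : ∀ {Γ Δ} (ε : Env Γ) (δ : Sub Δ Γ) (φ : Fo Δ) → T (isQF φ) → QF (evalF ε δ φ)
evalF-QF ε δ (s ≈ t) q       = eq _ _
evalF-QF ε δ (rel r s t) q   = QF-rel r _ _
evalF-QF ε δ ⊥′ q            = bot
evalF-QF ε δ (φ ∧′ ψ) q      = and (evalF-QF ε δ φ (proj₁ (T-&& q))) (evalF-QF ε δ ψ (proj₂ (T-&& {isQF φ} q)))
evalF-QF ε δ (φ ∨′ ψ) q      = or (evalF-QF ε δ φ (proj₁ (T-&& q))) (evalF-QF ε δ ψ (proj₂ (T-&& {isQF φ} q)))
evalF-QF ε δ (φ ⇒′ ψ) q      = imp (evalF-QF ε δ φ (proj₁ (T-&& q))) (evalF-QF ε δ ψ (proj₂ (T-&& {isQF φ} q)))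
evalF-QF ε δ (atom P ts) q   = evalF-QF ε (evals ε δ ts) P q

succ-sub : Sb (ι ∷ []) (ι ∷ [])
succ-sub (here refl) = su b₀

indQF : (φ : Fo (ι ∷ [])) {_ : T (isQF φ)} → Φ ⊩ φ [ 𝟎 ]ᶠ →
        ((n : Te [] ι) → φ [ n ]ᶠ ∷ Φ ⊩ φ [ n ]ᶠ → φ [ n ]ᶠ ∷ Φ ⊩ φ [ su n ]ᶠ) →
        (t : Te [] ι) → Φ ⊩ φ [ t ]ᶠ
indQF {Φ} φ {q} z s t = concl at t
  where
  step : Φ ⊩ ∀′ ι (φ ⇒′ subFo succ-sub φ)
  step = gen λ n → assume λ h → conv (λ ε → trans (evalF-subFo ε _ ∅ˢ φ) (trans
      (evalF-cong {δ' = λ x → eval ε _ (succ-sub x)} (λ _ _ → refl) (λ { (here refl) → refl ; (there ()) }) φ)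
      (sym (trans (evalF-subFo ε _ ∅ˢ (subFo succ-sub φ)) (evalF-subFo ε _ _ φ)))))
    (s n h)
  concl : Φ ⊩ ∀′ ι φ
  concl = mk λ ε → ⊃E (ax (inj₁ (inj₁ (inj₁ (QF-IA (evalF-QF (ε ⇑) (extˢ ∅ˢ) φ q))))))
    (∧I (subst (_ ∣ _ ⊢_) (sym (⟦[]⟧ ε φ 𝟎)) (run z ε))
        (subst (λ a → _ ∣ _ ⊢ ∀[ ι ] evalF (ε ⇑) (extˢ ∅ˢ) φ ⊃ a)
          (trans (evalF-subFo (ε ⇑) _ _ φ) (sym (trans (subF-evalF _ (ε ⇑) _ φ)
            (evalF-cong (λ τ n → trans (sub-ren there _ (ε τ n)) (sym (ren≡sub there (ε τ n))))
              (λ { (here refl) → refl ; (there ()) }) φ))))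
          (run step ε)))

choice-sub : Sb (τ ∷ σ ∷ []) (σ ∷ (σ ⇒ τ) ∷ [])
choice-sub (here refl)         = b₁ ∙ b₀
choice-sub (there (here refl)) = b₀

module _ {σ τ : Ty} (a : ∀ {Γ} {φ : Fm Γ} → QF-AC σ τ φ → 𝕋 φ) where
  acQF : (φ : Fo (τ ∷ σ ∷ [])) {_ : T (isQF φ)} → Φ ⊩ ∀′ σ (∃′ τ φ) → Φ ⊩ ∃′ (σ ⇒ τ) (∀′ σ (subFo choice-sub φ))
  acQF φ {q} d = mk λ ε → subst (λ a → _ ∣ _ ⊢ ∃[ _ ] ∀[ _ ] a)
    (trans (subF-evalF _ (ε ⇑ ⇑) _ φ) (trans
      (evalF-cong (λ τ n → trans (sub-ren there _ (ε τ n ↑)) (trans (sub-ren there _ (ε τ n))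
                      (trans (sym (ren≡sub (λ x → there (there x)) (ε τ n))) (sym (ren-ren there there (ε τ n))))))
                  (λ { (here refl) → refl ; (there (here refl)) → refl ; (there (there ())) }) φ)
      (sym (evalF-subFo (ε ⇑ ⇑) choice-sub _ φ))))
    (⊃E (ax (a (qf-ac (evalF-QF (ε ⇑ ⇑) (extˢ (extˢ ∅ˢ)) φ q)))) (run d ε))

𝐄 : ∀ {Δ} → Te Δ 𝟐
𝐄 = nm 0

E-ax : Φ ⊩ ∀′ 𝟏 ((𝐄 ∙ b₀ ≈ 𝟎 ∨′ 𝐄 ∙ b₀ ≈ 𝟏′) ∧′ (∃′ ι (b₁ ∙ b₀ ≈ 𝟎) ⇔′ 𝐄 ∙ b₀ ≈ 𝟎))
E-ax = mk λ ε → hyp (here refl)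

-- Here `∃²` enters as an axiom: its functional is assigned to name 0. The goal contains no names,
-- hence does not depend on this assignment and survives the elimination of the existential.
⊩-closed : ∀ (φ : Fo []) → boundF φ ≡ 0 → [] ⊩ φ → (ε : Env []) → 𝕋 ∣ [] ⊢ ⟦ φ ⟧ ε
⊩-closed φ p d ε = ∃E (ax (inj₁ (inj₂ ∃²-ax)))
  (subst (𝕋 ∣ Espec v₀ ∷ [] ⊢_)
    (trans (evalF-agree {k = 0} (λ _ _ ()) (λ ()) φ (subst (_≤ 0) (sym p) z≤n))
           (sym (trans (renF-evalF there ε ∅ˢ φ) (evalF-cong {δ' = ∅ˢ} (λ _ _ → refl) (λ ()) φ))))
    (run d ε'))
  where
  ε' : Env (𝟐 ∷ [])
  ε' ((ι ⇒ ι) ⇒ ι) zero = v₀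
  ε' σ n = ε σ n ↑

private variable
  a b c d r s t u s' t' : Te [] ι

-- Arithmetic

infixr 2 _≈⟨_⟩_ _≈⟨_⟨_
infix  3 _∎

_≈⟨_⟩_ : ∀ s → Φ ⊩ s ≈ t → Φ ⊩ t ≈ u → Φ ⊩ s ≈ u
_ ≈⟨ p ⟩ q = ≈trans p q

_≈⟨_⟨_ : ∀ s → Φ ⊩ t ≈ s → Φ ⊩ t ≈ u → Φ ⊩ s ≈ u
_ ≈⟨ p ⟨ q = ≈trans (≈sym p) q

_∎ : ∀ t → Φ ⊩ t ≈ t
_ ∎ = rfl

un-cong : ∀ f → Φ ⊩ s ≈ t → Φ ⊩ un f s ≈ un f t
un-cong f p = ctx (un f b₀) p

bin-cong : ∀ f → Φ ⊩ s ≈ s' → Φ ⊩ t ≈ t' → Φ ⊩ bin f s t ≈ bin f s' t'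
bin-cong {s' = s'} {t = t} f p q = ≈trans (ctx (bin f b₀ (clo t)) p) (ctx (bin f (clo s') b₀) q)

su-cong : Φ ⊩ s ≈ t → Φ ⊩ su s ≈ su t
su-cong p = ctx (su b₀) p

app-cong : ∀ {f : Te [] (ι ⇒ ι)} → Φ ⊩ s ≈ t → Φ ⊩ f ∙ s ≈ f ∙ t
app-cong {f = f} p = ctx (clo f ∙ b₀) p

infixl 21 _⊹c_
_⊹c_ : Φ ⊩ s ≈ s' → Φ ⊩ t ≈ t' → Φ ⊩ s ⊹ t ≈ s' ⊹ t'
_⊹c_ = bin-cong plusᵇ

_∸c_ : Φ ⊩ s ≈ s' → Φ ⊩ t ≈ t' → Φ ⊩ s ∸′ t ≈ s' ∸′ t'
_∸c_ = bin-cong monusᵇ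

infixl 22 _×c_
_×c_ : Φ ⊩ s ≈ s' → Φ ⊩ t ≈ t' → Φ ⊩ s ×′ t ≈ s' ×′ t'
_×c_ = bin-cong timesᵇ

beta₂ : ∀ (f : Te (ι ∷ ι ∷ []) ι) → Φ ⊩ lam (lam f) ∙ s ∙ t ≈ subTe (exts (inst s)) f [ t ]ᵗ
beta₂ {s = s} {t} f = ≈trans (beta (lam f) s at t) (beta (subTe (exts (inst s)) f) t)

rec-step : ∀ (f : Te (ι ∷ ι ∷ []) ι) →
           Φ ⊩ rec′ ∙ su t ∙ a ∙ lam (lam f) ≈ subTe (exts (inst (rec′ ∙ t ∙ a ∙ lam (lam f)))) f [ t ]ᵗ
rec-step f = ≈trans rec-suc (beta₂ f)

pred′ : ∀ {Δ} → Te Δ ι → Te Δ ι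
pred′ t = rec′ ∙ t ∙ 𝟎 ∙ lam (lam b₀)

pred-zero : Φ ⊩ pred′ 𝟎 ≈ 𝟎
pred-zero = rec-zero

pred-suc : Φ ⊩ pred′ (su t) ≈ t
pred-suc = rec-step b₀

pred-cong : Φ ⊩ s ≈ t → Φ ⊩ pred′ s ≈ pred′ t
pred-cong p = ctx (pred′ b₀) p

opaque
  unfolding ⟦_⟧ᵘ ⟦_⟧ᵇ

  +-zero : Φ ⊩ s ⊹ 𝟎 ≈ s
  +-zero {s = s} = conv (λ ε → refl) (rec-zero {a = s} {f = lam (lam (su b₁))})

  +-suc : Φ ⊩ s ⊹ su t ≈ su (s ⊹ t)
  +-suc {s = s} {t} = conv (λ ε → refl) (rec-step {t = t} {a = s} (su b₁))

  ∸-zero : Φ ⊩ s ∸′ 𝟎 ≈ s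
  ∸-zero {s = s} = conv (λ ε → refl) (rec-zero {a = s} {f = lam (lam (pred′ b₁))})

  ∸-suc : Φ ⊩ s ∸′ su t ≈ pred′ (s ∸′ t)
  ∸-suc {s = s} {t} = conv (λ ε → refl) (rec-step {t = t} {a = s} (pred′ b₁))

  -- The product of the statement is an abstraction applied to two arguments; two β-steps are due
  -- before the recursor equations can be used.
  ×-unfold : Φ ⊩ s ×′ t ≈ rec′ ∙ t ∙ 𝟎 ∙ lam (lam (b₁ ⊹ clo s))
  ×-unfold {s = s} {t} = conv (λ ε → refl) (beta₂ {s = s} {t} (rec′ ∙ b₀ ∙ 𝟎 ∙ lam (lam (b₁ ⊹ b₃))))

  ×-zero : Φ ⊩ s ×′ 𝟎 ≈ 𝟎
  ×-zero = ≈trans ×-unfold rec-zero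

  ×-suc : Φ ⊩ s ×′ su t ≈ s ×′ t ⊹ s
  ×-suc {s = s} = ≈trans ×-unfold (≈trans (rec-step (b₁ ⊹ clo s)) (≈sym ×-unfold ⊹c rfl))

  two-zero : Φ ⊩ un twoᵘ 𝟎 ≈ 𝟏′
  two-zero = conv (λ ε → refl) (rec-zero {a = 𝟏′} {f = lam (lam (b₁ ⊹ b₁))})

  two-suc : Φ ⊩ un twoᵘ (su t) ≈ un twoᵘ t ⊹ un twoᵘ t
  two-suc {t = t} = conv (λ ε → refl) (rec-step {t = t} {a = 𝟏′} (b₁ ⊹ b₁))

  tri-suc : Φ ⊩ un triᵘ (su t) ≈ un triᵘ t ⊹ su t
  tri-suc {t = t} = conv (λ ε → refl) (rec-step {t = t} {a = 𝟎} (b₁ ⊹ su b₀))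

  tri-zero : Φ ⊩ un triᵘ 𝟎 ≈ 𝟎
  tri-zero = conv (λ ε → refl) (rec-zero {a = 𝟎} {f = lam (lam (b₁ ⊹ su b₀))})

  root-zero : Φ ⊩ un rootᵘ 𝟎 ≈ 𝟎
  root-zero = conv (λ ε → refl) (rec-zero {a = 𝟎} {f = lam (lam (b₁ ⊹ (𝟏′ ∸′ (un triᵘ (su b₁) ∸′ su b₀))))})

  root-suc : Φ ⊩ un rootᵘ (su t) ≈ un rootᵘ t ⊹ (𝟏′ ∸′ (un triᵘ (su (un rootᵘ t)) ∸′ su t))
  root-suc {t = t} = conv (λ ε → refl) (rec-step {t = t} {a = 𝟎} (b₁ ⊹ (𝟏′ ∸′ (un triᵘ (su b₁) ∸′ su b₀))))

  pair-def : Φ ⊩ pair s t ≈ un triᵘ (s ⊹ t) ⊹ t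
  pair-def {s = s} {t} = conv (λ ε → refl) (rfl {t = un triᵘ (s ⊹ t) ⊹ t})

  snd-def : Φ ⊩ un sndᵘ t ≈ t ∸′ un triᵘ (un rootᵘ t)
  snd-def {t = t} = conv (λ ε → refl) (rfl {t = t ∸′ un triᵘ (un rootᵘ t)})

  fst-def : Φ ⊩ un fstᵘ t ≈ un rootᵘ t ∸′ un sndᵘ t
  fst-def {t = t} = conv (λ ε → refl) (rfl {t = un rootᵘ t ∸′ un sndᵘ t})

+-zeroˡ : ∀ t → Φ ⊩ 𝟎 ⊹ t ≈ t
+-zeroˡ = indQF (𝟎 ⊹ b₀ ≈ b₀) +-zero (λ n h → ≈trans +-suc (su-cong h))

+-sucˡ : ∀ s t → Φ ⊩ su s ⊹ t ≈ su (s ⊹ t)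
+-sucˡ s = indQF (su (clo s) ⊹ b₀ ≈ su (clo s ⊹ b₀)) (≈trans +-zero (su-cong (≈sym +-zero)))
  λ n h → ≈trans +-suc (su-cong (≈trans h (≈sym +-suc)))

+-comm : ∀ s t → Φ ⊩ s ⊹ t ≈ t ⊹ s
+-comm s = indQF (clo s ⊹ b₀ ≈ b₀ ⊹ clo s) (≈trans +-zero (≈sym (+-zeroˡ s)))
  λ n h → ≈trans +-suc (≈trans (su-cong h) (≈sym (+-sucˡ n s)))

+-assoc : ∀ s t u → Φ ⊩ (s ⊹ t) ⊹ u ≈ s ⊹ (t ⊹ u)
+-assoc s t = indQF ((clo s ⊹ clo t) ⊹ b₀ ≈ clo s ⊹ (clo t ⊹ b₀)) (≈trans +-zero (rfl ⊹c ≈sym +-zero))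
  λ n h → ≈trans +-suc (≈trans (su-cong h) (≈trans (≈sym +-suc) (rfl ⊹c ≈sym +-suc)))

+-exch : ∀ a b c d → Φ ⊩ (a ⊹ b) ⊹ (c ⊹ d) ≈ (a ⊹ c) ⊹ (b ⊹ d)
+-exch a b c d =
  (a ⊹ b) ⊹ (c ⊹ d)  ≈⟨ +-assoc a b _ ⟩
  a ⊹ (b ⊹ (c ⊹ d))  ≈⟨ rfl ⊹c +-assoc b c d ⟨
  a ⊹ ((b ⊹ c) ⊹ d)  ≈⟨ rfl ⊹c (+-comm b c ⊹c rfl) ⟩
  a ⊹ ((c ⊹ b) ⊹ d)  ≈⟨ rfl ⊹c +-assoc c b d ⟩
  a ⊹ (c ⊹ (b ⊹ d))  ≈⟨ +-assoc a c _ ⟨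
  (a ⊹ c) ⊹ (b ⊹ d)  ∎

×-zeroˡ : ∀ t → Φ ⊩ 𝟎 ×′ t ≈ 𝟎
×-zeroˡ = indQF (𝟎 ×′ b₀ ≈ 𝟎) ×-zero λ n h → ≈trans ×-suc (≈trans +-zero h)

×-sucˡ : ∀ s t → Φ ⊩ su s ×′ t ≈ s ×′ t ⊹ t
×-sucˡ s = indQF (su (clo s) ×′ b₀ ≈ clo s ×′ b₀ ⊹ b₀) (≈trans ×-zero (≈sym (≈trans +-zero ×-zero))) λ n h →
  su s ×′ su n            ≈⟨ ×-suc ⟩
  su s ×′ n ⊹ su s        ≈⟨ +-suc ⟩
  su (su s ×′ n ⊹ s)      ≈⟨ su-cong (h ⊹c rfl) ⟩
  su (s ×′ n ⊹ n ⊹ s)     ≈⟨ su-cong (≈trans (+-assoc _ _ _) (≈trans (rfl ⊹c +-comm n s) (≈sym (+-assoc _ _ _)))) ⟩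
  su (s ×′ n ⊹ s ⊹ n)     ≈⟨ +-suc ⟨
  s ×′ n ⊹ s ⊹ su n       ≈⟨ ×-suc ⊹c rfl ⟨
  s ×′ su n ⊹ su n        ∎

×-comm : ∀ s t → Φ ⊩ s ×′ t ≈ t ×′ s
×-comm s = indQF (clo s ×′ b₀ ≈ b₀ ×′ clo s) (≈trans ×-zero (≈sym (×-zeroˡ s)))
  λ n h → ≈trans ×-suc (≈trans (h ⊹c rfl) (≈sym (×-sucˡ n s)))

×-distribʳ : ∀ s t u → Φ ⊩ (t ⊹ u) ×′ s ≈ t ×′ s ⊹ u ×′ s
×-distribʳ s t u = indQF ((clo t ⊹ clo u) ×′ b₀ ≈ clo t ×′ b₀ ⊹ clo u ×′ b₀)
  (≈trans ×-zero (≈sym (≈trans (×-zero ⊹c ×-zero) +-zero)))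
  (λ n h → ≈trans ×-suc (≈trans (h ⊹c rfl) (≈trans (+-exch _ _ _ _) (≈sym (×-suc ⊹c ×-suc))))) s

×-distribˡ : ∀ s t u → Φ ⊩ s ×′ (t ⊹ u) ≈ s ×′ t ⊹ s ×′ u
×-distribˡ s t u = ≈trans (×-comm _ _) (≈trans (×-distribʳ s t u) (×-comm _ _ ⊹c ×-comm _ _))

×-assoc : ∀ s t u → Φ ⊩ (s ×′ t) ×′ u ≈ s ×′ (t ×′ u)
×-assoc s t = indQF ((clo s ×′ clo t) ×′ b₀ ≈ clo s ×′ (clo t ×′ b₀))
  (≈trans ×-zero (≈sym (≈trans (rfl ×c ×-zero) ×-zero)))
  λ n h → ≈trans ×-suc (≈trans (h ⊹c rfl) (≈trans (≈sym (×-distribˡ s _ t)) (rfl ×c ≈sym ×-suc)))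

×-oneˡ : ∀ t → Φ ⊩ 𝟏′ ×′ t ≈ t
×-oneˡ t = ≈trans (×-sucˡ 𝟎 t) (≈trans (×-zeroˡ t ⊹c rfl) (+-zeroˡ t))

-- With provable equality as the equality of the semiring, the ring solver produces derivations in
-- the object theory.
natSemiring : List (Fo []) → CommutativeSemiring 0ℓ 0ℓ
natSemiring Φ = record
  { Carrier = Te [] ι
  ; _≈_ = λ s t → Φ ⊩ s ≈ t
  ; _+_ = λ s t → s ⊹ t
  ; _*_ = λ s t → s ×′ t
  ; 0# = 𝟎
  ; 1# = 𝟏′
  ; isCommutativeSemiring = isCommutativeSemiringˡ record
    { +-isCommutativeMonoid = record { isMonoid = record { isSemigroup = record
        { isMagma = record { isEquivalence = eqv ; ∙-cong = _⊹c_ } ; assoc = +-assoc }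
        ; identity = +-zeroˡ , λ t → +-zero } ; comm = +-comm }
    ; *-isCommutativeMonoid = record { isMonoid = record { isSemigroup = record
        { isMagma = record { isEquivalence = eqv ; ∙-cong = _×c_ } ; assoc = ×-assoc }
        ; identity = ×-oneˡ , λ t → ≈trans (×-comm t 𝟏′) (×-oneˡ t) } ; comm = ×-comm }
    ; distribʳ = ×-distribʳ
    ; zeroˡ = ×-zeroˡ } }
  where
  eqv : IsEquivalence (λ s t → Φ ⊩ s ≈ t)
  eqv = record { refl = rfl ; sym = ≈sym ; trans = ≈trans }

module NatSolver {Φ : List (Fo [])} where
  open Algebra.Solver.Ring.NaturalCoefficients.Default (natSemiring Φ) public
    using (solve; _:=_; _:+_; _:*_)
open NatSolver public

-- Order

infix 19 _≤ₙ_
_≤ₙ_ : ∀ {Δ} → Te Δ ι → Te Δ ι → Fo Δ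
s ≤ₙ t = s ∸′ t ≈ 𝟎

su-∸ : ∀ s t → Φ ⊩ su s ∸′ su t ≈ s ∸′ t
su-∸ s = indQF (su (clo s) ∸′ su b₀ ≈ clo s ∸′ b₀)
  (≈trans ∸-suc (≈trans (pred-cong ∸-zero) (≈trans pred-suc (≈sym ∸-zero))))
  λ n h → ≈trans ∸-suc (≈trans (pred-cong h) (≈sym ∸-suc))

0∸ : ∀ t → Φ ⊩ 𝟎 ∸′ t ≈ 𝟎
0∸ = indQF (𝟎 ∸′ b₀ ≈ 𝟎) ∸-zero λ n h → ≈trans ∸-suc (≈trans (pred-cong h) pred-zero)

+-∸ : ∀ s t → Φ ⊩ (s ⊹ t) ∸′ t ≈ s
+-∸ s = indQF ((clo s ⊹ b₀) ∸′ b₀ ≈ clo s) (≈trans ∸-zero +-zero)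
  λ n h → ≈trans (+-suc ∸c rfl) (≈trans (su-∸ _ n) h)

≤-intro : ∀ {s t} r → Φ ⊩ s ⊹ r ≈ t → Φ ⊩ s ≤ₙ t
≤-intro {s = s} r p = ≈trans (rfl ∸c ≈sym p) (go r)
  where
  go : ∀ r → _ ⊩ s ∸′ (s ⊹ r) ≈ 𝟎
  go = indQF (clo s ∸′ (clo s ⊹ b₀) ≈ 𝟎) (≈trans (≈sym (+-zeroˡ s) ∸c +-zero) (+-∸ 𝟎 s))
    λ n h → ≈trans (rfl ∸c +-suc) (≈trans ∸-suc (≈trans (pred-cong h) pred-zero))

0∨suc : ∀ t → Φ ⊩ t ≈ 𝟎 ∨′ t ≈ su (pred′ t)
0∨suc = indQF (b₀ ≈ 𝟎 ∨′ b₀ ≈ su (pred′ b₀)) (left rfl) λ n h → right (su-cong (≈sym pred-suc))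

-- Quantifier-free, hence within reach of `QF-IA`. Both `≤-elim` and the totality of the order rest
-- on it.
∸-dichotomy : ∀ s t → Φ ⊩ s ∸′ t ≈ 𝟎 ∨′ t ⊹ (s ∸′ t) ≈ s
∸-dichotomy s = indQF (clo s ∸′ b₀ ≈ 𝟎 ∨′ b₀ ⊹ (clo s ∸′ b₀) ≈ clo s)
  (right (≈trans (rfl ⊹c ∸-zero) (+-zeroˡ s)))
  λ n h → cases (0∨suc (s ∸′ n))
    (λ z → left (≈trans ∸-suc (≈trans (pred-cong z) pred-zero)))
    λ q → cases (w h)
      (λ z → left (≈trans ∸-suc (≈trans (pred-cong z) pred-zero)))
      λ e → right (≈trans (rfl ⊹c ∸-suc) (≈trans (+-sucˡ _ _) (≈trans (≈sym +-suc)
              (≈trans (rfl ⊹c ≈sym (w q)) e))))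

≤-elim : Φ ⊩ s ≤ₙ t → Φ ⊩ s ⊹ (t ∸′ s) ≈ t
≤-elim {s = s} {t} p = go t ▹ p
  where
  go : ∀ t → _ ⊩ s ∸′ t ≈ 𝟎 ⇒′ s ⊹ (t ∸′ s) ≈ t
  go = indQF (clo s ∸′ b₀ ≈ 𝟎 ⇒′ clo s ⊹ (b₀ ∸′ clo s) ≈ b₀)
    (assume λ h → ≈trans (≈trans (≈sym ∸-zero) h ⊹c 0∸ s) +-zero)
    λ n h → assume λ e → cases (∸-dichotomy s n)
      (λ z → let ih = w² h ▹ z
                 q = ≈trans +-suc (su-cong ih)
             in ≈trans (rfl ⊹c ≈trans (≈sym q ∸c rfl) (≈trans (+-comm s _ ∸c rfl) (+-∸ _ s))) q)
      λ q → cases (0∨suc (s ∸′ n))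
        (λ z → let ih = w³ h ▹ z
                   q = ≈trans +-suc (su-cong ih)
               in ≈trans (rfl ⊹c ≈trans (≈sym q ∸c rfl) (≈trans (+-comm s _ ∸c rfl) (+-∸ _ s))) q)
        -- Here `s` exceeds `n` but not the successor of `n`, so it equals that successor.
        λ z → let one = ≈trans z (su-cong (≈trans (≈sym ∸-suc) (w² e)))
                  sn = ≈trans (≈sym (w q)) (≈trans (rfl ⊹c one) (≈trans +-suc (su-cong +-zero)))
              in ≈trans (rfl ⊹c ≈trans (≈sym sn ∸c rfl) (≈trans (≈sym (+-zeroˡ s) ∸c rfl) (+-∸ 𝟎 s)))
                        (≈trans +-zero sn)


≤-cong : Φ ⊩ s ≈ s' → Φ ⊩ t ≈ t' → Φ ⊩ s ≤ₙ t → Φ ⊩ s' ≤ₙ t'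
≤-cong p q h = ≈trans (≈sym (p ∸c q)) h

≤-refl′ : Φ ⊩ t ≤ₙ t
≤-refl′ = ≤-intro 𝟎 +-zero

≈⇒≤ : Φ ⊩ s ≈ t → Φ ⊩ s ≤ₙ t
≈⇒≤ p = ≤-cong rfl p ≤-refl′

≤-trans′ : Φ ⊩ s ≤ₙ t → Φ ⊩ t ≤ₙ u → Φ ⊩ s ≤ₙ u
≤-trans′ {s = s} {t} {u} p q = ≤-intro ((t ∸′ s) ⊹ (u ∸′ t))
  (≈trans (≈sym (+-assoc _ _ _)) (≈trans (≤-elim p ⊹c rfl) (≤-elim q)))

0≤ : Φ ⊩ 𝟎 ≤ₙ t
0≤ {t = t} = 0∸ t

s≤s+t : Φ ⊩ s ≤ₙ s ⊹ t
s≤s+t {t = t} = ≤-intro t rfl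

t≤s+t : Φ ⊩ t ≤ₙ s ⊹ t
t≤s+t {t = t} {s} = ≤-intro s (+-comm t s)

n≤suc : Φ ⊩ t ≤ₙ su t
n≤suc = ≤-intro 𝟏′ (≈trans +-suc (su-cong +-zero))

≤0⇒≈0 : Φ ⊩ t ≤ₙ 𝟎 → Φ ⊩ t ≈ 𝟎
≤0⇒≈0 p = ≈trans (≈sym ∸-zero) p

su-mono : Φ ⊩ s ≤ₙ t → Φ ⊩ su s ≤ₙ su t
su-mono {s = s} {t} p = ≈trans (su-∸ s t) p

su-mono⁻ : Φ ⊩ su s ≤ₙ su t → Φ ⊩ s ≤ₙ t
su-mono⁻ {s = s} {t} p = ≈trans (≈sym (su-∸ s t)) p

+-cancelʳ : Φ ⊩ a ⊹ c ≈ b ⊹ c → Φ ⊩ a ≈ b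
+-cancelʳ {a = a} {c} {b} p = ≈trans (≈sym (+-∸ a c)) (≈trans (p ∸c rfl) (+-∸ b c))

+-cancelˡ : Φ ⊩ c ⊹ a ≈ c ⊹ b → Φ ⊩ a ≈ b
+-cancelˡ {c = c} {a} {b} p = +-cancelʳ (≈trans (+-comm a c) (≈trans p (+-comm c b)))

su≰ : Φ ⊩ su t ≤ₙ t → Φ ⊩ ⊥′
su≰ {t = t} p = su≢0 (+-cancelˡ (≈trans +-suc (≈trans (≈sym (+-sucˡ t _)) (≈trans (≤-elim p) (≈sym +-zero)))))

≤-or-> : ∀ s t → Φ ⊩ s ≤ₙ t ∨′ su t ≤ₙ s
≤-or-> s t = cases (∸-dichotomy s t) left λ e → cases (0∨suc (s ∸′ t)) left
  λ q → right (≤-intro (pred′ (s ∸′ t)) (≈trans (+-sucˡ _ _) (≈trans (≈sym +-suc) (≈trans (rfl ⊹c ≈sym q) (w e)))))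

≰⇒> : Φ ⊩ ¬′ s ≤ₙ t → Φ ⊩ su t ≤ₙ s
≰⇒> {s = s} {t} n = cases (≤-or-> s t) (λ p → absurd (w n ▹ p)) λ p → p

≤-total : ∀ s t → Φ ⊩ s ≤ₙ t ∨′ t ≤ₙ s
≤-total s t = cases (≤-or-> s t) left λ p → right (≤-trans′ n≤suc p)

+≈0ˡ : Φ ⊩ s ⊹ t ≈ 𝟎 → Φ ⊩ s ≈ 𝟎
+≈0ˡ p = ≤0⇒≈0 (≤-cong rfl p s≤s+t)

+≈0ʳ : Φ ⊩ s ⊹ t ≈ 𝟎 → Φ ⊩ t ≈ 𝟎
+≈0ʳ p = ≤0⇒≈0 (≤-cong rfl p t≤s+t)

≤-antisym : Φ ⊩ s ≤ₙ t → Φ ⊩ t ≤ₙ s → Φ ⊩ s ≈ t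
≤-antisym {s = s} {t} p q = ≈sym (≈trans (≈sym (≤-elim p)) (≈trans (rfl ⊹c z) +-zero))
  where
  z : _ ⊩ t ∸′ s ≈ 𝟎
  z = q

+-mono : Φ ⊩ a ≤ₙ b → Φ ⊩ c ≤ₙ d → Φ ⊩ a ⊹ c ≤ₙ b ⊹ d
+-mono {a = a} {b} {c} {d} p q = ≤-intro ((b ∸′ a) ⊹ (d ∸′ c)) (≈trans (+-exch _ _ _ _) (≤-elim p ⊹c ≤-elim q))

+-cancel-≤ : Φ ⊩ a ⊹ c ≤ₙ b ⊹ c → Φ ⊩ a ≤ₙ b
+-cancel-≤ {a = a} {c} {b} p = ≤-intro ((b ⊹ c) ∸′ (a ⊹ c)) (+-cancelʳ
  (≈trans (+-assoc _ _ _) (≈trans (rfl ⊹c +-comm _ c) (≈trans (≈sym (+-assoc _ _ _)) (≤-elim p)))))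

×-mono : Φ ⊩ a ≤ₙ b → Φ ⊩ a ×′ c ≤ₙ b ×′ c
×-mono {a = a} {b} {c} p = ≤-intro ((b ∸′ a) ×′ c) (≈trans (≈sym (×-distribʳ c a _)) (≤-elim p ×c rfl))

×-cancel-≤ : Φ ⊩ a ×′ su c ≤ₙ b ×′ su c → Φ ⊩ a ≤ₙ b
×-cancel-≤ {a = a} {c} {b} p = cases (≤-or-> a b) (λ h → h) λ h → absurd (su≰
  (≤-trans′ (≤-intro c (≈trans (+-sucˡ _ _) (≈sym +-suc)))
  (≤-trans′ (≤-cong (×-sucˡ b (su c)) rfl (×-mono h)) (w p))))

-- Characteristic terms and arithmetical comprehension

num⁺ num⁻ den′ : ∀ {Δ} → Te Δ ι → Te Δ ι
num⁺ q = un fstᵘ q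
num⁻ q = un fstᵘ (un sndᵘ q)
den′ q = su (un sndᵘ (un sndᵘ q))

-- Comparisons of rationals evaluate to equations with right-hand side `O`; this is the left-hand
-- side, written in the second syntax.
relT : ∀ {Δ} → Rl → Te Δ ι → Te Δ ι → Te Δ ι
relT ltʳ q r = su (num⁺ q ×′ den′ r ⊹ num⁻ r ×′ den′ q) ∸′ (num⁺ r ×′ den′ q ⊹ num⁻ q ×′ den′ r)
relT leʳ q r = (num⁺ q ×′ den′ r ⊹ num⁻ r ×′ den′ q) ∸′ (num⁺ r ×′ den′ q ⊹ num⁻ q ×′ den′ r)

opaque
  unfolding ⟦_⟧ᵇ ⟦_⟧ʳ

  rel-elim : ∀ r {s t} → Φ ⊩ rel r s t → Φ ⊩ relT r s t ≈ 𝟎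
  rel-elim ltʳ = conv λ ε → refl
  rel-elim leʳ = conv λ ε → refl

  rel-intro : ∀ r {s t} → Φ ⊩ relT r s t ≈ 𝟎 → Φ ⊩ rel r s t
  rel-intro ltʳ = conv λ ε → refl
  rel-intro leʳ = conv λ ε → refl

ifz : ∀ {Δ} → Te Δ ι → Te Δ ι → Te Δ ι → Te Δ ι
ifz t a b = rec′ ∙ t ∙ a ∙ lam (lam (sh (sh b)))

not′ : ∀ {Δ} → Te Δ ι → Te Δ ι
not′ t = rec′ ∙ t ∙ 𝟏′ ∙ lam (lam 𝟎)

ifz-zero : Φ ⊩ t ≈ 𝟎 → Φ ⊩ ifz t a b ≈ a
ifz-zero {a = a} {b} p = ≈trans (ctx (rec′ ∙ b₀ ∙ clo a ∙ lam (lam (clo b))) p) rec-zero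

ifz-suc : Φ ⊩ t ≈ su u → Φ ⊩ ifz t a b ≈ b
ifz-suc {a = a} {b} p = ≈trans (ctx (rec′ ∙ b₀ ∙ clo a ∙ lam (lam (clo b))) p) (rec-step (clo b))

not′-cong : Φ ⊩ s ≈ t → Φ ⊩ not′ s ≈ not′ t
not′-cong p = ctx (not′ b₀) p

pos-elim : Φ ⊩ ¬′ t ≈ 𝟎 → Φ ⊩ t ≈ su (pred′ t)
pos-elim {t = t} n = cases (0∨suc t) (λ z → absurd (w n ▹ z)) λ q → q

zero-or-pos : ∀ t → (t ≈ 𝟎 ∷ Φ ⊩ t ≈ 𝟎 → t ≈ 𝟎 ∷ Φ ⊩ φ) →
              (t ≈ su (pred′ t) ∷ Φ ⊩ t ≈ su (pred′ t) → t ≈ su (pred′ t) ∷ Φ ⊩ φ) → Φ ⊩ φ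
zero-or-pos t = cases (0∨suc t)

not′-zero : Φ ⊩ t ≈ 𝟎 → Φ ⊩ not′ t ≈ 𝟎 → Φ ⊩ ⊥′
not′-zero p q = su≢0 (≈trans (≈sym (≈trans (not′-cong p) rec-zero)) q)

not′-intro : Φ ⊩ ¬′ t ≈ 𝟎 → Φ ⊩ not′ t ≈ 𝟎
not′-intro {t = t} n = ≈trans (not′-cong (pos-elim n)) (rec-step 𝟎)

infix 2 _⇔ᵢ_
_⇔ᵢ_ : (φ ∷ Φ ⊩ φ → φ ∷ Φ ⊩ ψ) → (ψ ∷ Φ ⊩ ψ → ψ ∷ Φ ⊩ φ) → Φ ⊩ φ ⇔′ ψ
f ⇔ᵢ g = assume f & assume g

isAr : ∀ {Δ} → Fo Δ → Bool
isAr (s ≈ t)     = true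
isAr (rel r s t) = true
isAr ⊥′          = true
isAr (φ ∧′ ψ)    = isAr φ && isAr ψ
isAr (φ ∨′ ψ)    = isAr φ && isAr ψ
isAr (φ ⇒′ ψ)    = isAr φ && isAr ψ
isAr (∀′ ι φ)    = isAr φ
isAr (∃′ ι φ)    = isAr φ
isAr (∀′ (_ ⇒ _) φ) = false
isAr (∃′ (_ ⇒ _) φ) = false
isAr (atom P ts) = isAr P

isAr-sub : ∀ {Δ Δ'} (θ : Sb Δ Δ') φ → isAr (subFo θ φ) ≡ isAr φ
isAr-sub θ (s ≈ t)     = refl
isAr-sub θ (rel r s t) = refl
isAr-sub θ ⊥′          = refl
isAr-sub θ (φ ∧′ ψ)    = cong₂ _&&_ (isAr-sub θ φ) (isAr-sub θ ψ)
isAr-sub θ (φ ∨′ ψ)    = cong₂ _&&_ (isAr-sub θ φ) (isAr-sub θ ψ)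
isAr-sub θ (φ ⇒′ ψ)    = cong₂ _&&_ (isAr-sub θ φ) (isAr-sub θ ψ)
isAr-sub θ (∀′ ι φ)    = isAr-sub (exts θ) φ
isAr-sub θ (∃′ ι φ)    = isAr-sub (exts θ) φ
isAr-sub θ (∀′ (_ ⇒ _) φ) = refl
isAr-sub θ (∃′ (_ ⇒ _) φ) = refl
isAr-sub θ (atom P ts) = refl

⟦sub-sub⟧ : ∀ {Γ Δ Δ'} (ε : Env Γ) (θ : Sb Δ Δ') (θ' : Sb Δ' []) (θ'' : Sb Δ []) (φ : Fo Δ) →
            (∀ {σ} (x : σ ∈ Δ) → eval ε ∅ˢ (subTe θ' (θ x)) ≡ eval ε ∅ˢ (θ'' x)) →
            ⟦ subFo θ' (subFo θ φ) ⟧ ε ≡ ⟦ subFo θ'' φ ⟧ ε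
⟦sub-sub⟧ ε θ θ' θ'' φ e = trans (evalF-subFo ε θ' ∅ˢ (subFo θ φ)) (trans (evalF-subFo ε θ _ φ)
  (trans (evalF-cong (λ _ _ → refl) (λ x → trans (sym (eval-subTe ε θ' ∅ˢ (θ x))) (e x)) φ)
         (sym (evalF-subFo ε θ'' ∅ˢ φ))))

infixl 10 _,ᵉ_
_,ᵉ_ : ∀ {Δ Δ'} → Sb Δ Δ' → Te Δ' σ → Sb (σ ∷ Δ) Δ'
(θ ,ᵉ a) (here refl) = a
(θ ,ᵉ a) (there x)   = θ x

⟦exts-inst⟧ : ∀ {Γ Δ} (ε : Env Γ) (θ : Sb Δ []) (a : Te [] σ) (φ : Fo (σ ∷ Δ)) →
              ⟦ subFo (exts θ) φ [ a ]ᶠ ⟧ ε ≡ ⟦ subFo (θ ,ᵉ a) φ ⟧ ε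
⟦exts-inst⟧ ε θ a φ = ⟦sub-sub⟧ ε (exts θ) (inst a) (θ ,ᵉ a) φ λ { (here refl) → refl ; (there x) → refl }

opaque
  unfolding ⟦_⟧ᵇ ⟦_⟧ʳ

  charac-eq : Φ ⊩ (s ≈ t) ⇔′ ⌈ s ≈ t ⌉ ≈ 𝟎
  charac-eq {s = s} {t} =
    (λ p → conv (λ ε → refl) (≈trans {t = 𝟎 ⊹ 𝟎} (≈⇒≤ p ⊹c ≈⇒≤ (≈sym p)) +-zero)) ⇔ᵢ
    (λ p → let q = conv {ψ = (s ∸′ t) ⊹ (t ∸′ s) ≈ 𝟎} (λ ε → refl) p in ≤-antisym (+≈0ˡ q) (+≈0ʳ q))

  charac-rel : ∀ r s t → Φ ⊩ rel r s t ⇔′ ⌈ rel r s t ⌉ ≈ 𝟎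
  charac-rel ltʳ s t = conv (λ ε → refl) (charac-eq {s = relT ltʳ s t} {𝟎})
  charac-rel leʳ s t = conv (λ ε → refl) (charac-eq {s = relT leʳ s t} {𝟎})

  ⌈∧⌉ : ∀ A B {Γ} (ε : Env Γ) → ⟦ (A ∧′ B) ⇔′ ⌈ A ⌉ ⊹ ⌈ B ⌉ ≈ 𝟎 ⟧ ε ≡ ⟦ (A ∧′ B) ⇔′ ⌈ A ∧′ B ⌉ ≈ 𝟎 ⟧ ε
  ⌈∧⌉ A B ε = refl

private
  -- Derivability is defined for closed formulas, but the induction passes under number quantifiers
  -- and into the definitions of atoms. The formula is therefore kept open and carried along with a
  -- closing substitution.
  charac-sub : ∀ {Δ} (θ : Sb Δ []) (φ : Fo Δ) → T (isAr φ) → ∀ {Φ} → Φ ⊩ subFo θ φ ⇔′ ⌈ subFo θ φ ⌉ ≈ 𝟎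

  charac-inst : ∀ {Δ} (θ : Sb Δ []) (φ : Fo (ι ∷ Δ)) → T (isAr φ) → (x : Te [] ι) → ∀ {Φ} →
                Φ ⊩ (subFo (exts θ) φ [ x ]ᶠ) ⇔′ ⌈ subFo (exts θ) φ [ x ]ᶠ ⌉ ≈ 𝟎
  charac-inst θ φ p x = conv (λ ε → cong (λ a → (a Defs.⊃⊂ χ (ε 𝟐 0) a Defs.≐ Defs.O)) (sym (⟦exts-inst⟧ ε θ x φ)))
    (charac-sub (θ ,ᵉ x) φ p)

  charac-sub θ (s ≈ t) p = charac-eq
  charac-sub θ (rel r s t) p = charac-rel r _ _
  charac-sub θ ⊥′ p = (λ h → absurd h) ⇔ᵢ (λ h → su≢0 (conv {ψ = 𝟏′ ≈ 𝟎} (λ ε → refl) h))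
  charac-sub θ (φ ∧′ ψ) p = conv (⌈∧⌉ A B)
    ((λ h → ≈trans ((π₁ (w ca) ▹ π₁ h) ⊹c (π₁ (w cb) ▹ π₂ h)) +-zero) ⇔ᵢ
     (λ h → (π₂ (w ca) ▹ +≈0ˡ h) & (π₂ (w cb) ▹ +≈0ʳ h)))
    where
    A = subFo θ φ
    B = subFo θ ψ
    ca = charac-sub θ φ (proj₁ (T-&& p))
    cb = charac-sub θ ψ (proj₂ (T-&& {isAr φ} p))
  charac-sub θ (φ ∨′ ψ) p = conv {φ = (A ∨′ B) ⇔′ ifz (not′ ⌈ A ⌉) ⌈ B ⌉ 𝟎 ≈ 𝟎} (λ ε → refl)
    ((λ h → zero-or-pos (not′ ⌈ A ⌉)
       (λ z → cases (w h) (λ x → absurd (not′-zero (π₁ (w³ ca) ▹ x) (w z)))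
                          (λ y → ≈trans (ifz-zero {b = 𝟎} (w z)) (π₁ (w³ cb) ▹ y)))
       (λ q → ifz-suc {b = 𝟎} q)) ⇔ᵢ
     (λ h → zero-or-pos (not′ ⌈ A ⌉)
       (λ z → right (π₂ (w² cb) ▹ ≈trans (≈sym (ifz-zero {b = 𝟎} z)) (w h)))
       (λ q → left (byContra λ n → su≢0 (≈trans (≈sym (w q)) (not′-intro (assume λ z → w n ▹ (π₂ (w⁴ ca) ▹ z)))))) ))
    where
    A = subFo θ φ
    B = subFo θ ψ
    ca = charac-sub θ φ (proj₁ (T-&& p))
    cb = charac-sub θ ψ (proj₂ (T-&& {isAr φ} p))
  charac-sub θ (φ ⇒′ ψ) p = conv {φ = (A ⇒′ B) ⇔′ ifz ⌈ A ⌉ ⌈ B ⌉ 𝟎 ≈ 𝟎} (λ ε → refl)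
    ((λ h → zero-or-pos ⌈ A ⌉
       (λ z → ≈trans (ifz-zero {b = 𝟎} z) (π₁ (w² cb) ▹ (w h ▹ (π₂ (w² ca) ▹ z))))
       (λ q → ifz-suc {b = 𝟎} q)) ⇔ᵢ
     (λ h → assume λ x → π₂ (w² cb) ▹ ≈trans (≈sym (ifz-zero {b = 𝟎} (π₁ (w² ca) ▹ x))) (w h)))
    where
    A = subFo θ φ
    B = subFo θ ψ
    ca = charac-sub θ φ (proj₁ (T-&& p))
    cb = charac-sub θ ψ (proj₂ (T-&& {isAr φ} p))
  charac-sub θ (∃′ ι φ) p = conv {φ = (∃′ ι A) ⇔′ 𝐄 ∙ lam ⌈ A ⌉ ≈ 𝟎} (λ ε → refl)
    ((λ h → obtain h λ x y → π₁ (π₂ (E-ax at lam ⌈ A ⌉)) ▹ witness x (≈trans (beta ⌈ A ⌉ x) (π₁ (charac-inst θ φ p x) ▹ y))) ⇔ᵢ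
     (λ h → obtain (π₂ (π₂ (E-ax at lam ⌈ A ⌉)) ▹ h) λ x y →
        witness x (π₂ (charac-inst θ φ p x) ▹ ≈trans (≈sym (beta ⌈ A ⌉ x)) y)))
    where
    A = subFo (exts θ) φ
  charac-sub θ (∀′ ι φ) p = conv {φ = (∀′ ι A) ⇔′ not′ (𝐄 ∙ lam (not′ ⌈ A ⌉)) ≈ 𝟎} (λ ε → refl)
    ((λ h → not′-intro (assume λ z → obtain (π₂ (π₂ (E-ax at lam (not′ ⌈ A ⌉))) ▹ z) λ x y →
        not′-zero (π₁ (charac-inst θ φ p x) ▹ (w² h at x)) (≈trans (≈sym (beta (not′ ⌈ A ⌉) x)) y))) ⇔ᵢ
     (λ h → gen λ x → π₂ (charac-inst θ φ p x) ▹ byContra λ n → not′-zero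
        (π₁ (π₂ (E-ax at lam (not′ ⌈ A ⌉))) ▹ witness x (≈trans (beta (not′ ⌈ A ⌉) x) (not′-intro n))) (w h)))
    where
    A = subFo (exts θ) φ
  charac-sub θ (atom P ts) p = conv (λ ε → cong (λ a → (a Defs.⊃⊂ χ (ε 𝟐 0) a Defs.≐ Defs.O)) (sym (⟦atom⟧ ε P (subTes θ ts))))
    (charac-sub (args (subTes θ ts)) P p)

charac : (φ : Fo []) {_ : T (isAr φ)} → Φ ⊩ φ ⇔′ ⌈ φ ⌉ ≈ 𝟎
charac φ {p} = conv (λ ε → cong (λ a → (a Defs.⊃⊂ χ (ε 𝟐 0) a Defs.≐ Defs.O)) (e ε)) (charac-sub (λ ()) φ p)
  where
  e : ∀ {Γ} (ε : Env Γ) → ⟦ subFo (λ ()) φ ⟧ ε ≡ ⟦ φ ⟧ ε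
  e ε = trans (evalF-subFo ε (λ ()) ∅ˢ φ) (evalF-cong (λ _ _ → refl) (λ ()) φ)

private
  charac-[] : (φ : Fo (σ ∷ [])) → T (isAr φ) → (x : Te [] σ) → Φ ⊩ φ [ x ]ᶠ ⇔′ ⌈ φ [ x ]ᶠ ⌉ ≈ 𝟎
  charac-[] φ p x = charac (φ [ x ]ᶠ) {subst T (sym (isAr-sub (inst x) φ)) p}

-- Quantifier-free induction on the equation `⌈ φ ⌉ ≈ 𝟎`. The same device extends the choice axioms
-- to arithmetical formulas in `acAr`.
ind : (φ : Fo (ι ∷ [])) {_ : T (isAr φ)} → Φ ⊩ φ [ 𝟎 ]ᶠ →
      ((n : Te [] ι) → φ [ n ]ᶠ ∷ Φ ⊩ φ [ n ]ᶠ → φ [ n ]ᶠ ∷ Φ ⊩ φ [ su n ]ᶠ) →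
      (t : Te [] ι) → Φ ⊩ φ [ t ]ᶠ
ind φ {p} z s t = π₂ (charac-[] φ p t) ▹ indQF (⌈ φ ⌉ ≈ 𝟎) (π₁ (charac-[] φ p 𝟎) ▹ z)
  (λ n h → π₁ (charac-[] φ p (su n)) ▹ (assume (s n) ▸ (π₂ (charac-[] φ p n) ▹ h))) t
  where
  _▸_ : ∀ {Φ φ ψ θ} → Φ ⊩ φ ⇒′ ψ → θ ∷ Φ ⊩ φ → θ ∷ Φ ⊩ ψ
  d ▸ e = w d ▹ e

module _ {σ τ : Ty} (a : ∀ {Γ} {φ : Defs.Fm Γ} → QF-AC σ τ φ → 𝕋 φ) where
  acAr : (φ : Fo (τ ∷ σ ∷ [])) {_ : T (isAr φ)} → Φ ⊩ ∀′ σ (∃′ τ φ) → Φ ⊩ ∃′ (σ ⇒ τ) (∀′ σ (subFo choice-sub φ))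
  acAr φ {p} h = obtain (acQF a (⌈ φ ⌉ ≈ 𝟎) (gen λ x → obtain (h at x) λ y q →
      witness y (π₁ (charac-[] (subFo (exts (inst x)) φ) (subst T (sym (isAr-sub (exts (inst x)) φ)) p) y) ▹ q)))
    λ G q → witness G (gen λ x → π₂ (charac-[] (subFo (exts (inst G)) (subFo choice-sub φ))
      (subst T (sym (trans (isAr-sub (exts (inst G)) (subFo choice-sub φ)) (isAr-sub choice-sub φ))) p) x) ▹ (q at x))

ac₁₀ : (φ : Fo (ι ∷ 𝟏 ∷ [])) {_ : T (isAr φ)} → Φ ⊩ ∀′ 𝟏 (∃′ ι φ) → Φ ⊩ ∃′ 𝟐 (∀′ 𝟏 (subFo choice-sub φ))
ac₁₀ φ {p} = acAr (λ q → inj₁ (inj₁ (inj₂ q))) φ {p}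
  where open import Data.Sum using (inj₁; inj₂)

ac₀₁ : (φ : Fo (𝟏 ∷ ι ∷ [])) {_ : T (isAr φ)} → Φ ⊩ ∀′ ι (∃′ 𝟏 φ) → Φ ⊩ ∃′ (ι ⇒ 𝟏) (∀′ ι (subFo choice-sub φ))
ac₀₁ φ {p} = acAr inj₂ φ {p}
  where open import Data.Sum using (inj₂)

-- Extensionality speaks of terms; it reaches a formula by being applied to the characteristic
-- function `lam ⌈ φ ⌉`. This is how functions known to agree only pointwise, such as a sequence and
-- its packed and unpacked form, are exchanged.
ext-replace : (φ : Fo (σ ∷ [])) {_ : T (isAr φ)} → ∀ {s t} → Φ ⊩ Eq′ σ s t → Φ ⊩ φ [ s ]ᶠ → Φ ⊩ φ [ t ]ᶠ
ext-replace φ {p} {s} {t} e h = π₂ (charac-[] φ p t) ▹ ≈trans (≈sym (beta ⌈ φ ⌉ t))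
  (≈trans (≈sym (exten {f = lam ⌈ φ ⌉} e)) (≈trans (beta ⌈ φ ⌉ s) (π₁ (charac-[] φ p s) ▹ h)))

private variable
  q q' r' k n m : Te [] ι

-- Pairing

tri-mono : Φ ⊩ s ≤ₙ t → Φ ⊩ un triᵘ s ≤ₙ un triᵘ t
tri-mono {s = s} {t} p = ≤-cong rfl (un-cong triᵘ (≤-elim p)) (go (t ∸′ s))
  where
  go : ∀ d → _ ⊩ un triᵘ s ≤ₙ un triᵘ (s ⊹ d)
  go = indQF (un triᵘ (clo s) ≤ₙ un triᵘ (clo s ⊹ b₀)) (≈⇒≤ (un-cong triᵘ (≈sym +-zero)))
    λ n h → ≤-trans′ h (≤-cong rfl (≈sym (≈trans (un-cong triᵘ +-suc) tri-suc)) s≤s+t)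

-- The recursion for the root adds 1 exactly when the next triangular number has been reached, and 0
-- otherwise.
root-spec : ∀ t → Φ ⊩ un triᵘ (un rootᵘ t) ≤ₙ t ∧′ su t ≤ₙ un triᵘ (su (un rootᵘ t))
root-spec = indQF (un triᵘ (un rootᵘ b₀) ≤ₙ b₀ ∧′ su b₀ ≤ₙ un triᵘ (su (un rootᵘ b₀)))
  (≈⇒≤ (≈trans (un-cong triᵘ root-zero) tri-zero) & ≤-cong rfl (≈sym tri-suc) (≤-trans′ (su-mono 0≤) t≤s+t))
  λ n h → cases (≤-or-> (un triᵘ (su (un rootᵘ n))) (su n))
    (λ z → let e = ≈trans root-suc (≈trans (rfl ⊹c ≈trans (rfl ∸c z) ∸-zero) (≈trans +-suc (su-cong +-zero))) in
      ≤-cong (un-cong triᵘ (≈sym e)) rfl z &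
      ≤-cong (≈trans +-suc (su-cong +-zero)) (≈sym (≈trans (un-cong triᵘ (su-cong e)) tri-suc))
        (+-mono (π₂ (w h)) (su-mono (0≤ {t = su (un rootᵘ n)}))))
    (λ q → let e₀ = pos-elim (assume λ z → su≰ (≤-trans′ (w q) z))
               e = ≈trans root-suc (≈trans (rfl ⊹c ≈trans (rfl ∸c e₀) (≈trans (su-∸ _ _) (0∸ _))) +-zero) in
      ≤-cong (un-cong triᵘ (≈sym e)) rfl (≤-trans′ (π₁ (w h)) n≤suc) &
      ≤-cong rfl (un-cong triᵘ (su-cong (≈sym e))) q)

-- A pair is the triangular number of `s ⊹ t` plus `t`, hence below the next triangular number;
-- `root-spec` and monotonicity leave no other value for the root.
root-pair : Φ ⊩ un rootᵘ (pair s t) ≈ s ⊹ t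
root-pair {s = s} {t} = ≤-antisym
  (cases (≤-or-> rt ky) (λ h → h) λ h → absurd (su≰ (≤-trans′ (≤-cong rfl (≈sym tri-suc)
     (≤-cong (≈trans +-suc (su-cong (≈sym pair-def))) rfl (+-mono (≤-refl′ {t = un triᵘ ky}) (su-mono (t≤s+t {t = t} {s}))))) (≤-trans′ (tri-mono h) (w l)))))
  (cases (≤-or-> ky rt) (λ h → h) λ h → absurd (su≰ (≤-trans′ (w g) (≤-trans′ (tri-mono h) (≤-cong rfl (≈sym pair-def) s≤s+t)))))
  where
  rt ky : Te [] ι
  rt = un rootᵘ (pair s t)
  ky = s ⊹ t
  l : _ ⊩ un triᵘ rt ≤ₙ pair s t
  l = π₁ (root-spec (pair s t))
  g : _ ⊩ su (pair s t) ≤ₙ un triᵘ (su rt)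
  g = π₂ (root-spec (pair s t))

snd-pair : Φ ⊩ un sndᵘ (pair s t) ≈ t
snd-pair {s = s} {t} = ≈trans snd-def (≈trans (≈trans pair-def (+-comm _ t) ∸c un-cong triᵘ root-pair) (+-∸ t _))

fst-pair : Φ ⊩ un fstᵘ (pair s t) ≈ s
fst-pair {s = s} {t} = ≈trans fst-def (≈trans (root-pair ∸c snd-pair) (+-∸ s t))

-- Rationals

rat′ : ∀ {Δ} → Te Δ ι → Te Δ ι → Te Δ ι → Te Δ ι
rat′ p m d = pair p (pair m d)

rat-num⁺ : Φ ⊩ num⁺ (rat′ a b c) ≈ a
rat-num⁺ = fst-pair

rat-num⁻ : Φ ⊩ num⁻ (rat′ a b c) ≈ b
rat-num⁻ = ≈trans (un-cong fstᵘ snd-pair) fst-pair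

rat-den : Φ ⊩ den′ (rat′ a b c) ≈ su c
rat-den = su-cong (≈trans (un-cong sndᵘ snd-pair) snd-pair)

-- Codes of rationals store the denominator minus one. This recovers the denominator wherever it is
-- known to be positive.
suc-∸1 : Φ ⊩ t ≈ su u → Φ ⊩ su (t ∸′ 𝟏′) ≈ t
suc-∸1 {t = t} {u} p = ≈trans (su-cong (≈trans (p ∸c rfl) (≈trans (su-∸ u 𝟎) ∸-zero))) (≈sym p)

den-× : Φ ⊩ su (den′ q ×′ den′ r ∸′ 𝟏′) ≈ den′ q ×′ den′ r
den-× = suc-∸1 (≈trans ×-suc +-suc)

num⁺-cong : Φ ⊩ q ≈ r → Φ ⊩ num⁺ q ≈ num⁺ r
num⁺-cong p = un-cong fstᵘ p

num⁻-cong : Φ ⊩ q ≈ r → Φ ⊩ num⁻ q ≈ num⁻ r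
num⁻-cong p = un-cong fstᵘ (un-cong sndᵘ p)

den-cong : Φ ⊩ q ≈ r → Φ ⊩ den′ q ≈ den′ r
den-cong p = su-cong (un-cong sndᵘ (un-cong sndᵘ p))

infixl 21 _+q_ _-q_
pattern _+q_ s t = bin addᵇ s t
pattern _-q_ s t = bin subᵇ s t
pattern absq t = un absᵘ t
pattern 2⁻ᵗ t = un halfᵘ t

-- Numerators and denominator of a code up to provable equality: estimates on rationals become
-- inequalities between numbers, without computing with the pairing function.
record Val (Φ : List (Fo [])) (p m d q : Te [] ι) : Set where
  constructor val
  field
    p≈ : Φ ⊩ num⁺ q ≈ p
    m≈ : Φ ⊩ num⁻ q ≈ m
    d≈ : Φ ⊩ den′ q ≈ d
open Val public

self-val : Val Φ (num⁺ q) (num⁻ q) (den′ q) q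
self-val = val rfl rfl rfl

rat-val : Φ ⊩ q ≈ rat′ a b c → Φ ⊩ su c ≈ d → Val Φ a b d q
rat-val p e = val (≈trans (num⁺-cong p) rat-num⁺) (≈trans (num⁻-cong p) rat-num⁻) (≈trans (den-cong p) (≈trans rat-den e))

opaque
  unfolding ⟦_⟧ᵘ ⟦_⟧ᵇ ⟦_⟧ʳ

  sub-val : Val Φ (num⁺ q ×′ den′ r ⊹ num⁻ r ×′ den′ q) (num⁻ q ×′ den′ r ⊹ num⁺ r ×′ den′ q) (den′ q ×′ den′ r) (q -q r)
  sub-val {q = q} {r} = rat-val (conv (λ ε → refl) (rfl {t = rat′ (num⁺ q ×′ den′ r ⊹ num⁻ r ×′ den′ q) (num⁻ q ×′ den′ r ⊹ num⁺ r ×′ den′ q)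
    (den′ q ×′ den′ r ∸′ 𝟏′)})) (den-× {q = q} {r})

  add-val : Val Φ (num⁺ q ×′ den′ r ⊹ num⁺ r ×′ den′ q) (num⁻ q ×′ den′ r ⊹ num⁻ r ×′ den′ q) (den′ q ×′ den′ r) (q +q r)
  add-val {q = q} {r} = rat-val (conv (λ ε → refl) (rfl {t = rat′ (num⁺ q ×′ den′ r ⊹ num⁺ r ×′ den′ q) (num⁻ q ×′ den′ r ⊹ num⁻ r ×′ den′ q)
    (den′ q ×′ den′ r ∸′ 𝟏′)})) (den-× {q = q} {r})

  abs-val : Val Φ ((num⁺ q ∸′ num⁻ q) ⊹ (num⁻ q ∸′ num⁺ q)) 𝟎 (den′ q) (absq q)
  abs-val {q = q} = rat-val (conv (λ ε → refl) (rfl {t = rat′ ((num⁺ q ∸′ num⁻ q) ⊹ (num⁻ q ∸′ num⁺ q)) 𝟎 (den′ q ∸′ 𝟏′)})) (suc-∸1 rfl)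

two-pos : ∀ t → Φ ⊩ un twoᵘ t ≈ su (pred′ (un twoᵘ t))
two-pos t = ≈trans e (su-cong (≈sym (≈trans (pred-cong e) pred-suc)))
  where
  e : _ ⊩ un twoᵘ t ≈ su (un twoᵘ t ∸′ 𝟏′)
  e = ≈sym (≤-elim′ (go t))
    where
    ≤-elim′ : Φ ⊩ 𝟏′ ≤ₙ s → Φ ⊩ su (s ∸′ 𝟏′) ≈ s
    ≤-elim′ p = ≈trans (≈sym (≈trans (+-sucˡ 𝟎 _) (su-cong (+-zeroˡ _)))) (≤-elim p)
    go : ∀ t → _ ⊩ 𝟏′ ≤ₙ un twoᵘ t
    go = indQF (𝟏′ ≤ₙ un twoᵘ b₀) (≈⇒≤ (≈sym two-zero)) λ n h → ≤-trans′ h (≤-cong rfl (≈sym two-suc) s≤s+t)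

opaque
  unfolding ⟦_⟧ᵘ ⟦_⟧ᵇ ⟦_⟧ʳ

  half-val : Val Φ 𝟏′ 𝟎 (un twoᵘ t) (2⁻ᵗ t)
  half-val {t = t} = rat-val (conv (λ ε → refl) (rfl {t = rat′ 𝟏′ 𝟎 (un twoᵘ t ∸′ 𝟏′)})) (suc-∸1 (two-pos t))

  dbl-val : Val Φ (su 𝟏′) 𝟎 (un twoᵘ t) (un dblᵘ t)
  dbl-val {t = t} = rat-val (conv (λ ε → refl) (rfl {t = rat′ (su 𝟏′) 𝟎 (un twoᵘ t ∸′ 𝟏′)})) (suc-∸1 (two-pos t))

0q : ∀ {Δ} → Te Δ ι
0q = rat′ 𝟎 𝟎 𝟎

0q-val : Val Φ 𝟎 𝟎 𝟏′ 0q
0q-val = rat-val rfl rfl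

infix 19 _≤q_
pattern _≤q_ s t = rel leʳ s t

module _ {Φ} {p m d p' m' d' q r} (v : Val Φ p m d q) (v' : Val Φ p' m' d' r) where
  private
    l : Φ ⊩ num⁺ q ×′ den′ r ⊹ num⁻ r ×′ den′ q ≈ p ×′ d' ⊹ m' ×′ d
    l = (p≈ v ×c d≈ v') ⊹c (m≈ v' ×c d≈ v)
    g : Φ ⊩ num⁺ r ×′ den′ q ⊹ num⁻ q ×′ den′ r ≈ p' ×′ d ⊹ m ×′ d'
    g = (p≈ v' ×c d≈ v) ⊹c (m≈ v ×c d≈ v')

  le-intro : Φ ⊩ p ×′ d' ⊹ m' ×′ d ≤ₙ p' ×′ d ⊹ m ×′ d' → Φ ⊩ q ≤q r
  le-intro h = rel-intro leʳ (≤-cong (≈sym l) (≈sym g) h)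

  le-elim : Φ ⊩ q ≤q r → Φ ⊩ p ×′ d' ⊹ m' ×′ d ≤ₙ p' ×′ d ⊹ m ×′ d'
  le-elim h = ≤-cong l g (rel-elim leʳ h)

lt⇒≰ : Φ ⊩ rel ltʳ q r → Φ ⊩ ¬′ (r ≤q q)
lt⇒≰ h = assume λ e → su≰ (≤-trans′ (rel-elim ltʳ (w h)) (rel-elim leʳ e))

≰⇒lt : Φ ⊩ ¬′ (r ≤q q) → Φ ⊩ rel ltʳ q r
≰⇒lt h = rel-intro ltʳ (≰⇒> (assume λ e → w h ▹ rel-intro leʳ e))

infix 4 _⊢_≈q_
-- Equality of value rather than of codes. As a pair of derivations, not a formula, it can be the
-- equality of a monoid.
_⊢_≈q_ : List (Fo []) → Te [] ι → Te [] ι → Set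
Φ ⊢ q ≈q r = (Φ ⊩ q ≤q r) × (Φ ⊩ r ≤q q)

same⇒≈q : ∀ {p m d} → Val Φ p m d q → Val Φ p m d r → Φ ⊢ q ≈q r
same⇒≈q v v' = le-intro v v' ≤-refl′ , le-intro v' v ≤-refl′

≤q-total : ∀ q r → Φ ⊩ q ≤q r ∨′ r ≤q q
≤q-total q r = cases (≤-total _ _) (λ h → left (rel-intro leʳ h)) (λ h → right (rel-intro leʳ h))

-- The two cross-multiplied inequalities are scaled by `den′ s` and `den′ q` and added. The
-- numerators of `r` then occur equally on both sides and cancel, and what remains has the common
-- factor `den′ r`.
≤q-trans : Φ ⊩ q ≤q r → Φ ⊩ r ≤q s → Φ ⊩ q ≤q s
≤q-trans {Φ} {q} {r} {s} h h' = rel-intro leʳ (×-cancel-≤ (+-cancel-≤ (≤-cong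
    (solve 9 (λ p₁ m₁ d₁ p₂ m₂ d₂ p₃ m₃ d₃ → (p₁ :* d₂ :+ m₂ :* d₁) :* d₃ :+ (p₂ :* d₃ :+ m₃ :* d₂) :* d₁ :=
      (p₁ :* d₃ :+ m₃ :* d₁) :* d₂ :+ (m₂ :* (d₁ :* d₃) :+ p₂ :* (d₃ :* d₁))) rfl
      (num⁺ q) (num⁻ q) (den′ q) (num⁺ r) (num⁻ r) (den′ r) (num⁺ s) (num⁻ s) (den′ s))
    (solve 9 (λ p₁ m₁ d₁ p₂ m₂ d₂ p₃ m₃ d₃ → (p₂ :* d₁ :+ m₁ :* d₂) :* d₃ :+ (p₃ :* d₂ :+ m₂ :* d₃) :* d₁ :=
      (p₃ :* d₁ :+ m₁ :* d₃) :* d₂ :+ (m₂ :* (d₁ :* d₃) :+ p₂ :* (d₃ :* d₁))) rfl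
      (num⁺ q) (num⁻ q) (den′ q) (num⁺ r) (num⁻ r) (den′ r) (num⁺ s) (num⁻ s) (den′ s))
    (+-mono (×-mono {c = den′ s} (rel-elim leʳ h)) (×-mono {c = den′ q} (rel-elim leʳ h'))))))

≤q-refl : ∀ {q} → Φ ⊩ q ≤q q
≤q-refl = rel-intro leʳ ≤-refl′

≈⇒≈q : Φ ⊩ q ≈ r → Φ ⊢ q ≈q r
≈⇒≈q {q = q} p = replace (rel leʳ (clo q) b₀) p ≤q-refl , replace (rel leʳ b₀ (clo q)) p ≤q-refl

≈q-sym : Φ ⊢ q ≈q r → Φ ⊢ r ≈q q
≈q-sym (p , q) = q , p

≈q-trans : Φ ⊢ q ≈q r → Φ ⊢ r ≈q s → Φ ⊢ q ≈q s
≈q-trans (p , q) (r , s) = ≤q-trans p r , ≤q-trans s q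

module _ {Φ : List (Fo [])} {q r s : Te [] ι} where
  private
    l : Φ ⊩ (num⁺ q ×′ den′ s ⊹ num⁺ s ×′ den′ q) ×′ (den′ r ×′ den′ s) ⊹ (num⁻ r ×′ den′ s ⊹ num⁻ s ×′ den′ r) ×′ (den′ q ×′ den′ s)
          ≈ (num⁺ q ×′ den′ r ⊹ num⁻ r ×′ den′ q) ×′ den′ s ×′ den′ s
            ⊹ (num⁺ s ×′ den′ q ×′ den′ r ×′ den′ s ⊹ num⁻ s ×′ den′ q ×′ den′ r ×′ den′ s)
    l = solve 9 (λ p₁ m₁ d₁ p₂ m₂ d₂ p₃ m₃ d₃ →
          (p₁ :* d₃ :+ p₃ :* d₁) :* (d₂ :* d₃) :+ (m₂ :* d₃ :+ m₃ :* d₂) :* (d₁ :* d₃) :=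
          (p₁ :* d₂ :+ m₂ :* d₁) :* d₃ :* d₃ :+ (p₃ :* d₁ :* d₂ :* d₃ :+ m₃ :* d₁ :* d₂ :* d₃)) rfl
          (num⁺ q) (num⁻ q) (den′ q) (num⁺ r) (num⁻ r) (den′ r) (num⁺ s) (num⁻ s) (den′ s)
    g : Φ ⊩ (num⁺ r ×′ den′ s ⊹ num⁺ s ×′ den′ r) ×′ (den′ q ×′ den′ s) ⊹ (num⁻ q ×′ den′ s ⊹ num⁻ s ×′ den′ q) ×′ (den′ r ×′ den′ s)
          ≈ (num⁺ r ×′ den′ q ⊹ num⁻ q ×′ den′ r) ×′ den′ s ×′ den′ s
            ⊹ (num⁺ s ×′ den′ q ×′ den′ r ×′ den′ s ⊹ num⁻ s ×′ den′ q ×′ den′ r ×′ den′ s)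
    g = solve 9 (λ p₁ m₁ d₁ p₂ m₂ d₂ p₃ m₃ d₃ →
          (p₂ :* d₃ :+ p₃ :* d₂) :* (d₁ :* d₃) :+ (m₁ :* d₃ :+ m₃ :* d₁) :* (d₂ :* d₃) :=
          (p₂ :* d₁ :+ m₁ :* d₂) :* d₃ :* d₃ :+ (p₃ :* d₁ :* d₂ :* d₃ :+ m₃ :* d₁ :* d₂ :* d₃)) rfl
          (num⁺ q) (num⁻ q) (den′ q) (num⁺ r) (num⁻ r) (den′ r) (num⁺ s) (num⁻ s) (den′ s)

  -- Cross-multiplied, the inequality of the sums is the original one times the square of `den′ s`,
  -- plus the same remainder on both sides. It can thus be read in either direction, which also
  -- gives `+q-cancelʳ`.
  +q-monoˡ : Φ ⊩ q ≤q r → Φ ⊩ q +q s ≤q r +q s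
  +q-monoˡ h = le-intro add-val add-val (≤-cong (≈sym l) (≈sym g)
    (+-mono (×-mono {c = den′ s} (×-mono {c = den′ s} (rel-elim leʳ h))) ≤-refl′))

  +q-cancelʳ : Φ ⊩ q +q s ≤q r +q s → Φ ⊩ q ≤q r
  +q-cancelʳ h = rel-intro leʳ (×-cancel-≤ (×-cancel-≤ (+-cancel-≤ (≤-cong l g (le-elim add-val add-val h)))))

+q-comm : ∀ q r → Φ ⊢ q +q r ≈q r +q q
+q-comm q r = same⇒≈q add-val (val (≈trans (p≈ add-val) (+-comm _ _)) (≈trans (m≈ add-val) (+-comm _ _)) (≈trans (d≈ add-val) (×-comm _ _)))

+q-mono : Φ ⊩ q ≤q q' → Φ ⊩ r ≤q r' → Φ ⊩ q +q r ≤q q' +q r'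
+q-mono {q = q} {q'} {r} {r'} h h' = ≤q-trans (+q-monoˡ h) (≤q-trans (proj₁ (+q-comm q' r)) (≤q-trans (+q-monoˡ h') (proj₁ (+q-comm r' q'))))

+q-cong : Φ ⊢ q ≈q q' → Φ ⊢ r ≈q r' → Φ ⊢ q +q r ≈q q' +q r'
+q-cong (a , b) (c , d) = +q-mono a c , +q-mono b d

+q-assoc : ∀ q r s → Φ ⊢ (q +q r) +q s ≈q q +q (r +q s)
+q-assoc {Φ} q r s = same⇒≈q add-val (val
  (≈trans (p≈ add-val) (≈trans ((rfl ×c d≈ add-val) ⊹c (p≈ add-val ×c rfl)) (≈trans
     (solve 6 (λ p₁ d₁ p₂ d₂ p₃ d₃ → p₁ :* (d₂ :* d₃) :+ (p₂ :* d₃ :+ p₃ :* d₂) :* d₁ :=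
                (p₁ :* d₂ :+ p₂ :* d₁) :* d₃ :+ p₃ :* (d₁ :* d₂)) rfl
        (num⁺ q) (den′ q) (num⁺ r) (den′ r) (num⁺ s) (den′ s))
     (≈sym ((p≈ add-val ×c rfl) ⊹c (rfl ×c d≈ add-val))))))
  (≈trans (m≈ add-val) (≈trans ((rfl ×c d≈ add-val) ⊹c (m≈ add-val ×c rfl)) (≈trans
     (solve 6 (λ p₁ d₁ p₂ d₂ p₃ d₃ → p₁ :* (d₂ :* d₃) :+ (p₂ :* d₃ :+ p₃ :* d₂) :* d₁ :=
                (p₁ :* d₂ :+ p₂ :* d₁) :* d₃ :+ p₃ :* (d₁ :* d₂)) rfl
        (num⁻ q) (den′ q) (num⁻ r) (den′ r) (num⁻ s) (den′ s))
     (≈sym ((m≈ add-val ×c rfl) ⊹c (rfl ×c d≈ add-val))))))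
  (≈trans (d≈ add-val) (≈trans (rfl ×c d≈ add-val) (≈trans (≈sym (×-assoc _ _ _)) (≈sym (d≈ add-val ×c rfl))))))

×-one : ∀ t → Φ ⊩ t ×′ 𝟏′ ≈ t
×-one t = ≈trans (×-comm t 𝟏′) (×-oneˡ t)

+q-zero : ∀ q → Φ ⊢ q +q 0q ≈q q
+q-zero q = same⇒≈q (val
  (≈trans (p≈ add-val) (≈trans ((rfl ×c d≈ 0q-val) ⊹c (p≈ 0q-val ×c rfl)) (≈trans (×-one _ ⊹c ×-zeroˡ _) +-zero)))
  (≈trans (m≈ add-val) (≈trans ((rfl ×c d≈ 0q-val) ⊹c (m≈ 0q-val ×c rfl)) (≈trans (×-one _ ⊹c ×-zeroˡ _) +-zero)))
  (≈trans (d≈ add-val) (≈trans (rfl ×c d≈ 0q-val) (×-one _)))) self-val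

-- Input for the monoid solver. Together with cancellation, addition alone suffices for all linear
-- estimates below.
ratMonoid : List (Fo []) → CommutativeMonoid 0ℓ 0ℓ
ratMonoid Φ = record
  { Carrier = Te [] ι
  ; _≈_ = Φ ⊢_≈q_
  ; _∙_ = λ s t → s +q t
  ; ε = 0q
  ; isCommutativeMonoid = record
    { isMonoid = record
      { isSemigroup = record
        { isMagma = record { isEquivalence = eqv ; ∙-cong = +q-cong }
        ; assoc = +q-assoc }
      ; identity = (λ q → ≈q-trans (+q-comm 0q q) (+q-zero q)) , +q-zero }
    ; comm = +q-comm } }
  where
  eqv : IsEquivalence (Φ ⊢_≈q_)
  eqv = record { refl = ≤q-refl , ≤q-refl ; sym = ≈q-sym ; trans = ≈q-trans }

module RatSolver {Φ : List (Fo [])} where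
  open Algebra.Solver.CommutativeMonoid (ratMonoid Φ) public
    using (_⊜_) renaming (solve to solveq; _⊕_ to infixr 5 _:⊕_; id to :0)
open RatSolver public

-- A sum of hypotheses X ≤ Y yields A ≤ B when A + Y and B + X agree as sums.

linear : ∀ {A B X Y} → Φ ⊩ X ≤q Y → Φ ⊢ A +q Y ≈q B +q X → Φ ⊩ A ≤q B
linear h (e , _) = +q-cancelʳ (≤q-trans (+q-mono ≤q-refl h) e)

infixr 5 _⊕q_
_⊕q_ : Φ ⊩ q ≤q q' → Φ ⊩ r ≤q r' → Φ ⊩ q +q r ≤q q' +q r'
_⊕q_ = +q-mono

-- Later estimates treat a difference as an unknown summand constrained by this equation.
sub-+ : ∀ q r → Φ ⊢ (q -q r) +q r ≈q q
sub-+ {Φ} q r = le-intro v self-val (≈⇒≤ e) , le-intro self-val v (≈⇒≤ (≈sym e))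
  where
  v = val (≈trans (p≈ add-val) ((p≈ sub-val ×c rfl) ⊹c (rfl ×c d≈ sub-val)))
          (≈trans (m≈ add-val) ((m≈ sub-val ×c rfl) ⊹c (rfl ×c d≈ sub-val)))
          (≈trans (d≈ add-val) (d≈ sub-val ×c rfl))
  e = solve 6 (λ p m d p' m' d' →
        ((p :* d' :+ m' :* d) :* d' :+ p' :* (d :* d')) :* d :+ m :* ((d :* d') :* d') :=
        p :* ((d :* d') :* d') :+ ((m :* d' :+ p' :* d) :* d' :+ m' :* (d :* d')) :* d) rfl
        (num⁺ q) (num⁻ q) (den′ q) (num⁺ r) (num⁻ r) (den′ r)

module _ {Φ} {p d p' d' q r} (v : Val Φ p 𝟎 d q) (v' : Val Φ p' 𝟎 d' r) where
  private
    e : ∀ {x y} → Φ ⊩ x ⊹ 𝟎 ×′ y ≈ x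
    e = ≈trans (rfl ⊹c ×-zeroˡ _) +-zero

  nonneg-intro : Φ ⊩ p ×′ d' ≤ₙ p' ×′ d → Φ ⊩ q ≤q r
  nonneg-intro h = le-intro v v' (≤-cong (≈sym e) (≈sym e) h)

  nonneg-elim : Φ ⊩ q ≤q r → Φ ⊩ p ×′ d' ≤ₙ p' ×′ d
  nonneg-elim h = ≤-cong e e (le-elim v v' h)

private
  half-sum : Val Φ (𝟏′ ×′ un twoᵘ k ⊹ 𝟏′ ×′ un twoᵘ k) 𝟎 (un twoᵘ k ×′ un twoᵘ k) (2⁻ᵗ k +q 2⁻ᵗ k)
  half-sum = val (≈trans (p≈ add-val) (cc ⊹c cc)) (≈trans (m≈ add-val) (≈trans (z ⊹c z) +-zero)) (≈trans (d≈ add-val) (d≈ half-val ×c d≈ half-val))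
    where
    cc = p≈ half-val ×c d≈ half-val
    z = ≈trans (m≈ half-val ×c rfl) (×-zeroˡ _)

half-suc : ∀ k → Φ ⊢ 2⁻ᵗ (su k) +q 2⁻ᵗ (su k) ≈q 2⁻ᵗ k
half-suc {Φ} k = nonneg-intro half-sum half-val (≈⇒≤ e) , nonneg-intro half-val half-sum (≈⇒≤ (≈sym e))
  where
  e = ≈trans (((rfl ×c two-suc) ⊹c (rfl ×c two-suc)) ×c rfl) (≈trans
        (solve 2 (λ o x → (o :* (x :+ x) :+ o :* (x :+ x)) :* x := o :* ((x :+ x) :* (x :+ x))) rfl 𝟏′ (un twoᵘ k))
        (rfl ×c ≈sym (two-suc ×c two-suc)))

dbl-half : ∀ k → Φ ⊢ un dblᵘ k ≈q 2⁻ᵗ k +q 2⁻ᵗ k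
dbl-half {Φ} k = nonneg-intro dbl-val half-sum (≈⇒≤ e) , nonneg-intro half-sum dbl-val (≈⇒≤ (≈sym e))
  where
  e = ≈trans (≈sym (≈trans +-suc (su-cong +-zero)) ×c rfl) (solve 2 (λ o x → (o :+ o) :* (x :* x) := (o :* x :+ o :* x) :* x) rfl 𝟏′ (un twoᵘ k))

0≤half : ∀ k → Φ ⊩ 0q ≤q 2⁻ᵗ k
0≤half k = nonneg-intro 0q-val half-val (≤-cong (≈sym (×-zeroˡ _)) rfl 0≤)

half≰0 : ∀ k → Φ ⊩ 2⁻ᵗ k ≤q 0q → Φ ⊩ ⊥′
half≰0 k h = su≢0 (≈trans (≈sym (×-one 𝟏′)) (≤0⇒≈0 (≤-cong rfl (×-zeroˡ _) (nonneg-elim half-val 0q-val h))))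

n≤two : ∀ n → Φ ⊩ n ≤ₙ un twoᵘ n
n≤two = indQF (b₀ ≤ₙ un twoᵘ b₀) 0≤ λ n h → ≤-cong (≈trans +-suc (su-cong +-zero)) (≈sym two-suc)
  (+-mono h (≤-cong rfl (≈sym (two-pos n)) (su-mono 0≤)))

-- A positive rational is at least the reciprocal of its denominator `d`, and `d` is at most the
-- `d`-th power of two.
archimedes : ∀ q → Φ ⊩ ¬′ (q ≤q 0q) → Φ ⊩ 2⁻ᵗ (den′ q) ≤q q
archimedes {Φ} q h = le-intro half-val self-val (≤-cong
    (≈trans (+-comm _ _) (≈sym (≈trans (×-oneˡ _) (≈sym (×-oneˡ _)) ⊹c rfl)))
    (≈sym (rfl ⊹c ×-zeroˡ _))
    (≤-cong rfl (≈sym +-zero) (≤-trans′ (+-mono (≤-refl′ {t = num⁻ q ×′ K}) (≤-cong (≈sym (×-oneˡ _)) rfl (n≤two (den′ q))))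
      (≤-cong (≈trans (×-sucˡ _ _) (rfl ⊹c rfl)) rfl (×-mono {c = K} g)))))
  where
  K = un twoᵘ (den′ q)
  g : Φ ⊩ su (num⁻ q) ≤ₙ num⁺ q
  g = ≰⇒> (assume λ e → w h ▹ le-intro self-val 0q-val
        (≤-cong (≈sym (≈trans (×-one _ ⊹c ×-zeroˡ _) +-zero)) (≈sym (≈trans (×-zeroˡ _ ⊹c ×-one _) (+-zeroˡ _))) e))

≈q-refl : ∀ {q} → Φ ⊢ q ≈q q
≈q-refl = ≤q-refl , ≤q-refl

private variable
  k' : Te [] ι
  x y z : Te [] 𝟏

-- Absolute values

0≤abs : ∀ q → Φ ⊩ 0q ≤q absq q
0≤abs q = nonneg-intro 0q-val abs-val (≤-cong (≈sym (×-zeroˡ _)) rfl 0≤)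

-- The second alternative expresses |q| = -q as a vanishing sum, the form that `linear` can use.
abs-cases : ∀ q → Φ ⊩ (absq q ≤q q ∧′ q ≤q absq q) ∨′ (absq q +q q ≤q 0q ∧′ 0q ≤q absq q +q q)
abs-cases q = cases (≤-total (num⁻ q) (num⁺ q))
  (λ h → let k : _ ⊩ ((num⁺ q ∸′ num⁻ q) ⊹ (num⁻ q ∸′ num⁺ q)) ⊹ num⁻ q ≈ num⁺ q
             k = ≈trans ((≈trans (rfl ⊹c h) +-zero) ⊹c rfl) (≈trans (+-comm _ _) (≤-elim h))
             k' = ≈trans (≈sym (×-distribʳ _ _ _)) (≈trans (k ×c rfl) (≈sym (≈trans (rfl ⊹c ×-zeroˡ _) +-zero)))
         in left (le-intro abs-val self-val (≈⇒≤ k') & le-intro self-val abs-val (≈⇒≤ (≈sym k'))))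
  (λ h → let k : _ ⊩ ((num⁺ q ∸′ num⁻ q) ⊹ (num⁻ q ∸′ num⁺ q)) ⊹ num⁺ q ≈ num⁻ q
             k = ≈trans ((≈trans (h ⊹c rfl) (+-zeroˡ _)) ⊹c rfl) (≈trans (+-comm _ _) (≤-elim h))
             v = val (≈trans (p≈ add-val) ((p≈ abs-val ×c rfl) ⊹c (rfl ×c d≈ abs-val)))
                     (≈trans (m≈ add-val) ((m≈ abs-val ×c rfl) ⊹c (rfl ×c d≈ abs-val)))
                     (≈trans (d≈ add-val) (d≈ abs-val ×c rfl))
             k' = ≈trans (≈trans (≈trans (rfl ⊹c ×-zeroˡ _) +-zero) (×-one _)) (≈trans (≈sym (×-distribʳ _ _ _)) (≈trans (k ×c rfl)
                    (≈sym (≈trans (×-zeroˡ _ ⊹c ×-one _) (≈trans (+-zeroˡ _) (≈trans (×-zeroˡ _ ⊹c rfl) (+-zeroˡ _)))))))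
         in right (le-intro v 0q-val (≈⇒≤ k') & le-intro 0q-val v (≈⇒≤ (≈sym k'))))

q≤abs : ∀ q → Φ ⊩ q ≤q absq q
q≤abs {Φ} q = cases (abs-cases q) π₂ λ h → linear (π₁ h ⊕q 0≤abs q ⊕q 0≤abs q)
  (solveq 2 (λ x y → x :⊕ (:0 :⊕ y :⊕ y) ⊜ y :⊕ ((y :⊕ x) :⊕ :0 :⊕ :0)) ≈q-refl q (absq q))

0≤q+abs : ∀ q → Φ ⊩ 0q ≤q q +q absq q
0≤q+abs q = cases (abs-cases q)
  (λ h → linear (0≤abs q ⊕q 0≤abs q ⊕q π₁ h)
    (solveq 2 (λ x y → :0 :⊕ (y :⊕ y :⊕ x) ⊜ (x :⊕ y) :⊕ (:0 :⊕ :0 :⊕ y)) ≈q-refl q (absq q)))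
  (λ h → ≤q-trans (π₂ h) (proj₁ (+q-comm _ _)))

abs-intro : Φ ⊩ q ≤q s → Φ ⊩ 0q ≤q q +q s → Φ ⊩ absq q ≤q s
abs-intro {q = q} {s} h h' = cases (abs-cases q) (λ e → ≤q-trans (π₁ e) (w h))
  λ e → linear (π₁ e ⊕q w h') (solveq 3 (λ x y z → y :⊕ :0 :⊕ x :⊕ z ⊜ z :⊕ (y :⊕ x) :⊕ :0) ≈q-refl q (absq q) s)

module _ {a b : Te [] ι} where
  -- Together with its two companions this trades a distance for two inequalities between sums, so
  -- that absolute values disappear from the estimates.
  dist-elimˡ : Φ ⊩ absq (a -q b) ≤q s → Φ ⊩ a ≤q b +q s
  dist-elimˡ {s = s} h = linear (q≤abs (a -q b) ⊕q h ⊕q proj₂ (sub-+ a b))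
    (solveq 5 (λ a b s d e → a :⊕ (e :⊕ s :⊕ d :⊕ b) ⊜ (b :⊕ s) :⊕ (d :⊕ e :⊕ a)) ≈q-refl a b s (a -q b) (absq (a -q b)))

  dist-elimʳ : Φ ⊩ absq (a -q b) ≤q s → Φ ⊩ b ≤q a +q s
  dist-elimʳ {s = s} h = linear (0≤q+abs (a -q b) ⊕q h ⊕q proj₁ (sub-+ a b))
    (solveq 5 (λ a b s d e → b :⊕ ((d :⊕ e) :⊕ s :⊕ a) ⊜ (a :⊕ s) :⊕ (:0 :⊕ e :⊕ d :⊕ b)) ≈q-refl a b s (a -q b) (absq (a -q b)))

  dist-intro : Φ ⊩ a ≤q b +q s → Φ ⊩ b ≤q a +q s → Φ ⊩ absq (a -q b) ≤q s
  dist-intro {s = s} h h' = abs-intro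
    (linear (h ⊕q proj₁ (sub-+ a b)) (solveq 4 (λ a b s d → d :⊕ (b :⊕ s) :⊕ a ⊜ s :⊕ a :⊕ (d :⊕ b)) ≈q-refl a b s (a -q b)))
    (linear (h' ⊕q proj₂ (sub-+ a b)) (solveq 4 (λ a b s d → :0 :⊕ (a :⊕ s) :⊕ (d :⊕ b) ⊜ (d :⊕ s) :⊕ b :⊕ a) ≈q-refl a b s (a -q b)))

≰⇒≥ : Φ ⊩ ¬′ (q ≤q r) → Φ ⊩ r ≤q q
≰⇒≥ {q = q} {r} h = cases (≤q-total q r) (λ e → absurd (w h ▹ e)) λ e → e

half-mono : ∀ n k → Φ ⊩ 2⁻ᵗ (n ⊹ k) ≤q 2⁻ᵗ n
half-mono n = ind (2⁻ᵗ (clo n ⊹ b₀) ≤q 2⁻ᵗ (clo n)) (proj₁ (≈⇒≈q (un-cong halfᵘ +-zero)))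
  λ k h → ≤q-trans (proj₁ (≈⇒≈q (un-cong halfᵘ +-suc))) (≤q-trans (linear (0≤half (su (n ⊹ k)) ⊕q proj₁ (half-suc (n ⊹ k)))
    (solveq 2 (λ a b → a :⊕ a :⊕ b ⊜ b :⊕ :0 :⊕ a :⊕ a) ≈q-refl (2⁻ᵗ (su (n ⊹ k))) (2⁻ᵗ (n ⊹ k)))) h)

half-anti : Φ ⊩ n ≤ₙ m → Φ ⊩ 2⁻ᵗ m ≤q 2⁻ᵗ n
half-anti {n = n} {m} p = ≤q-trans (proj₂ (≈⇒≈q (un-cong halfᵘ (≤-elim p)))) (half-mono n (m ∸′ n))

half-eight : ∀ n → let v = 2⁻ᵗ (su (su (su n))) in Φ ⊩ ((v +q v) +q (v +q v)) +q ((v +q v) +q (v +q v)) ≤q 2⁻ᵗ n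
half-eight n = proj₁ (≈q-trans (+q-cong f f) (half-suc n))
  where
  f = ≈q-trans (+q-cong (half-suc _) (half-suc _)) (half-suc (su n))

-- Real numbers

infixl 21 _-ᵣ_
infix  19 _≐ᵣ_ _<ᵣ_ _≤ᵣ_

_-ᵣ_ : ∀ {Δ} → Te Δ 𝟏 → Te Δ 𝟏 → Te Δ 𝟏
x -ᵣ y = lam (lam (lam (b₂ ∙ su b₀ -q b₁ ∙ su b₀))) ∙ x ∙ y

absᵣ : ∀ {Δ} → Te Δ 𝟏 → Te Δ 𝟏
absᵣ x = lam (lam (absq (b₁ ∙ b₀))) ∙ x

ratᵣ : ∀ {Δ} → Te Δ ι → Te Δ 𝟏
ratᵣ q = lam (lam b₁) ∙ q

RealP : Fo (𝟏 ∷ [])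
RealP = ∀′ ι (∀′ ι (rel ltʳ (absq (b₂ ∙ b₁ -q b₂ ∙ (b₁ ⊹ b₀))) (2⁻ᵗ b₁)))

EqP LtP : Fo (𝟏 ∷ 𝟏 ∷ [])
EqP = ∀′ ι (rel leʳ (absq (b₁ ∙ b₀ -q b₂ ∙ b₀)) (un dblᵘ b₀))
LtP = ∃′ ι (rel ltʳ (un dblᵘ b₀) (b₂ ∙ b₀ -q b₁ ∙ b₀))

Real′ : ∀ {Δ} → Te Δ 𝟏 → Fo Δ
Real′ x = atom RealP (x ∷ᵃ ∅ᵃ)

_≐ᵣ_ _<ᵣ_ _≤ᵣ_ : ∀ {Δ} → Te Δ 𝟏 → Te Δ 𝟏 → Fo Δ
x ≐ᵣ y = atom EqP (x ∷ᵃ y ∷ᵃ ∅ᵃ)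
x <ᵣ y = atom LtP (x ∷ᵃ y ∷ᵃ ∅ᵃ)
x ≤ᵣ y = ¬′ (y <ᵣ x)

-- DltP says x − y < r.  Margin and index share one bound, so that sums of such
-- statements need no new estimates.

NearP DltP : Fo (𝟏 ∷ 𝟏 ∷ ι ∷ [])
NearP = absᵣ (b₀ -ᵣ b₁) <ᵣ ratᵣ (2⁻ᵗ b₂)
DltP = ∃′ ι (∀′ ι (b₂ ∙ (b₁ ⊹ b₀) +q 2⁻ᵗ b₁ ≤q b₃ ∙ (b₁ ⊹ b₀) +q b₄))

Nearᵣ lt : ∀ {Δ} → Te Δ 𝟏 → Te Δ 𝟏 → Te Δ ι → Fo Δ
Nearᵣ x y k = atom NearP (x ∷ᵃ y ∷ᵃ k ∷ᵃ ∅ᵃ)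
lt x y r = atom DltP (x ∷ᵃ y ∷ᵃ r ∷ᵃ ∅ᵃ)

idx-cong : ∀ {i j} → Φ ⊩ i ≈ j → Φ ⊢ x ∙ i ≈q x ∙ j
idx-cong p = ≈⇒≈q (app-cong p)

real-≤ : Φ ⊩ Real′ x → ∀ n k → Φ ⊩ x ∙ n ≤q x ∙ (n ⊹ k) +q 2⁻ᵗ n
real-≤ h n k = dist-elimˡ (≰⇒≥ (lt⇒≰ (unfold h at n at k)))

real-≥ : Φ ⊩ Real′ x → ∀ n k → Φ ⊩ x ∙ (n ⊹ k) ≤q x ∙ n +q 2⁻ᵗ n
real-≥ h n k = dist-elimʳ (≰⇒≥ (lt⇒≰ (unfold h at n at k)))

-- Both bounds hold from the index `m₁ ⊹ m₂` on, and the margin required there is at most the first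
-- of the two given ones, so adding the inequalities is enough.
lt-trans : Φ ⊩ lt x y r → Φ ⊩ lt y z s → Φ ⊩ r +q s ≤q t → Φ ⊩ lt x z t
lt-trans {x = x} {y} {r} {z} {s} {t} h h' e = pick h λ m₁ f → pick (w h') λ m₂ g → exhibit (m₁ ⊹ m₂) (gen λ l →
  let i = (m₁ ⊹ m₂) ⊹ l
      e₁ = +-assoc m₁ m₂ l
      e₂ = ≈trans (+-comm m₁ m₂ ⊹c rfl) (+-assoc m₂ m₁ l)
      f' = ≤q-trans (+q-mono (proj₁ (idx-cong e₁)) ≤q-refl) (≤q-trans (w f at (m₂ ⊹ l)) (+q-mono (proj₂ (idx-cong e₁)) ≤q-refl))
      g' = ≤q-trans (+q-mono (proj₁ (idx-cong e₂)) ≤q-refl) (≤q-trans (g at (m₁ ⊹ l)) (+q-mono (proj₂ (idx-cong e₂)) ≤q-refl))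
  in linear (f' ⊕q g' ⊕q w² e ⊕q half-mono m₁ m₂ ⊕q 0≤half m₂)
       (solveq 9 (λ xi yi zi r s t u₁ u₂ u → (xi :⊕ u) :⊕ (yi :⊕ r) :⊕ (zi :⊕ s) :⊕ t :⊕ u₁ :⊕ u₂
                   ⊜ (zi :⊕ t) :⊕ (xi :⊕ u₁) :⊕ (yi :⊕ u₂) :⊕ (r :⊕ s) :⊕ u :⊕ :0) ≈q-refl
         (x ∙ i) (y ∙ i) (z ∙ i) r s t (2⁻ᵗ m₁) (2⁻ᵗ m₂) (2⁻ᵗ (m₁ ⊹ m₂))))

lt-weak : Φ ⊩ lt x y r → Φ ⊩ r ≤q s → Φ ⊩ lt x y s
lt-weak h e = pick h λ m f → exhibit m (gen λ l → ≤q-trans (f at l) (+q-mono ≤q-refl (w e)))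

lt-irrefl : Φ ⊩ lt x x r → Φ ⊩ r ≤q 0q → Φ ⊩ ⊥′
lt-irrefl {x = x} {r} h e = pick h λ m f → half≰0 m (linear (f at 𝟎 ⊕q w e)
  (solveq 3 (λ x u r → u :⊕ (x :⊕ r) :⊕ :0 ⊜ :0 :⊕ (x :⊕ u) :⊕ r) ≈q-refl (x ∙ (m ⊹ 𝟎)) (2⁻ᵗ m) r))

-- Since `lt` carries a uniform margin, its failure yields the reverse comparison only with a loss;
-- the positive slack in `r +q s` pays for it.
lt-total : Φ ⊩ Real′ x → Φ ⊩ Real′ y → Φ ⊩ ¬′ lt x y r → ∀ j → Φ ⊩ 2⁻ᵗ j ≤q r +q s → Φ ⊩ lt y x s
lt-total {x = x} {y} {r} {s} rx ry h j e = byContra λ n → w h ▹ exhibit M (gen λ l → byContra λ g → w n ▹ exhibit M (gen λ l' →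
  let i = M ⊹ l
      i' = M ⊹ l'
  in linear (real-≥ (w² ry) M l' ⊕q real-≤ (w² ry) M l ⊕q ≰⇒≥ g ⊕q real-≥ (w² rx) M l ⊕q real-≤ (w² rx) M l' ⊕q w² e ⊕q
             half-eight j ⊕q 0≤half M ⊕q 0≤half M)
       (solveq 10 (λ x₀ x₁ x₂ y₀ y₁ y₂ u u₀ r s →
          (y₂ :⊕ u) :⊕ (y₀ :⊕ u) :⊕ (y₁ :⊕ u) :⊕ (x₁ :⊕ u) :⊕ (x₀ :⊕ u) :⊕ (x₂ :⊕ u) :⊕ (r :⊕ s) :⊕ u₀ :⊕ u :⊕ u
          ⊜ (x₂ :⊕ s) :⊕ y₂ :⊕ y₀ :⊕ (y₁ :⊕ r) :⊕ x₁ :⊕ x₀ :⊕ u₀ :⊕ (((u :⊕ u) :⊕ (u :⊕ u)) :⊕ ((u :⊕ u) :⊕ (u :⊕ u))) :⊕ :0 :⊕ :0) ≈q-refl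
         (x ∙ M) (x ∙ i) (x ∙ i') (y ∙ M) (y ∙ i) (y ∙ i') (2⁻ᵗ M) (2⁻ᵗ j) r s)))
  where
  -- Four errors of regularity and two margins, each 2⁻ᴹ, have to fit into 2⁻ʲ. Six such summands
  -- are covered by eight, hence the shift by three.
  M : Te [] ι
  M = su (su (su j))

cut : Φ ⊩ φ → φ ∷ Φ ⊩ ψ → Φ ⊩ ψ
cut d e = assume (λ _ → e) ▹ d

-- One half of the margin is spent on lowering the bound, the other half is kept as the new margin.
lt-open : Φ ⊩ lt x y r → (∀ j → lt x y (r -q 2⁻ᵗ j) ∷ Φ ⊩ lt x y (r -q 2⁻ᵗ j) → lt x y (r -q 2⁻ᵗ j) ∷ Φ ⊩ ψ) → Φ ⊩ ψ
lt-open {x = x} {y} {r} h k = pick h λ m f → w (assume (k (su m))) ▹ exhibit (su m) (gen λ l →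
  let i = su m ⊹ l
      e = ≈trans (+-sucˡ m l) (≈sym +-suc)
  in linear (proj₁ (idx-cong e) ⊕q f at su l ⊕q proj₂ (idx-cong e) ⊕q proj₁ (half-suc m) ⊕q proj₂ (sub-+ r (2⁻ᵗ (su m))))
       (solveq 8 (λ x₁ x₂ y₁ y₂ u v r d → (x₁ :⊕ v) :⊕ x₂ :⊕ (y₂ :⊕ r) :⊕ y₁ :⊕ u :⊕ (d :⊕ v)
          ⊜ (y₁ :⊕ d) :⊕ x₁ :⊕ (x₂ :⊕ u) :⊕ y₂ :⊕ (v :⊕ v) :⊕ r) ≈q-refl
         (x ∙ i) (x ∙ (m ⊹ su l)) (y ∙ i) (y ∙ (m ⊹ su l)) (2⁻ᵗ m) (2⁻ᵗ (su m)) r (r -q 2⁻ᵗ (su m))))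

rat-at : ∀ q n → Φ ⊩ ratᵣ q ∙ n ≈ q
rat-at q n = ≈trans (beta (lam b₁) q at n) (beta (clo q) n)

-- The approximation with index `su n` is off by at most half of 2⁻ⁿ; the other half is left as the
-- margin.
approx-< : Φ ⊩ Real′ x → ∀ n → Φ ⊩ lt x (ratᵣ (x ∙ su n)) (2⁻ᵗ n)
approx-< {x = x} h n = exhibit (su n) (gen λ l →
  linear (real-≥ h (su n) l ⊕q proj₁ (half-suc n) ⊕q proj₂ (≈⇒≈q (rat-at (x ∙ su n) (su n ⊹ l))))
    (solveq 5 (λ xl xn u v t → (xl :⊕ v) :⊕ (xn :⊕ v) :⊕ u :⊕ t ⊜ (t :⊕ u) :⊕ xl :⊕ (v :⊕ v) :⊕ xn) ≈q-refl
      (x ∙ (su n ⊹ l)) (x ∙ su n) (2⁻ᵗ n) (2⁻ᵗ (su n)) (ratᵣ (x ∙ su n) ∙ (su n ⊹ l))))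

approx-> : Φ ⊩ Real′ x → ∀ n → Φ ⊩ lt (ratᵣ (x ∙ su n)) x (2⁻ᵗ n)
approx-> {x = x} h n = exhibit (su n) (gen λ l →
  linear (real-≤ h (su n) l ⊕q proj₁ (half-suc n) ⊕q proj₁ (≈⇒≈q (rat-at (x ∙ su n) (su n ⊹ l))))
    (solveq 5 (λ xl xn u v t → (t :⊕ v) :⊕ (xl :⊕ v) :⊕ u :⊕ xn ⊜ (xl :⊕ u) :⊕ xn :⊕ (v :⊕ v) :⊕ t) ≈q-refl
      (x ∙ (su n ⊹ l)) (x ∙ su n) (2⁻ᵗ n) (2⁻ᵗ (su n)) (ratᵣ (x ∙ su n) ∙ (su n ⊹ l))))

sub-pos : Φ ⊩ ¬′ (q ≤q r) → Φ ⊩ ¬′ ((q -q r) ≤q 0q)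
sub-pos {q = q} {r} h = assume λ e → w h ▹ linear (e ⊕q proj₂ (sub-+ q r))
  (solveq 3 (λ q r d → q :⊕ :0 :⊕ (d :⊕ r) ⊜ r :⊕ d :⊕ q) ≈q-refl q r (q -q r))

slack : Φ ⊩ ¬′ (q ≤q r) → Φ ⊩ r +q 2⁻ᵗ (den′ (q -q r)) ≤q q
slack {q = q} {r} h = linear (archimedes _ (sub-pos h) ⊕q proj₁ (sub-+ q r))
  (solveq 4 (λ q r d u → (r :⊕ u) :⊕ d :⊕ q ⊜ q :⊕ u :⊕ (d :⊕ r)) ≈q-refl q r (q -q r) (2⁻ᵗ (den′ (q -q r))))

lt-rat : Φ ⊩ ¬′ ((r +q s) ≤q q) → Φ ⊩ lt (ratᵣ q) (ratᵣ r) s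
lt-rat {r = r} {s} {q} h = exhibit (den′ ((r +q s) -q q)) (gen λ l → ≤q-trans (+q-mono (proj₁ (≈⇒≈q (rat-at q _))) ≤q-refl)
  (≤q-trans (slack h) (+q-mono (proj₂ (≈⇒≈q (rat-at r _))) ≤q-refl)))

lt-rat⁻ : Φ ⊩ lt (ratᵣ q) (ratᵣ r) s → Φ ⊩ (r +q s) ≤q q → Φ ⊩ ⊥′
lt-rat⁻ {q = q} {r} {s} h e = pick h λ m f → half≰0 m (linear
  (proj₂ (≈⇒≈q (rat-at q (m ⊹ 𝟎))) ⊕q f at 𝟎 ⊕q proj₁ (≈⇒≈q (rat-at r (m ⊹ 𝟎))) ⊕q w e)
  (solveq 6 (λ q r s q' r' u → u :⊕ q' :⊕ (r' :⊕ s) :⊕ r :⊕ q ⊜ :0 :⊕ q :⊕ (q' :⊕ u) :⊕ r' :⊕ (r :⊕ s)) ≈q-refl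
    q r s (ratᵣ q ∙ (m ⊹ 𝟎)) (ratᵣ r ∙ (m ⊹ 𝟎)) (2⁻ᵗ m)))

real-rat : ∀ q → Φ ⊩ Real′ (ratᵣ q)
real-rat q = fold (gen λ n → gen λ k → ≰⇒lt (assume λ h → half≰0 n (≤q-trans h
  (dist-intro (e n (n ⊹ k)) (e (n ⊹ k) n)))))
  where
  e : ∀ {Φ} i j → Φ ⊩ ratᵣ q ∙ i ≤q ratᵣ q ∙ j +q 0q
  e i j = ≤q-trans (proj₁ (≈⇒≈q (≈trans (rat-at q i) (≈sym (rat-at q j))))) (proj₂ (+q-zero _))

-- The gap strictly exceeds the two approximation errors. By `archimedes` the excess is at least a
-- power of 1/2, which can serve as a margin.
<-slack : ∀ {X Y} → Φ ⊩ rel ltʳ (un dblᵘ n) (Y -q X) →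
          Φ ⊩ X +q ((2⁻ᵗ n +q 2⁻ᵗ n) +q 2⁻ᵗ (den′ ((Y -q X) -q un dblᵘ n))) ≤q Y
<-slack {n = n} {X} {Y} h = linear (slack (lt⇒≰ h) ⊕q proj₂ (dbl-half n) ⊕q proj₁ (sub-+ Y X))
  (solveq 6 (λ x y d e u v → (x :⊕ (u :⊕ u) :⊕ v) :⊕ d :⊕ e :⊕ y ⊜ y :⊕ (e :⊕ v) :⊕ (u :⊕ u) :⊕ (d :⊕ x)) ≈q-refl
    X Y (Y -q X) (un dblᵘ n) (2⁻ᵗ n) (2⁻ᵗ (den′ ((Y -q X) -q un dblᵘ n))))

-- Two indices further on, the required gap 2/2ⁿ⁺² is only half of 2⁻ⁿ, so the comparison is strict.
<-unslack : ∀ {X Y} → Φ ⊩ X +q 2⁻ᵗ n ≤q Y → Φ ⊩ rel ltʳ (un dblᵘ (su (su n))) (Y -q X)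
<-unslack {n = n} {X} {Y} h = ≰⇒lt (assume λ g → half≰0 (su (su n)) (linear
  (w h ⊕q g ⊕q proj₁ (dbl-half (su (su n))) ⊕q proj₂ (sub-+ Y X) ⊕q proj₁ (half-suc n) ⊕q half-suc² ⊕q 0≤half (su (su n)))
  (solveq 7 (λ x y d e u₀ u₁ u₂ → u₂ :⊕ y :⊕ e :⊕ (u₂ :⊕ u₂) :⊕ (d :⊕ x) :⊕ u₀ :⊕ (u₁ :⊕ u₁) :⊕ u₂
      ⊜ :0 :⊕ (x :⊕ u₀) :⊕ d :⊕ e :⊕ y :⊕ (u₁ :⊕ u₁) :⊕ ((u₂ :⊕ u₂) :⊕ (u₂ :⊕ u₂)) :⊕ :0) ≈q-refl
    X Y (Y -q X) (un dblᵘ (su (su n))) (2⁻ᵗ n) (2⁻ᵗ (su n)) (2⁻ᵗ (su (su n))))))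
  where
  half-suc² : ∀ {Φ} → Φ ⊩ (2⁻ᵗ (su (su n)) +q 2⁻ᵗ (su (su n))) +q (2⁻ᵗ (su (su n)) +q 2⁻ᵗ (su (su n))) ≤q 2⁻ᵗ (su n) +q 2⁻ᵗ (su n)
  half-suc² = +q-mono (proj₁ (half-suc (su n))) (proj₁ (half-suc (su n)))

-- Carrying the gap from one index to all later ones costs 2/2ⁿ by regularity, exactly the amount
-- that the definition of the strict order sets aside; the excess found by `<-slack` becomes the
-- margin.
<⇒lt : Φ ⊩ Real′ x → Φ ⊩ Real′ y → Φ ⊩ x <ᵣ y → Φ ⊩ lt x y 0q
<⇒lt {x = x} {y} rx ry h = pick h λ n g → let k = den′ ((y ∙ n -q x ∙ n) -q un dblᵘ n) in exhibit (n ⊹ k) (gen λ l →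
  let i = (n ⊹ k) ⊹ l
      e = +-assoc n k l
  in linear (proj₁ (idx-cong e) ⊕q real-≥ (w rx) n (k ⊹ l) ⊕q <-slack g ⊕q real-≤ (w ry) n (k ⊹ l) ⊕q proj₂ (idx-cong e) ⊕q
             ≤q-trans (proj₁ (≈⇒≈q (un-cong halfᵘ (+-comm n k)))) (half-mono k n))
       (solveq 9 (λ xi xi' xn yi yi' yn un uk uu →
           (xi :⊕ uu) :⊕ xi' :⊕ (xn :⊕ un) :⊕ yn :⊕ (yi' :⊕ un) :⊕ yi :⊕ uk
           ⊜ (yi :⊕ :0) :⊕ xi :⊕ xi' :⊕ (xn :⊕ (un :⊕ un) :⊕ uk) :⊕ yn :⊕ yi' :⊕ uu) ≈q-refl
         (x ∙ i) (x ∙ (n ⊹ (k ⊹ l))) (x ∙ n) (y ∙ i) (y ∙ (n ⊹ (k ⊹ l))) (y ∙ n) (2⁻ᵗ n) (2⁻ᵗ k) (2⁻ᵗ (n ⊹ k))))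

lt⇒< : Φ ⊩ lt x y 0q → Φ ⊩ x <ᵣ y
lt⇒< {x = x} {y} h = pick h λ m f → exhibit (su (su m)) (<-unslack (linear
    (proj₁ (idx-cong (i m)) ⊕q f at su (su 𝟎) ⊕q proj₂ (idx-cong (i m)))
    (solveq 5 (λ x x' y y' u → (x :⊕ u) :⊕ x' :⊕ (y' :⊕ :0) :⊕ y ⊜ y :⊕ x :⊕ (x' :⊕ u) :⊕ y') ≈q-refl
       (x ∙ su (su m)) (x ∙ (m ⊹ su (su 𝟎))) (y ∙ su (su m)) (y ∙ (m ⊹ su (su 𝟎))) (2⁻ᵗ m))))
  where
  i : ∀ {Φ} m → Φ ⊩ su (su m) ≈ m ⊹ su (su 𝟎)
  i m = ≈sym (≈trans +-suc (su-cong (≈trans +-suc (su-cong +-zero))))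

-- Nearness and equality of reals

abs-sub-at : ∀ x y n → Φ ⊩ absᵣ (x -ᵣ y) ∙ n ≈ absq (x ∙ su n -q y ∙ su n)
abs-sub-at x y n = ≈trans (beta (lam (absq (b₁ ∙ b₀))) (x -ᵣ y) at n) (≈trans (beta (absq (clo (x -ᵣ y) ∙ b₀)) n)
  (un-cong absᵘ (≈trans (beta (lam (lam (b₂ ∙ su b₀ -q b₁ ∙ su b₀))) x at y at n)
    (≈trans (beta (lam (clo x ∙ su b₀ -q b₁ ∙ su b₀)) y at n) (beta (clo x ∙ su b₀ -q clo y ∙ su b₀) n)))))

rel-cong : ∀ f → Φ ⊩ a ≈ b → Φ ⊩ c ≈ d → Φ ⊩ rel f a c → Φ ⊩ rel f b d
rel-cong {b = b} {c} f p q h = replace (rel f (clo b) b₀) q (replace (rel f b₀ (clo c)) p h)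

-- Nearness is split into two one-sided bounds. The estimates below use it only through this lemma
-- and `near-intro`, so that the index shift in the difference of reals need not be considered
-- again.
near-elim : Φ ⊩ Real′ x → Φ ⊩ Real′ y → Φ ⊩ Nearᵣ x y k' → Φ ⊩ lt x y (2⁻ᵗ k') ∧′ lt y x (2⁻ᵗ k')
near-elim {x = x} {y} {k'} rx ry h = pick (unfold h) λ n g →
  let dst = absq (x ∙ su n -q y ∙ su n)
      g' = rel-cong ltʳ rfl (bin-cong subᵇ (rat-at (2⁻ᵗ k') n) (abs-sub-at x y n)) g
      k = den′ ((2⁻ᵗ k' -q dst) -q un dblᵘ n)
      one : ∀ {Φ} x y → Φ ⊩ Real′ x → Φ ⊩ Real′ y → Φ ⊩ x ∙ su n ≤q y ∙ su n +q dst →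
            Φ ⊩ dst +q ((2⁻ᵗ n +q 2⁻ᵗ n) +q 2⁻ᵗ k) ≤q 2⁻ᵗ k' → Φ ⊩ lt x y (2⁻ᵗ k')
      one x y rx ry t s = exhibit (su n ⊹ k) (gen λ l →
        let i = (su n ⊹ k) ⊹ l
            i' = su n ⊹ (k ⊹ l)
            e = +-assoc (su n) k l
        in linear (proj₁ (idx-cong e) ⊕q real-≥ rx (su n) (k ⊹ l) ⊕q t ⊕q s ⊕q real-≤ ry (su n) (k ⊹ l) ⊕q proj₂ (idx-cong e) ⊕q
             ≤q-trans (proj₁ (≈⇒≈q (un-cong halfᵘ (+-comm (su n) k)))) (half-mono k (su n)) ⊕q
             proj₁ (half-suc n) ⊕q 0≤half n)
           (solveq 12 (λ xi xi' xn yi yi' yn dd un us uk uu uk' →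
             (xi :⊕ uu) :⊕ xi' :⊕ (xn :⊕ us) :⊕ (yn :⊕ dd) :⊕ uk' :⊕ (yi' :⊕ us) :⊕ yi :⊕ uk :⊕ un :⊕ un
             ⊜ (yi :⊕ uk') :⊕ xi :⊕ xi' :⊕ xn :⊕ (dd :⊕ (un :⊕ un) :⊕ uk) :⊕ yn :⊕ yi' :⊕ uu :⊕ (us :⊕ us) :⊕ :0) ≈q-refl
             (x ∙ i) (x ∙ i') (x ∙ su n) (y ∙ i) (y ∙ i') (y ∙ su n) dst (2⁻ᵗ n) (2⁻ᵗ (su n)) (2⁻ᵗ k) (2⁻ᵗ (su n ⊹ k)) (2⁻ᵗ k')))
  in one x y (w rx) (w ry) (dist-elimˡ ≤q-refl) (<-slack g') & one y x (w ry) (w rx) (dist-elimʳ ≤q-refl) (<-slack g')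

near-intro : Φ ⊩ lt x y (2⁻ᵗ k') → Φ ⊩ lt y x (2⁻ᵗ k') → Φ ⊩ Nearᵣ x y k'
near-intro {x = x} {y} {k'} h h' = pick h λ m₁ f → pick (w h') λ m₂ g →
  let M = m₁ ⊹ m₂
      N = su (su (su M))
      e₁ : ∀ {Φ} → Φ ⊩ N ≈ m₁ ⊹ su (su (su m₂))
      e₁ = ≈sym (≈trans +-suc (su-cong (≈trans +-suc (su-cong +-suc))))
      e₂ : ∀ {Φ} → Φ ⊩ N ≈ m₂ ⊹ su (su (su m₁))
      e₂ = ≈trans (su-cong (su-cong (su-cong (+-comm m₁ m₂)))) (≈sym (≈trans +-suc (su-cong (≈trans +-suc (su-cong +-suc)))))
      one : ∀ {Φ} x y m j → Φ ⊩ N ≈ m ⊹ j → Φ ⊩ 2⁻ᵗ M ≤q 2⁻ᵗ m → Φ ⊩ x ∙ (m ⊹ j) +q 2⁻ᵗ m ≤q y ∙ (m ⊹ j) +q 2⁻ᵗ k' →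
            Φ ⊩ x ∙ N ≤q y ∙ N +q (2⁻ᵗ k' -q 2⁻ᵗ M)
      one x y m j e u f = linear (proj₁ (idx-cong e) ⊕q f ⊕q proj₂ (idx-cong e) ⊕q u ⊕q proj₂ (sub-+ (2⁻ᵗ k') (2⁻ᵗ M)))
        (solveq 8 (λ x x' y y' um uM uk d → x :⊕ x' :⊕ (y' :⊕ uk) :⊕ y :⊕ um :⊕ (d :⊕ uM)
            ⊜ (y :⊕ d) :⊕ x :⊕ (x' :⊕ um) :⊕ y' :⊕ uM :⊕ uk) ≈q-refl
          (x ∙ N) (x ∙ (m ⊹ j)) (y ∙ N) (y ∙ (m ⊹ j)) (2⁻ᵗ m) (2⁻ᵗ M) (2⁻ᵗ k') (2⁻ᵗ k' -q 2⁻ᵗ M))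
      d : _ ⊩ absq (x ∙ N -q y ∙ N) ≤q 2⁻ᵗ k' -q 2⁻ᵗ M
      d = dist-intro (one x y m₁ _ e₁ (half-mono m₁ m₂) (w f at _))
            (one y x m₂ _ e₂ (≤q-trans (proj₁ (≈⇒≈q (un-cong halfᵘ (+-comm m₁ m₂)))) (half-mono m₂ m₁)) (g at _))
  in fold (exhibit (su (su M)) (rel-cong ltʳ rfl (bin-cong subᵇ (≈sym (rat-at (2⁻ᵗ k') _)) (≈sym (abs-sub-at x y _)))
       (<-unslack (≤q-trans (+q-mono d ≤q-refl) (proj₁ (sub-+ _ _))))))

≐⇒≮ : Φ ⊩ x ≐ᵣ y → Φ ⊩ ¬′ (x <ᵣ y)
≐⇒≮ {x = x} {y} h = assume λ g → pick g λ n k → lt⇒≰ k ▹ linear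
  (dist-elimʳ (unfold (w² h) at n) ⊕q proj₁ (sub-+ (y ∙ n) (x ∙ n)))
  (solveq 4 (λ x y d e → e :⊕ (x :⊕ d) :⊕ y ⊜ d :⊕ y :⊕ (e :⊕ x)) ≈q-refl (x ∙ n) (y ∙ n) (un dblᵘ n) (y ∙ n -q x ∙ n))

≐⇒≯ : Φ ⊩ x ≐ᵣ y → Φ ⊩ ¬′ (y <ᵣ x)
≐⇒≯ {x = x} {y} h = assume λ g → pick g λ n k → lt⇒≰ k ▹ linear
  (dist-elimˡ (unfold (w² h) at n) ⊕q proj₁ (sub-+ (x ∙ n) (y ∙ n)))
  (solveq 4 (λ x y d e → e :⊕ (x :⊕ d) :⊕ y ⊜ d :⊕ y :⊕ (e :⊕ x)) ≈q-refl (y ∙ n) (x ∙ n) (un dblᵘ n) (x ∙ n -q y ∙ n))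

≮≯⇒≐ : Φ ⊩ ¬′ (x <ᵣ y) → Φ ⊩ ¬′ (y <ᵣ x) → Φ ⊩ x ≐ᵣ y
≮≯⇒≐ {x = x} {y} h g = fold (gen λ n → dist-intro (one x y n g) (one y x n h))
  where
  one : ∀ {Φ} x y n → Φ ⊩ ¬′ (y <ᵣ x) → Φ ⊩ x ∙ n ≤q y ∙ n +q un dblᵘ n
  one x y n g = linear (byContra {φ = (x ∙ n -q y ∙ n) ≤q un dblᵘ n} (λ e → w g ▹ exhibit n (≰⇒lt e)) ⊕q proj₂ (sub-+ (x ∙ n) (y ∙ n)))
    (solveq 4 (λ x y d e → x :⊕ d :⊕ (e :⊕ y) ⊜ (y :⊕ d) :⊕ e :⊕ x) ≈q-refl (x ∙ n) (y ∙ n) (un dblᵘ n) (x ∙ n -q y ∙ n))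

private variable
  x' y' : Te [] 𝟏

half+half : ∀ k → Φ ⊩ 2⁻ᵗ (su k) +q 2⁻ᵗ (su k) ≤q 2⁻ᵗ k
half+half k = proj₁ (half-suc k)

0+ : ∀ q → Φ ⊢ 0q +q q ≈q q
0+ q = ≈q-trans (+q-comm 0q q) (+q-zero q)

half-split : ∀ r j → Φ ⊩ 2⁻ᵗ j +q (r -q 2⁻ᵗ j) ≤q r
half-split r j = ≤q-trans (proj₁ (+q-comm _ _)) (proj₁ (sub-+ r (2⁻ᵗ j)))

≤-close : Φ ⊩ Real′ x → Φ ⊩ Real′ y → Φ ⊩ x ≤ᵣ y → ∀ j → Φ ⊩ lt x y (2⁻ᵗ j)
≤-close rx ry h j = lt-total ry rx (assume λ e → w h ▹ lt⇒< e) j (proj₂ (0+ _))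

-- Opening the strict bound gains some 2⁻ʲ, and a weak inequality holds up to any such error.
≤-lt : Φ ⊩ Real′ x → Φ ⊩ Real′ y → Φ ⊩ x ≤ᵣ y → Φ ⊩ lt y z r → Φ ⊩ lt x z r
≤-lt {r = r} rx ry h g = lt-open g λ j e → lt-trans (w (≤-close rx ry h j)) e (half-split r j)

lt-≤ : Φ ⊩ Real′ y → Φ ⊩ Real′ z → Φ ⊩ lt x y r → Φ ⊩ y ≤ᵣ z → Φ ⊩ lt x z r
lt-≤ {r = r} ry rz g h = lt-open g λ j e → lt-trans e (w (≤-close ry rz h j)) (proj₁ (sub-+ r (2⁻ᵗ j)))

<-≤ᵣ : Φ ⊩ lt x y 0q → Φ ⊩ Real′ x → Φ ⊩ Real′ y → Φ ⊩ x ≤ᵣ y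
<-≤ᵣ h rx ry = assume λ g → lt-irrefl (lt-trans (w h) (<⇒lt (w ry) (w rx) g) (proj₁ (0+ _))) ≤q-refl

≐-sym : Φ ⊩ x ≐ᵣ y → Φ ⊩ y ≐ᵣ x
≐-sym h = ≮≯⇒≐ (≐⇒≯ h) (≐⇒≮ h)

≐-≤ : Φ ⊩ x ≐ᵣ y → Φ ⊩ x ≤ᵣ y
≐-≤ = ≐⇒≯

Eq⇒≐ : Φ ⊩ Eq′ 𝟏 x y → Φ ⊩ x ≐ᵣ y
Eq⇒≐ h = fold (gen λ n → dist-intro
  (≤q-trans (proj₁ (≈⇒≈q (h at n))) (pad _ n)) (≤q-trans (proj₂ (≈⇒≈q (h at n))) (pad _ n)))
  where
  pad : ∀ {Φ} q n → Φ ⊩ q ≤q q +q un dblᵘ n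
  pad q n = linear (0≤half n ⊕q 0≤half n ⊕q proj₂ (dbl-half n))
    (solveq 3 (λ q d u → q :⊕ u :⊕ u :⊕ d ⊜ (q :⊕ d) :⊕ :0 :⊕ :0 :⊕ u :⊕ u) ≈q-refl q (un dblᵘ n) (2⁻ᵗ n))

≐-trans : Φ ⊩ Real′ x → Φ ⊩ Real′ y → Φ ⊩ Real′ z → Φ ⊩ x ≐ᵣ y → Φ ⊩ y ≐ᵣ z → Φ ⊩ x ≐ᵣ z
≐-trans rx ry rz h g = ≮≯⇒≐
  (assume λ e → ≐⇒≮ (w g) ▹ lt⇒< (≤-lt (w ry) (w rx) (w (≐-≤ (≐-sym h))) (<⇒lt (w rx) (w rz) e)))
  (assume λ e → ≐⇒≯ (w g) ▹ lt⇒< (lt-≤ (w rx) (w ry) (<⇒lt (w rz) (w rx) e) (w (≐-≤ h))))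

near-sym : Φ ⊩ Real′ x → Φ ⊩ Real′ y → Φ ⊩ Nearᵣ x y k' → Φ ⊩ Nearᵣ y x k'
near-sym rx ry h = near-intro (π₂ (near-elim rx ry h)) (π₁ (near-elim rx ry h))

near-trans : Φ ⊩ Real′ x → Φ ⊩ Real′ y → Φ ⊩ Real′ z → Φ ⊩ Nearᵣ x y (su k') → Φ ⊩ Nearᵣ y z (su k') → Φ ⊩ Nearᵣ x z k'
near-trans rx ry rz h g = near-intro
  (lt-trans (π₁ (near-elim rx ry h)) (π₁ (near-elim ry rz g)) (half+half _))
  (lt-trans (π₂ (near-elim ry rz g)) (π₂ (near-elim rx ry h)) (half+half _))

near-mono : Φ ⊩ Real′ x → Φ ⊩ Real′ y → Φ ⊩ n ≤ₙ m → Φ ⊩ Nearᵣ x y m → Φ ⊩ Nearᵣ x y n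
near-mono rx ry p h = near-intro (lt-weak (π₁ (near-elim rx ry h)) (half-anti p)) (lt-weak (π₂ (near-elim rx ry h)) (half-anti p))

≐-near : Φ ⊩ Real′ x → Φ ⊩ Real′ y → Φ ⊩ x ≐ᵣ y → ∀ k → Φ ⊩ Nearᵣ x y k
≐-near rx ry h k = near-intro (≤-close rx ry (≐-≤ h) k) (≤-close ry rx (≐-≤ (≐-sym h)) k)

near-resp : Φ ⊩ Real′ x → Φ ⊩ Real′ x' → Φ ⊩ Real′ y → Φ ⊩ x ≐ᵣ x' → Φ ⊩ Nearᵣ x y k' → Φ ⊩ Nearᵣ x' y k'
near-resp rx rx' ry e h = near-intro (≤-lt rx' rx (≐-≤ (≐-sym e)) (π₁ (near-elim rx ry h)))
  (lt-≤ rx rx' (π₂ (near-elim rx ry h)) (≐-≤ e))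

near-respʳ : Φ ⊩ Real′ x → Φ ⊩ Real′ y → Φ ⊩ Real′ y' → Φ ⊩ y ≐ᵣ y' → Φ ⊩ Nearᵣ x y k' → Φ ⊩ Nearᵣ x y' k'
near-respʳ rx ry ry' e h = near-sym ry' rx (near-resp ry ry' rx e (near-sym rx ry h))

real-resp : Φ ⊩ Eq′ 𝟏 x y → Φ ⊩ Real′ x → Φ ⊩ Real′ y
real-resp e = ext-replace (Real′ b₀) e

≤ᵣ-trans : Φ ⊩ Real′ x → Φ ⊩ Real′ y → Φ ⊩ Real′ z → Φ ⊩ x ≤ᵣ y → Φ ⊩ y ≤ᵣ z → Φ ⊩ x ≤ᵣ z
≤ᵣ-trans rx ry rz h g = assume λ e → w h ▹ lt⇒< (≤-lt (w ry) (w rz) (w g) (<⇒lt (w rz) (w rx) e))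

≤-rat : Φ ⊩ q ≤q r → Φ ⊩ ratᵣ q ≤ᵣ ratᵣ r
≤-rat {q = q} {r} h = assume λ e → lt-rat⁻ (<⇒lt (real-rat r) (real-rat q) e) (≤q-trans (proj₁ (+q-zero _)) (w h))

-- The pointwise estimate is asked for in every context deriving `φ`, because it is applied under
-- assumptions that this proof introduces.
rat-≤ᵣ : (∀ {Ψ} n → Ψ ⊩ φ → Ψ ⊩ q ≤q x ∙ n) → Φ ⊩ φ → Φ ⊩ ratᵣ q ≤ᵣ x
rat-≤ᵣ {q = q} {x} h p = assume λ e → pick e λ n g → lt⇒≰ g ▹ linear
  (h n (w² p) ⊕q proj₁ (≈⇒≈q (rat-at q n)) ⊕q proj₁ (sub-+ (ratᵣ q ∙ n) (x ∙ n)) ⊕q 0≤half n ⊕q 0≤half n ⊕q proj₂ (dbl-half n))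
  (solveq 6 (λ q q' x d e u → d :⊕ x :⊕ q :⊕ q' :⊕ u :⊕ u :⊕ e ⊜ e :⊕ q :⊕ q' :⊕ (d :⊕ x) :⊕ :0 :⊕ :0 :⊕ u :⊕ u) ≈q-refl
    q (ratᵣ q ∙ n) (x ∙ n) (ratᵣ q ∙ n -q x ∙ n) (un dblᵘ n) (2⁻ᵗ n))

≤ᵣ-rat : (∀ {Ψ} n → Ψ ⊩ φ → Ψ ⊩ x ∙ n ≤q q) → Φ ⊩ φ → Φ ⊩ x ≤ᵣ ratᵣ q
≤ᵣ-rat {x = x} {q} h p = assume λ e → pick e λ n g → lt⇒≰ g ▹ linear
  (h n (w² p) ⊕q proj₂ (≈⇒≈q (rat-at q n)) ⊕q proj₁ (sub-+ (x ∙ n) (ratᵣ q ∙ n)) ⊕q 0≤half n ⊕q 0≤half n ⊕q proj₂ (dbl-half n))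
  (solveq 6 (λ q q' x d e u → d :⊕ q :⊕ q' :⊕ x :⊕ u :⊕ u :⊕ e ⊜ e :⊕ x :⊕ q :⊕ (d :⊕ q') :⊕ :0 :⊕ :0 :⊕ u :⊕ u) ≈q-refl
    q (ratᵣ q ∙ n) (x ∙ n) (x ∙ n -q ratᵣ q ∙ n) (un dblᵘ n) (2⁻ᵗ n))

-- The unit interval

0ᵣ 1ᵣ : Te [] 𝟏
0ᵣ = ratᵣ 0q
1ᵣ = ratᵣ (rat′ 𝟏′ 𝟎 𝟎)

InP : Fo (𝟏 ∷ [])
InP = Real′ b₀ ∧′ (clo 0ᵣ ≤ᵣ b₀ ∧′ b₀ ≤ᵣ clo 1ᵣ)

I : ∀ {Δ} → Te Δ 𝟏 → Fo Δ
I x = atom InP (x ∷ᵃ ∅ᵃ)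

I-real : Φ ⊩ I x → Φ ⊩ Real′ x
I-real h = π₁ (unfold h)

I-≥0 : Φ ⊩ I x → Φ ⊩ 0ᵣ ≤ᵣ x
I-≥0 h = π₁ (π₂ (unfold h))

I-≤1 : Φ ⊩ I x → Φ ⊩ x ≤ᵣ 1ᵣ
I-≤1 h = π₂ (π₂ (unfold h))

I-intro : Φ ⊩ Real′ x → Φ ⊩ 0ᵣ ≤ᵣ x → Φ ⊩ x ≤ᵣ 1ᵣ → Φ ⊩ I x
I-intro a b c = fold (a & b & c)

I-between : Φ ⊩ Real′ x → Φ ⊩ I y → Φ ⊩ I z → Φ ⊩ y ≤ᵣ x → Φ ⊩ x ≤ᵣ z → Φ ⊩ I x
I-between rx iy iz p q = I-intro rx (≤ᵣ-trans (real-rat _) (I-real iy) rx (I-≥0 iy) p)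
  (≤ᵣ-trans rx (I-real iz) (real-rat _) q (I-≤1 iz))

-- The two sides of a point

data Side : Set where
  L R′ : Side

SideP : Side → Fo (𝟏 ∷ 𝟏 ∷ [])
SideP L  = b₀ <ᵣ b₁
SideP R′ = b₁ <ᵣ b₀

side : ∀ {Δ} → Side → Te Δ 𝟏 → Te Δ 𝟏 → Fo Δ
side κ z x = atom (SideP κ) (z ∷ᵃ x ∷ᵃ ∅ᵃ)

side-≢ : ∀ κ → Φ ⊩ side κ z x → Φ ⊩ z ≐ᵣ x → Φ ⊩ ⊥′
side-≢ L  h e = ≐⇒≮ e ▹ unfold h
side-≢ R′ h e = ≐⇒≯ e ▹ unfold h

-- Trichotomy, with the two strict cases as one function of the side, so that arguments for left and
-- right limits are written once.
by-side : (z x : Te [] 𝟏) →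
          (∀ κ → side κ z x ∷ Φ ⊩ side κ z x → side κ z x ∷ Φ ⊩ φ) → (z ≐ᵣ x ∷ Φ ⊩ z ≐ᵣ x → z ≐ᵣ x ∷ Φ ⊩ φ) → Φ ⊩ φ
by-side z x f g = em (z <ᵣ x) (λ h → cut (fold h) (w′ (assume (f L))))
  λ h → em (x <ᵣ z) (λ h' → cut (fold h') (w″ (assume (f R′)))) λ h' → w² (assume g) ▹ ≮≯⇒≐ (w h) h'
  where
  w′ : ∀ {Φ α β} → Φ ⊩ α ⇒′ φ → α ∷ β ∷ Φ ⊩ φ
  w′ d = w² d ▹ h₀
  w″ : ∀ {Φ α β γ} → Φ ⊩ α ⇒′ φ → α ∷ β ∷ γ ∷ Φ ⊩ φ
  w″ d = w³ d ▹ h₀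

half-quarter : ∀ k → Φ ⊩ (2⁻ᵗ (su (su k)) +q 2⁻ᵗ (su (su k))) +q (2⁻ᵗ (su (su k)) +q 2⁻ᵗ (su (su k))) ≤q 2⁻ᵗ k
half-quarter k = ≤q-trans (+q-mono (half+half (su k)) (half+half (su k))) (half+half k)

-- The approximation `a` of `x` with error `v` is moved by twice `v` towards `z`. It is then
-- strictly on the side of `z`, and its distance from `x` is below four times `v`, that is at most
-- 2⁻⁽ᴺ⁺ʲ⁾, where 2⁻ʲ separates `z` from `x`. So it is near `x`, and it stays in the interval
-- because it does not pass `z`.
side-dense : ∀ κ → Φ ⊩ I z → Φ ⊩ I x → Φ ⊩ side κ z x → ∀ N →
             (∀ q → I (ratᵣ q) ∧′ (side κ (ratᵣ q) x ∧′ Nearᵣ (ratᵣ q) x N) ∷ Φ ⊩ φ) → Φ ⊩ φ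
side-dense {Φ} {z} {x} {φ} L iz ix h N k =
  lt-open (<⇒lt (I-real iz) (I-real ix) (unfold h)) λ j e →
    let n = su (su (N ⊹ j))
        v = 2⁻ᵗ n
        a = x ∙ su n
        q = a -q (v +q v)
        rx = w (I-real ix)
        qa : _ ⊩ lt (ratᵣ q) (ratᵣ a) (0q -q v)
        qa = lt-rat (assume λ g → half≰0 n (linear (g ⊕q proj₁ (sub-+ a (v +q v)) ⊕q proj₂ (sub-+ 0q v))
               (solveq 4 (λ v a q m → v :⊕ q :⊕ a :⊕ m :⊕ v ⊜ :0 :⊕ (a :⊕ m) :⊕ (q :⊕ (v :⊕ v)) :⊕ :0) ≈q-refl v a q (0q -q v))))
        aq : _ ⊩ lt (ratᵣ a) (ratᵣ q) ((v +q v) +q v)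
        aq = lt-rat (assume λ g → half≰0 n (linear (g ⊕q proj₂ (sub-+ a (v +q v)))
               (solveq 3 (λ v a q → v :⊕ a :⊕ q :⊕ v :⊕ v ⊜ :0 :⊕ (q :⊕ ((v :⊕ v) :⊕ v)) :⊕ a) ≈q-refl v a q)))
        qx : _ ⊩ lt (ratᵣ q) x 0q
        qx = lt-trans qa (approx-> rx n) (proj₁ (sub-+ 0q v))
        xq : _ ⊩ lt x (ratᵣ q) (2⁻ᵗ (N ⊹ j))
        xq = lt-trans (approx-< rx n) aq (linear (half-quarter (N ⊹ j))
               (solveq 2 (λ v u → (v :⊕ (v :⊕ v) :⊕ v) :⊕ u ⊜ u :⊕ (v :⊕ v) :⊕ (v :⊕ v)) ≈q-refl v (2⁻ᵗ (N ⊹ j))))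
        zq : _ ⊩ lt z (ratᵣ q) 0q
        zq = lt-trans e xq (≤q-trans (+q-mono ≤q-refl (≤q-trans (proj₁ (≈⇒≈q (un-cong halfᵘ (+-comm N j)))) (half-mono j N))) (proj₁ (sub-+ 0q (2⁻ᵗ j))))
    in w (assume′ (k q)) ▹ (I-between (real-rat q) (w iz) (w ix) (<-≤ᵣ zq (w (I-real iz)) (real-rat q)) (<-≤ᵣ qx (real-rat q) rx)
         & fold (lt⇒< qx)
         & near-intro (lt-weak qx (0≤half N)) (lt-weak xq (half-mono N j)))
  where
  assume′ : ∀ {Φ α} → α ∷ Φ ⊩ φ → Φ ⊩ α ⇒′ φ
  assume′ d = assume λ _ → d
side-dense {Φ} {z} {x} {φ} R′ iz ix h N k =
  lt-open (<⇒lt (I-real ix) (I-real iz) (unfold h)) λ j e →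
    let n = su (su (N ⊹ j))
        v = 2⁻ᵗ n
        a = x ∙ su n
        q = a +q (v +q v)
        rx = w (I-real ix)
        aq : _ ⊩ lt (ratᵣ a) (ratᵣ q) (0q -q v)
        aq = lt-rat (assume λ g → half≰0 n (linear (g ⊕q proj₂ (sub-+ 0q v))
               (solveq 3 (λ v a m → v :⊕ a :⊕ m :⊕ v ⊜ :0 :⊕ ((a :⊕ (v :⊕ v)) :⊕ m) :⊕ :0) ≈q-refl v a (0q -q v))))
        qa : _ ⊩ lt (ratᵣ q) (ratᵣ a) ((v +q v) +q v)
        qa = lt-rat (assume λ g → half≰0 n (linear g
               (solveq 2 (λ v a → v :⊕ (a :⊕ (v :⊕ v)) ⊜ :0 :⊕ (a :⊕ ((v :⊕ v) :⊕ v))) ≈q-refl v a)))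
        xq : _ ⊩ lt x (ratᵣ q) 0q
        xq = lt-trans (approx-< rx n) aq (≤q-trans (proj₁ (+q-comm _ _)) (proj₁ (sub-+ 0q v)))
        qx : _ ⊩ lt (ratᵣ q) x (2⁻ᵗ (N ⊹ j))
        qx = lt-trans qa (approx-> rx n) (linear (half-quarter (N ⊹ j))
               (solveq 2 (λ v u → (((v :⊕ v) :⊕ v) :⊕ v) :⊕ u ⊜ u :⊕ (v :⊕ v) :⊕ (v :⊕ v)) ≈q-refl v (2⁻ᵗ (N ⊹ j))))
        qz : _ ⊩ lt (ratᵣ q) z 0q
        qz = lt-trans qx e (≤q-trans (+q-mono (≤q-trans (proj₁ (≈⇒≈q (un-cong halfᵘ (+-comm N j)))) (half-mono j N)) ≤q-refl) (half-split 0q j))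
    in w (assume′ (k q)) ▹ (I-between (real-rat q) (w ix) (w iz) (<-≤ᵣ xq rx (real-rat q)) (<-≤ᵣ qz (real-rat q) (w (I-real iz)))
         & fold (lt⇒< xq)
         & near-intro (lt-weak qx (half-mono N j)) (lt-weak xq (0≤half N)))
  where
  assume′ : ∀ {Φ α} → α ∷ Φ ⊩ φ → Φ ⊩ α ⇒′ φ
  assume′ d = assume λ _ → d

-- Lying on a side of `x` and within a given distance of it are strict inequalities, three in all.
-- Opening each leaves room to move `z` by 2⁻ᴺ, where `N` is the sum of the exponents gained.
side-open : ∀ κ → Φ ⊩ Real′ z → Φ ⊩ Real′ x → Φ ⊩ side κ z x → Φ ⊩ Nearᵣ z x k' →
            Φ ⊩ ∃′ ι (∀′ 𝟏 (Real′ b₀ ∧′ Nearᵣ b₀ (clo z) b₁ ⇒′ side κ b₀ (clo x) ∧′ Nearᵣ b₀ (clo x) (clo k')))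
side-open {z = z} {x} {k'} κ rz rx h g = lt-open (π₁ (near-elim rz rx g)) λ j₁ e₁ → lt-open (w (π₂ (near-elim rz rx g))) λ j₂ e₂ →
  out κ (w² rz) (w² rx) (w² h) λ j₀ e₀ →
    let N = j₀ ⊹ (j₁ ⊹ j₂)
        n₀ : ∀ {Ψ} → Ψ ⊩ 2⁻ᵗ N ≤q 2⁻ᵗ j₀
        n₀ = half-anti s≤s+t
        n₁ : ∀ {Ψ} → Ψ ⊩ 2⁻ᵗ N ≤q 2⁻ᵗ j₁
        n₁ = half-anti (≤-trans′ s≤s+t t≤s+t)
        n₂ : ∀ {Ψ} → Ψ ⊩ 2⁻ᵗ N ≤q 2⁻ᵗ j₂
        n₂ = half-anti (≤-trans′ t≤s+t t≤s+t)
    in witness N (gen λ p → assume λ hp →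
      let pz = near-elim (π₁ hp) (w⁴ rz) (π₂ hp)
      in back κ (π₁ hp) (w⁴ rz) (w⁴ rx) n₀ (w e₀) (π₁ pz) (π₂ pz) &
         near-intro (lt-trans (π₁ pz) (w³ e₁) (≤q-trans (+q-mono n₁ ≤q-refl) (half-split _ j₁)))
                    (lt-trans (w² e₂) (π₂ pz) (≤q-trans (+q-mono ≤q-refl n₂) (proj₁ (sub-+ _ _)))))
  where
  gap : Side → Te [] 𝟏 → Te [] 𝟏 → Te [] ι → Fo []
  gap L  z x j = lt z x (0q -q 2⁻ᵗ j)
  gap R′ z x j = lt x z (0q -q 2⁻ᵗ j)
  out : ∀ {Φ ψ} κ → Φ ⊩ Real′ z → Φ ⊩ Real′ x → Φ ⊩ side κ z x → (∀ j → gap κ z x j ∷ Φ ⊩ gap κ z x j → gap κ z x j ∷ Φ ⊩ ψ) → Φ ⊩ ψ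
  out L  rz rx h k = lt-open (<⇒lt rz rx (unfold h)) k
  out R′ rz rx h k = lt-open (<⇒lt rx rz (unfold h)) k
  back : ∀ {Φ p n j} κ → Φ ⊩ Real′ p → Φ ⊩ Real′ z → Φ ⊩ Real′ x → Φ ⊩ 2⁻ᵗ n ≤q 2⁻ᵗ j → Φ ⊩ gap κ z x j →
         Φ ⊩ lt p z (2⁻ᵗ n) → Φ ⊩ lt z p (2⁻ᵗ n) → Φ ⊩ side κ p x
  back L  rp rz rx e g a b = fold (lt⇒< (lt-trans a g (≤q-trans (+q-mono e ≤q-refl) (half-split _ _))))
  back R′ rp rz rx e g a b = fold (lt⇒< (lt-trans g b (≤q-trans (+q-mono ≤q-refl e) (proj₁ (sub-+ _ _)))))

apart : Φ ⊩ Real′ z → Φ ⊩ Real′ x → Φ ⊩ ¬′ (z ≐ᵣ x) → Φ ⊩ ∃′ ι (¬′ Nearᵣ (clo z) (clo x) b₀)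
apart {z = z} {x} rz rx h = by-side z x
  (λ { L g → lt-open (<⇒lt (w rz) (w rx) (unfold g)) λ j e → witness j (assume λ k →
          lt-irrefl (lt-trans (w e) (π₂ (near-elim (w³ rz) (w³ rx) k)) ≤q-refl) (proj₁ (sub-+ 0q _)))
     ; R′ g → lt-open (<⇒lt (w rx) (w rz) (unfold g)) λ j e → witness j (assume λ k →
          lt-irrefl (lt-trans (w e) (π₁ (near-elim (w³ rz) (w³ rx) k)) ≤q-refl) (proj₁ (sub-+ 0q _))) })
  λ e → absurd (w h ▹ e)

private variable
  f : Te [] (𝟏 ⇒ 𝟏)
  H : Te [] 𝟐

-- The notions of the theorem

FunP RegP : Fo (𝟏 ⇒ 𝟏 ∷ [])
FunP = ∀′ 𝟏 (I b₀ ⇒′ Real′ (b₁ ∙ b₀)) ∧′ ∀′ 𝟏 (∀′ 𝟏 (I b₁ ∧′ (I b₀ ∧′ b₁ ≐ᵣ b₀) ⇒′ b₂ ∙ b₁ ≐ᵣ b₂ ∙ b₀))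

LimP : Side → Fo (𝟏 ⇒ 𝟏 ∷ 𝟏 ∷ 𝟏 ∷ [])
LimP κ = ∀′ ι (∃′ ι (∀′ 𝟏 (I b₀ ∧′ (side κ b₀ b₄ ∧′ Nearᵣ b₀ b₄ b₁) ⇒′ Nearᵣ (b₃ ∙ b₀) b₅ b₂)))

Lim : ∀ {Δ} → Side → Te Δ (𝟏 ⇒ 𝟏) → Te Δ 𝟏 → Te Δ 𝟏 → Fo Δ
Lim κ f x y = atom (LimP κ) (f ∷ᵃ x ∷ᵃ y ∷ᵃ ∅ᵃ)

RegP = ∀′ 𝟏 (I b₀ ⇒′ (∃′ 𝟏 (Real′ b₀ ∧′ Lim L b₂ b₁ b₀)) ∧′ (∃′ 𝟏 (Real′ b₀ ∧′ Lim R′ b₂ b₁ b₀)))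

ContP : Fo (𝟏 ⇒ 𝟏 ∷ 𝟏 ∷ [])
ContP = ∀′ ι (∃′ ι (∀′ 𝟏 (I b₀ ∧′ Nearᵣ b₀ b₄ b₁ ⇒′ Nearᵣ (b₃ ∙ b₀) (b₃ ∙ b₄) b₂)))

ExtP : Fo (𝟐 ∷ [])
ExtP = ∀′ 𝟏 (∀′ 𝟏 (Real′ b₁ ∧′ (Real′ b₀ ∧′ b₁ ≐ᵣ b₀) ⇒′ b₂ ∙ b₁ ≈ b₂ ∙ b₀))

RealsP DistinctP : Fo (ι ⇒ 𝟏 ∷ ι ∷ [])
RealsP = ∀′ ι (b₀ ≤ₙ b₂ ⇒′ Real′ (b₁ ∙ b₀))
DistinctP = ∀′ ι (∀′ ι (su b₁ ≤ₙ b₀ ∧′ b₀ ≤ₙ b₃ ⇒′ ¬′ b₂ ∙ b₁ ≐ᵣ b₂ ∙ b₀))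

Reals Distinct : ∀ {Δ} → Te Δ (ι ⇒ 𝟏) → Te Δ ι → Fo Δ
Reals s n = atom RealsP (s ∷ᵃ n ∷ᵃ ∅ᵃ)
Distinct s n = atom DistinctP (s ∷ᵃ n ∷ᵃ ∅ᵃ)

FinP : Fo (ι ∷ 𝟐 ∷ [])
FinP = ∃′ ι (∀′ (ι ⇒ 𝟏) (Reals b₀ b₁ ∧′ Distinct b₀ b₁ ⇒′
         ∃′ ι (b₀ ≤ₙ b₂ ∧′ ¬′ (I (b₁ ∙ b₀) ∧′ su (b₄ ∙ (b₁ ∙ b₀)) ≤ₙ b₃))))

Fin′ : ∀ {Δ} → Te Δ ι → Te Δ 𝟐 → Fo Δ
Fin′ n H = atom FinP (n ∷ᵃ H ∷ᵃ ∅ᵃ)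

Fun Reg : ∀ {Δ} → Te Δ (𝟏 ⇒ 𝟏) → Fo Δ
Fun f = atom FunP (f ∷ᵃ ∅ᵃ)
Reg f = atom RegP (f ∷ᵃ ∅ᵃ)

Cont : ∀ {Δ} → Te Δ (𝟏 ⇒ 𝟏) → Te Δ 𝟏 → Fo Δ
Cont f x = atom ContP (f ∷ᵃ x ∷ᵃ ∅ᵃ)

Ext : ∀ {Δ} → Te Δ 𝟐 → Fo Δ
Ext H = atom ExtP (H ∷ᵃ ∅ᵃ)

HeightP NotDiscP : Fo []
HeightP = ∃′ 𝟐 (Ext b₀ ∧′ ∀′ ι (Fin′ b₀ b₁))
NotDiscP = ∀′ (𝟏 ⇒ 𝟏) (Fun b₀ ∧′ Reg b₀ ⇒′ ∃′ 𝟏 (I b₀ ∧′ Cont b₁ b₀))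

-- Points with small height do not accumulate

SeqP : Fo (𝟏 ∷ ι ∷ ι ∷ 𝟏 ∷ ι ∷ 𝟐 ∷ [])
SeqP = I b₀ ∧′ (¬′ Nearᵣ b₀ b₃ b₁ ∧′ (Nearᵣ b₀ b₃ b₂ ∧′ su (b₅ ∙ b₀) ≤ₙ b₄))

Seq : ∀ {Δ} → Te Δ 𝟏 → Te Δ ι → Te Δ ι → Te Δ 𝟏 → Te Δ ι → Te Δ 𝟐 → Fo Δ
Seq z m N x k H = atom SeqP (z ∷ᵃ m ∷ᵃ N ∷ᵃ x ∷ᵃ k ∷ᵃ H ∷ᵃ ∅ᵃ)

-- A punctured neighbourhood of the point, within the unit interval, that is free of points of
-- height below the given number.
GapP : Fo (𝟏 ∷ ι ∷ 𝟐 ∷ [])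
GapP = ∃′ ι (∀′ 𝟏 (I b₀ ∧′ (¬′ b₀ ≐ᵣ b₂ ∧′ Nearᵣ b₀ b₂ b₁) ⇒′ ¬′ su (b₄ ∙ b₀) ≤ₙ b₃))

Gap : ∀ {Δ} → Te Δ 𝟏 → Te Δ ι → Te Δ 𝟐 → Fo Δ
Gap x k H = atom GapP (x ∷ᵃ k ∷ᵃ H ∷ᵃ ∅ᵃ)

-- For each `N` both a point and an exponent bounding its distance from `x` below are to be chosen.
-- They are packed into one function: the exponent is the value at 0, and the remaining values are
-- the point. Having the exponent at hand makes the passage to a subsequence a primitive recursion.
choose-near : Φ ⊩ Real′ x → Φ ⊩ ¬′ Gap x k' H →
              Φ ⊩ ∃′ (ι ⇒ 𝟏) (∀′ ι (Seq (lam (b₂ ∙ b₁ ∙ su b₀)) (b₁ ∙ b₀ ∙ 𝟎) b₀ (clo x) (clo k') (clo H)))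
choose-near {x = x} {k'} {H} rx ng = ac₀₁ (Seq (lam (b₁ ∙ su b₀)) (b₀ ∙ 𝟎) b₁ (clo x) (clo k') (clo H))
  (gen λ N → byContra λ nex → w ng ▹ exhibit N (gen λ z → assume λ p → assume λ small → obtain (apart (I-real (π₁ (w p))) (w³ rx) (π₁ (π₂ (w p)))) λ m far →
    w³ nex ▹
      (let g = lam (rec′ ∙ b₀ ∙ clo m ∙ lam (lam (clo z ∙ b₀)))
           g0 = ≈trans (beta (rec′ ∙ b₀ ∙ clo m ∙ lam (lam (clo z ∙ b₀))) 𝟎) rec-zero
           gs : ∀ {Ψ} → Ψ ⊩ Eq′ 𝟏 z (lam (clo g ∙ su b₀))
           gs = gen λ n → ≈sym (≈trans (beta (clo g ∙ su b₀) n) (≈trans (beta (rec′ ∙ b₀ ∙ clo m ∙ lam (lam (clo z ∙ b₀))) (su n)) (rec-step (clo z ∙ b₀))))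
           p' = w² p
       in witness g (replace (Seq (clo (lam (clo g ∙ su b₀))) b₀ (clo N) (clo x) (clo k') (clo H)) (≈sym g0)
            (ext-replace (Seq b₀ (clo m) (clo N) (clo x) (clo k') (clo H)) gs
              (fold (π₁ p' & far & π₂ (π₂ p') & w small)))))))

-- From witnesses z_N ≠ x at distance less than 2⁻ᴺ, but not less than 2⁻ᵐ with
-- m = m_N, the subsequence along c₀ = 0, c_{i+1} = m_{c_i} has distinct members.

module _ (G : Te [] (ι ⇒ 𝟏)) where
  private
    at-c : ∀ {Δ} → Te Δ ι → Te Δ ι
    at-c i = rec′ ∙ i ∙ 𝟎 ∙ lam (lam (clo G ∙ b₁ ∙ 𝟎))
    sq : Te [] (ι ⇒ 𝟏)
    sq = lam (lam (clo G ∙ at-c b₁ ∙ su b₀))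

    chosen : Te [] 𝟏 → Te [] ι → Te [] 𝟐 → Fo []
    chosen x k H = ∀′ ι (Seq (lam (clo G ∙ b₁ ∙ su b₀)) (clo G ∙ b₀ ∙ 𝟎) b₀ (clo x) (clo k) (clo H))

    c-suc : ∀ i → Φ ⊩ at-c (su i) ≈ G ∙ at-c i ∙ 𝟎
    c-suc i = rec-step (clo G ∙ b₁ ∙ 𝟎)

    sq-seq : Φ ⊩ chosen x k' H → ∀ i → Φ ⊩ Seq (sq ∙ i) (G ∙ at-c i ∙ 𝟎) (at-c i) x k' H
    sq-seq {Φ} {x} {k'} {H} h i = ext-replace (Seq b₀ (clo (G ∙ at-c i ∙ 𝟎)) (clo (at-c i)) (clo x) (clo k') (clo H)) e (h at at-c i)
      where
      e : Φ ⊩ Eq′ 𝟏 (lam (clo G ∙ clo (at-c i) ∙ su b₀)) (sq ∙ i)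
      e = gen λ n → ≈trans (beta (clo G ∙ clo (at-c i) ∙ su b₀) n)
            (≈sym (≈trans (beta (lam (clo G ∙ at-c b₁ ∙ su b₀)) i at n) (beta (clo G ∙ at-c (clo i) ∙ su b₀) n)))

    -- If the recorded exponent were smaller than `at-c i`, nearness at the scale `at-c i` would
    -- imply nearness at the recorded scale, which is excluded.
    c-mono : Φ ⊩ Real′ x → Φ ⊩ chosen x k' H → ∀ i → Φ ⊩ at-c i ≤ₙ at-c (su i)
    c-mono {x = x} {k'} {H} rx h i = cases (≤-or-> (at-c i) (G ∙ at-c i ∙ 𝟎))
      (λ p → ≤-trans′ p (≈⇒≤ (≈sym (c-suc i))))
      λ p → let q = unfold (w (sq-seq {x = x} {k'} {H} h i)) in
        absurd (π₁ (π₂ q) ▹ near-mono (I-real (π₁ q)) (w rx) (≤-trans′ n≤suc p) (π₁ (π₂ (π₂ q))))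

    c-mono* : Φ ⊩ Real′ x → Φ ⊩ chosen x k' H → ∀ i d → Φ ⊩ at-c i ≤ₙ at-c (i ⊹ d)
    c-mono* {x = x} {k'} {H} rx h i = indQF (clo (at-c i) ≤ₙ at-c (clo i ⊹ b₀)) (≈⇒≤ (ctx (at-c b₀) (≈sym +-zero)))
      λ d p → ≤-trans′ p (≤-cong rfl (ctx (at-c b₀) (≈sym +-suc)) (c-mono {x = x} {k'} {H} (w rx) (w h) (i ⊹ d)))

  contradiction-at : Φ ⊩ I x → Φ ⊩ Fin′ k' H → Φ ⊩ chosen x k' H → Φ ⊩ ⊥′
  contradiction-at {Φ} {x} {k'} {H} ix fin h = pick fin λ N hs → obtain (hs at sq ▹ (
      fold (gen λ i → assume λ _ → I-real (π₁ (unfold (sq-seq {x = x} {k'} {H} (w² h) i)))) &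
      fold (gen λ i → gen λ j → assume λ ij → assume λ e →
        let qi = unfold (sq-seq {x = x} {k'} {H} (w³ h) i)
            qj = unfold (sq-seq {x = x} {k'} {H} (w³ h) j)
            rx = I-real (w³ ix)
            i<j = w (π₁ ij)
            -- The left side is the exponent recorded for the member `i`, which is the next index of
            -- the subsequence. The member `j` is thus nearer to `x` than the member `i` can be.
            le : _ ⊩ G ∙ at-c i ∙ 𝟎 ≤ₙ at-c j
            le = ≤-trans′ (≈⇒≤ (≈sym (c-suc i))) (≤-cong rfl (ctx (at-c b₀) (≤-elim i<j))
                   (c-mono* {x = x} {k'} {H} rx (w³ h) (su i) (j ∸′ su i)))
        in π₁ (π₂ qi) ▹ near-resp (I-real (π₁ qj)) (I-real (π₁ qi)) rx (≐-sym e)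
             (near-mono (I-real (π₁ qj)) rx le (π₁ (π₂ (π₂ qj)))))))
    λ i p → let qi = unfold (sq-seq {x = x} {k'} {H} (w² h) i) in π₂ p ▹ (π₁ qi & π₂ (π₂ (π₂ qi)))

gap : Φ ⊩ I x → Φ ⊩ Fin′ k' H → Φ ⊩ Gap x k' H
gap {x = x} {k'} {H} ix fin = byContra λ ng → obtain (choose-near (w (I-real ix)) ng) λ G hG →
  contradiction-at G {x = x} {k'} {H} (w² ix) (w² fin) hG

-- The function x ↦ 2⁻ᴴ⁽ˣ⁾

heightF : Te [] 𝟐 → Te [] (𝟏 ⇒ 𝟏)
heightF H = lam (ratᵣ (2⁻ᵗ (clo H ∙ b₀)))

heightF-at : ∀ H x → Φ ⊩ Eq′ 𝟏 (ratᵣ (2⁻ᵗ (H ∙ x))) (heightF H ∙ x)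
heightF-at H x = gen λ n → ≈sym (beta (ratᵣ (2⁻ᵗ (clo H ∙ b₀))) x at n)

heightF-real : ∀ H x → Φ ⊩ Real′ (heightF H ∙ x)
heightF-real H x = real-resp (heightF-at H x) (real-rat _)

half-strict : ∀ k → Φ ⊩ 2⁻ᵗ k ≤q 2⁻ᵗ (su k) → Φ ⊩ ⊥′
half-strict k h = half≰0 (su k) (linear (h ⊕q half+half k)
  (solveq 2 (λ u v → v :⊕ v :⊕ u ⊜ :0 :⊕ u :⊕ v :⊕ v) ≈q-refl (2⁻ᵗ k) (2⁻ᵗ (su k))))

half<-mono : Φ ⊩ su k' ≤ₙ n → Φ ⊩ 2⁻ᵗ k' ≤q 2⁻ᵗ n → Φ ⊩ ⊥′
half<-mono p h = half-strict _ (≤q-trans h (half-anti p))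

heightF-fun : Φ ⊩ Ext H → Φ ⊩ Fun (heightF H)
heightF-fun {H = H} e = fold ((gen λ x → assume λ _ → heightF-real H x) &
  (gen λ x → gen λ y → assume λ p → Eq⇒≐ (gen λ n →
     ≈trans (≈sym (heightF-at H x at n)) (≈trans (rat-at _ n) (≈trans (un-cong halfᵘ
       (unfold (w e) at x at y ▹ (I-real (π₁ p) & I-real (π₁ (π₂ p)) & π₂ (π₂ p))))
       (≈trans (≈sym (rat-at _ n)) (heightF-at H y at n)))))))

heightF-small : ∀ H z → Φ ⊩ su k' ≤ₙ H ∙ z → Φ ⊩ Nearᵣ (heightF H ∙ z) 0ᵣ k'
heightF-small {k' = k} H z p = ext-replace (Nearᵣ b₀ (clo 0ᵣ) (clo k)) (heightF-at H z) (near-intro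
  (lt-rat (assume λ h → half<-mono (w p) (≤q-trans (proj₂ (0+ _)) h)))
  (lt-rat (assume λ h → half≰0 k (linear (h ⊕q 0≤half (H ∙ z))
    (solveq 2 (λ u v → u :⊕ :0 :⊕ v ⊜ :0 :⊕ (v :⊕ u) :⊕ :0) ≈q-refl (2⁻ᵗ k) (2⁻ᵗ (H ∙ z)))))))

heightF-lim : ∀ κ → Φ ⊩ I x → Φ ⊩ ∀′ ι (Fin′ b₀ (clo H)) → Φ ⊩ Lim κ (heightF H) x 0ᵣ
-- The bound `su k` rather than `k`: nearness is strict, so the heights have to exceed `k`.
heightF-lim {x = x} {H} κ ix fin = fold (gen λ k → pick (gap {H = H} ix (fin at su k)) λ N g →
  witness N (gen λ z → assume λ p → heightF-small H z (su-mono⁻ (≰⇒> (assume λ small →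
    (w² g at z ▹ (w (π₁ p) & (assume λ e → side-≢ κ (w² (π₁ (π₂ p))) e) & w (π₂ (π₂ p)))) ▹ small)))))

heightF-reg : Φ ⊩ ∀′ ι (Fin′ b₀ (clo H)) → Φ ⊩ Reg (heightF H)
heightF-reg {H = H} fin = fold (gen λ x → assume λ ix →
  witness 0ᵣ (real-rat _ & heightF-lim {H = H} L ix (w fin)) & witness 0ᵣ (real-rat _ & heightF-lim {H = H} R′ ix (w fin)))

0≤1 : Φ ⊩ 0q ≤q rat′ 𝟏′ 𝟎 𝟎
0≤1 = nonneg-intro 0q-val (rat-val rfl rfl) (≤-cong (≈sym (×-zeroˡ _)) rfl 0≤)

1≰0 : Φ ⊩ rat′ 𝟏′ 𝟎 𝟎 ≤q 0q → Φ ⊩ ⊥′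
1≰0 h = su≢0 (≈trans (≈sym (×-one 𝟏′)) (≤0⇒≈0 (≤-cong rfl (×-zeroˡ _) (nonneg-elim (rat-val rfl rfl) 0q-val h))))

0∈I : Φ ⊩ I 0ᵣ
0∈I = I-intro (real-rat _) (≤-rat ≤q-refl) (≤-rat 0≤1)

1∈I : Φ ⊩ I 1ᵣ
1∈I = I-intro (real-rat _) (≤-rat 0≤1) (≤-rat ≤q-refl)

-- An endpoint of the interval differs from `x`, and rational points approach `x` from the side of
-- that endpoint.
exists-near : Φ ⊩ I x → ∀ N → (∀ z → I z ∧′ (¬′ z ≐ᵣ x ∧′ Nearᵣ z x N) ∷ Φ ⊩ φ) → Φ ⊩ φ
exists-near {Φ} {x} {φ} ix N k = em (x <ᵣ 1ᵣ)
  (λ h → side-dense R′ 1∈I (w ix) (fold h) N λ q → finish R′ q)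
  (λ h → side-dense L 0∈I (w ix) (fold (lt⇒< (lt-≤ (real-rat _) (w (I-real ix))
      (lt-rat (assume λ e → 1≰0 (≤q-trans (proj₂ (+q-zero _)) e))) h))) N λ q → finish L q)
  where
  finish : ∀ {α} κ q → I (ratᵣ q) ∧′ (side κ (ratᵣ q) x ∧′ Nearᵣ (ratᵣ q) x N) ∷ α ∷ Φ ⊩ φ
  finish κ q = w² (assume λ _ → k (ratᵣ q)) ▹ (π₁ h₀ & (assume λ e → side-≢ κ (w (π₁ (π₂ h₀))) e) & π₂ (π₂ h₀))

-- Points close to `x` have height above `H ∙ x`, so the function takes there at most half of its
-- value at `x`. Half of that value is the tolerance at which continuity fails.
heightF-disc : Φ ⊩ I x → Φ ⊩ ∀′ ι (Fin′ b₀ (clo H)) → Φ ⊩ Cont (heightF H) x → Φ ⊩ ⊥′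
heightF-disc {x = x} {H} ix fin cont = pick (gap {H = H} ix (fin at su (H ∙ x))) λ N₁ g →
  obtain (unfold (w cont) at su (H ∙ x)) λ N₂ c → exists-near (w² ix) (N₁ ⊹ N₂) λ z →
    let p = h₀
        rz = I-real (π₁ p)
        rx = I-real (w³ ix)
        big = w² g at z ▹ (π₁ p & π₁ (π₂ p) & near-mono rz rx s≤s+t (π₂ (π₂ p)))
        close = w c at z ▹ (π₁ p & near-mono rz rx t≤s+t (π₂ (π₂ p)))
        k = su (H ∙ x)
        close' = ext-replace (Nearᵣ (clo (ratᵣ (2⁻ᵗ (H ∙ z)))) b₀ (clo k)) (gen λ n → ≈sym (heightF-at H x at n))
                   (ext-replace (Nearᵣ b₀ (clo (heightF H ∙ x)) (clo k)) (gen λ n → ≈sym (heightF-at H z at n)) close)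
    in lt-rat⁻ (π₂ (near-elim (real-rat _) (real-rat _) close'))
         (≤q-trans (+q-mono (half-anti (su-mono⁻ (≰⇒> big))) ≤q-refl) (half+half (H ∙ x)))

regulated⇒NIN : Φ ⊩ NotDiscP → Φ ⊩ ¬′ HeightP
regulated⇒NIN h = assume λ g → obtain g λ H e →
  obtain (w² h at heightF H ▹ (heightF-fun (π₁ e) & heightF-reg {H = H} (π₂ e))) λ x p →
    heightF-disc {H = H} (π₁ p) (π₂ (w e)) (π₂ p)

private variable
  K : Te [] ι
  h h' h'' : Te [] (ι ⇒ ι)

-- Counting the zeros of a function below a bound

CNT : Te [] ((ι ⇒ ι) ⇒ ι ⇒ ι)
CNT = lam (lam (rec′ ∙ b₀ ∙ 𝟎 ∙ lam (lam (b₁ ⊹ (𝟏′ ∸′ b₃ ∙ b₀)))))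

cnt-unfold : ∀ h K → Φ ⊩ CNT ∙ h ∙ K ≈ rec′ ∙ K ∙ 𝟎 ∙ lam (lam (b₁ ⊹ (𝟏′ ∸′ clo h ∙ b₀)))
cnt-unfold h K = ≈trans (beta (lam (rec′ ∙ b₀ ∙ 𝟎 ∙ lam (lam (b₁ ⊹ (𝟏′ ∸′ b₃ ∙ b₀))))) h at K)
  (beta (rec′ ∙ b₀ ∙ 𝟎 ∙ lam (lam (b₁ ⊹ (𝟏′ ∸′ clo h ∙ b₀)))) K)

cnt-zero : ∀ h → Φ ⊩ CNT ∙ h ∙ 𝟎 ≈ 𝟎
cnt-zero h = ≈trans (cnt-unfold h 𝟎) rec-zero

cnt-suc : ∀ h K → Φ ⊩ CNT ∙ h ∙ su K ≈ CNT ∙ h ∙ K ⊹ (𝟏′ ∸′ h ∙ K)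
cnt-suc h K = ≈trans (cnt-unfold h (su K)) (≈trans (rec-step (b₁ ⊹ (𝟏′ ∸′ clo h ∙ b₀))) (≈sym (cnt-unfold h K) ⊹c rfl))

cnt-suc-zero : Φ ⊩ h ∙ n ≈ 𝟎 → Φ ⊩ CNT ∙ h ∙ su n ≈ su (CNT ∙ h ∙ n)
cnt-suc-zero p = ≈trans (cnt-suc _ _) (≈trans (rfl ⊹c ≈trans (rfl ∸c p) ∸-zero) (≈trans +-suc (su-cong +-zero)))

cnt-suc-pos : Φ ⊩ h ∙ n ≈ su k' → Φ ⊩ CNT ∙ h ∙ su n ≈ CNT ∙ h ∙ n
cnt-suc-pos p = ≈trans (cnt-suc _ _) (≈trans (rfl ⊹c ≈trans (rfl ∸c p) (≈trans (su-∸ _ _) (0∸ _))) +-zero)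

-- The hypothesis reaches only up to `K`, so the induction is relativised to `n ≤ₙ K`; the next two
-- lemmas proceed in the same way.
cnt-all : Φ ⊩ ∀′ ι (su b₀ ≤ₙ clo K ⇒′ clo h ∙ b₀ ≈ 𝟎) → Φ ⊩ CNT ∙ h ∙ K ≈ K
cnt-all {Φ} {K} {h} p = go K ▹ ≤-refl′
  where
  go : ∀ n → Φ ⊩ n ≤ₙ K ⇒′ CNT ∙ h ∙ n ≈ n
  go = ind (b₀ ≤ₙ clo K ⇒′ clo CNT ∙ clo h ∙ b₀ ≈ b₀) (assume λ _ → cnt-zero h)
    λ n g → assume λ l → ≈trans (cnt-suc-zero (w² p at n ▹ l)) (su-cong (w g ▹ ≤-trans′ n≤suc l))

-- Subadditivity of the count, the finite pigeonhole principle behind the bisection.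
cnt-cover : Φ ⊩ ∀′ ι (su b₀ ≤ₙ clo K ⇒′ clo h ∙ b₀ ≈ 𝟎 ⇒′ (clo h' ∙ b₀ ≈ 𝟎 ∨′ clo h'' ∙ b₀ ≈ 𝟎)) →
            Φ ⊩ CNT ∙ h ∙ K ≤ₙ CNT ∙ h' ∙ K ⊹ CNT ∙ h'' ∙ K
cnt-cover {Φ} {K} {h} {h'} {h''} p = go K ▹ ≤-refl′
  where
  go : ∀ n → Φ ⊩ n ≤ₙ K ⇒′ CNT ∙ h ∙ n ≤ₙ CNT ∙ h' ∙ n ⊹ CNT ∙ h'' ∙ n
  go = ind (b₀ ≤ₙ clo K ⇒′ clo CNT ∙ clo h ∙ b₀ ≤ₙ clo CNT ∙ clo h' ∙ b₀ ⊹ clo CNT ∙ clo h'' ∙ b₀)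
    (assume λ _ → ≤-cong (≈sym (cnt-zero h)) rfl 0≤)
    λ n g → assume λ l →
      let ih = w g ▹ ≤-trans′ n≤suc l
          δ : (h : Te [] (ι ⇒ ι)) → Te [] ι
          δ h = 𝟏′ ∸′ h ∙ n
          one : ∀ {Ψ} h → Ψ ⊩ h ∙ n ≈ 𝟎 → Ψ ⊩ δ h ≈ 𝟏′
          one h z = ≈trans (rfl ∸c z) ∸-zero
          e : _ ⊩ δ h ≤ₙ δ h' ⊹ δ h''
          e = zero-or-pos (h ∙ n)
            (λ z → cases (w³ p at n ▹ w l ▹ z)
              (λ z' → ≤-trans′ (≈⇒≤ (≈trans (one h (w z)) (≈sym (one h' z')))) s≤s+t)
              (λ z' → ≤-trans′ (≈⇒≤ (≈trans (one h (w z)) (≈sym (one h'' z')))) t≤s+t))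
            (λ q → ≤-cong (≈sym (≈trans (rfl ∸c q) (≈trans (su-∸ _ _) (0∸ _)))) rfl 0≤)
      in ≤-cong (≈sym (cnt-suc h n)) (≈trans (+-exch _ _ _ _) (≈sym (cnt-suc h' n ⊹c cnt-suc h'' n))) (+-mono ih e)

TwoZerosP : Fo ((ι ⇒ ι) ∷ ι ∷ [])
TwoZerosP = ∃′ ι (∃′ ι (su b₁ ≤ₙ b₀ ∧′ (su b₀ ≤ₙ b₃ ∧′ (b₂ ∙ b₁ ≈ 𝟎 ∧′ b₂ ∙ b₀ ≈ 𝟎))))

-- As long as two zeros have not been met, either no zero has occurred and the count is 0, or one
-- has occurred and the count is 1. This invariant is arithmetical, so `ind` applies.
cnt-two : Φ ⊩ su 𝟏′ ≤ₙ CNT ∙ h ∙ K → Φ ⊩ atom TwoZerosP (h ∷ᵃ K ∷ᵃ ∅ᵃ)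
cnt-two {Φ} {h} {K} p = byContra λ nex → cases (go nex K ▹ ≤-refl′)
  (λ e → su≢0 (≤0⇒≈0 (≤-cong rfl (π₂ e) (w² p))))
  (λ e → su≰ (≤-cong rfl (π₂ e) (w² p)))
  where
  N : Fo []
  N = ¬′ atom TwoZerosP (h ∷ᵃ K ∷ᵃ ∅ᵃ)
  go : ∀ {Ψ} → Ψ ⊩ N → ∀ n → Ψ ⊩ n ≤ₙ K ⇒′ (∀′ ι (su b₀ ≤ₙ clo n ⇒′ ¬′ clo h ∙ b₀ ≈ 𝟎) ∧′ CNT ∙ h ∙ n ≈ 𝟎)
                                   ∨′ (∃′ ι (su b₀ ≤ₙ clo n ∧′ clo h ∙ b₀ ≈ 𝟎) ∧′ CNT ∙ h ∙ n ≈ 𝟏′)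
  go nex = ind (b₀ ≤ₙ clo K ⇒′ (∀′ ι (su b₀ ≤ₙ b₁ ⇒′ ¬′ clo h ∙ b₀ ≈ 𝟎) ∧′ clo CNT ∙ clo h ∙ b₀ ≈ 𝟎)
                            ∨′ (∃′ ι (su b₀ ≤ₙ b₁ ∧′ clo h ∙ b₀ ≈ 𝟎) ∧′ clo CNT ∙ clo h ∙ b₀ ≈ 𝟏′))
    (assume λ _ → left ((gen λ i → assume λ l → absurd (su≢0 (≤0⇒≈0 l))) & cnt-zero h))
    λ n g → assume λ l → zero-or-pos (h ∙ n)
      (λ z → cases (w² g ▹ ≤-trans′ n≤suc (w l))
        (λ e → right (witness n (≤-refl′ & w z) & ≈trans (cnt-suc-zero (w z)) (su-cong (π₂ e))))
        (λ e → absurd (obtain (π₁ e) λ i f → w⁵ nex ▹ exhibit i (witness n (π₁ f & w³ l & π₂ f & w² z)))))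
      (λ q → cases (w² g ▹ ≤-trans′ n≤suc (w l))
        (λ e → left ((gen λ i → assume λ l' → cases (≤-or-> n i)
            (λ l″ → assume λ z → su≢0 (≈trans (≈sym (w⁴ q)) (≈trans (app-cong (≤-antisym (w l″) (su-mono⁻ (w² l')))) z)))
            (λ l″ → π₁ (w² e) at i ▹ l″)) & ≈trans (cnt-suc-pos (w q)) (π₂ e)))
        (λ e → right (obtain (π₁ e) (λ i f → witness i (≤-trans′ (π₁ f) n≤suc & π₂ f)) & ≈trans (cnt-suc-pos (w q)) (π₂ e))))

-- Bolzano–Weierstraß.  Y N lists finitely many points y_0, …, y_N for each N;
-- an interval is big if it contains unboundedly many points of a single list,
-- and SEQ Y halves [0,1], keeping the interval big.

JP : Fo (ι ∷ ι ∷ 𝟏 ∷ [])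
JP = ratᵣ b₀ ≤ᵣ b₂ ∧′ b₂ ≤ᵣ ratᵣ (b₀ +q 2⁻ᵗ b₁)

J : ∀ {Δ} → Te Δ ι → Te Δ ι → Te Δ 𝟏 → Fo Δ
J q s y = atom JP (q ∷ᵃ s ∷ᵃ y ∷ᵃ ∅ᵃ)

-- Membership in the interval has a characteristic function, so the count is a term and the formula
-- is arithmetical. Hence it is open to `ind` and can itself steer the recursion in `SEQ`.
BigP : Fo (ι ∷ ι ∷ (ι ⇒ ι ⇒ 𝟏) ∷ [])
BigP = ∀′ ι (∃′ ι (b₁ ≤ₙ clo CNT ∙ lam ⌈ J b₃ b₄ (b₅ ∙ b₁ ∙ b₀) ⌉ ∙ su b₀))

Big : ∀ {Δ} → Te Δ ι → Te Δ ι → Te Δ (ι ⇒ ι ⇒ 𝟏) → Fo Δ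
Big q s Y = atom BigP (q ∷ᵃ s ∷ᵃ Y ∷ᵃ ∅ᵃ)

InUnitP : Fo ((ι ⇒ ι ⇒ 𝟏) ∷ [])
InUnitP = ∀′ ι (∀′ ι (b₀ ≤ₙ b₁ ⇒′ I (b₂ ∙ b₁ ∙ b₀)))

InUnit : ∀ {Δ} → Te Δ (ι ⇒ ι ⇒ 𝟏) → Fo Δ
InUnit Y = atom InUnitP (Y ∷ᵃ ∅ᵃ)

J-split : Φ ⊩ Real′ y → ∀ q s → Φ ⊩ J q s y → Φ ⊩ J q (su s) y ∨′ J (q +q 2⁻ᵗ (su s)) (su s) y
J-split {y = y} ry q s h = em (y ≤ᵣ ratᵣ (q +q 2⁻ᵗ (su s)))
  (λ e → left (fold (π₁ (unfold (w h)) & e)))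
  (λ e → right (fold (
    <-≤ᵣ (<⇒lt (real-rat _) (w ry) (byContra λ n → w e ▹ n)) (real-rat _) (w ry) &
    ≤ᵣ-trans (w ry) (real-rat _) (real-rat _) (π₂ (unfold (w h))) (≤-rat
      (≤q-trans (+q-mono ≤q-refl (proj₂ (half-suc s))) (proj₂ (+q-assoc q _ _)))))))

module _ (Y : Te [] (ι ⇒ ι ⇒ 𝟏)) where
  private
    hJ : Te [] ι → Te [] ι → Te [] ι → Te [] (ι ⇒ ι)
    hJ q s N = lam ⌈ J (clo q) (clo s) (clo Y ∙ clo N ∙ b₀) ⌉

    hJ-intro : ∀ {q s N i} → Φ ⊩ J q s (Y ∙ N ∙ i) → Φ ⊩ hJ q s N ∙ i ≈ 𝟎
    hJ-intro p = ≈trans (beta _ _) (π₁ (charac _) ▹ p)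

    hJ-elim : ∀ {q s N i} → Φ ⊩ hJ q s N ∙ i ≈ 𝟎 → Φ ⊩ J q s (Y ∙ N ∙ i)
    hJ-elim p = π₂ (charac _) ▹ ≈trans (≈sym (beta _ _)) p

  -- If the counts in the two halves stayed below `m₁` and `m₂` for all lists, a list with at least
  -- `m₁ ⊹ m₂` members in the whole interval would violate `cnt-cover`.
  Big-split : Φ ⊩ InUnit Y → ∀ q s → Φ ⊩ Big q s Y → Φ ⊩ Big q (su s) Y ∨′ Big (q +q 2⁻ᵗ (su s)) (su s) Y
  Big-split inu q s big = em (Big q (su s) Y) left λ nb → right (fold (gen λ m₂ → byContra λ n₂ →
    w nb ▹ fold (gen λ m₁ → byContra λ n₁ → obtain (unfold (w³ big) at m₁ ⊹ m₂) λ N p →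
      let h₁ = hJ q (su s) N
          h₂ = hJ (q +q 2⁻ᵗ (su s)) (su s) N
          cover = cnt-cover {h = hJ q s N} {h₁} {h₂} (gen λ i → assume λ l → assume λ z →
                    cases (J-split (I-real (unfold (w⁵ (w inu)) at N at i ▹ su-mono⁻ (w l))) q s (hJ-elim z))
                      (λ e → left (hJ-intro e)) (λ e → right (hJ-intro e)))
      in su≰ (≤-trans′ (≤-cong (+-sucˡ _ _) rfl (+-mono (small N (w n₁)) (≤-trans′ n≤suc (small N (w² n₂))))) (≤-trans′ p cover)))))

    where
    small : ∀ {Ψ m q} N → Ψ ⊩ ¬′ ∃′ ι (clo m ≤ₙ clo CNT ∙ lam ⌈ J (clo q) (clo (su s)) (clo Y ∙ b₁ ∙ b₀) ⌉ ∙ su b₀) →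
            Ψ ⊩ su (CNT ∙ hJ q (su s) N ∙ su N) ≤ₙ m
    small N n = ≰⇒> (assume λ l → w n ▹ witness N l)

  Big-zero : Φ ⊩ InUnit Y → Φ ⊩ Big 0q 𝟎 Y
  Big-zero inu = fold (gen λ m → witness m (≤-trans′ n≤suc (≈⇒≤ (≈sym (cnt-all (gen λ i → assume λ l →
    let iy = unfold (w inu) at m at i ▹ su-mono⁻ l in
    hJ-intro (fold (I-≥0 iy & ≤ᵣ-trans (I-real iy) (real-rat _) (real-rat _) (I-≤1 iy) (≤-rat one))))))))) 
    where
    one : ∀ {Ψ} → Ψ ⊩ rat′ 𝟏′ 𝟎 𝟎 ≤q 0q +q 2⁻ᵗ 𝟎
    one = ≤q-trans (nonneg-intro (rat-val rfl rfl) half-val (≈⇒≤ (rfl ×c two-zero))) (proj₂ (0+ _))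

  -- Left endpoints of nested intervals of length 2⁻ˢ; the left half is taken whenever it is big.
  -- The states are codes of rationals, so recursion of type 0 suffices, and they converge at the
  -- rate demanded of a real: the sequence of endpoints is itself the accumulation point.
  SEQ : Te [] (ι ⇒ ι)
  SEQ = lam (rec′ ∙ b₀ ∙ 0q ∙ lam (lam (rec′ ∙ ⌈ Big b₁ (su b₀) (clo Y) ⌉ ∙ b₁ ∙ lam (lam (b₃ +q 2⁻ᵗ (su b₂))))))

  private
    stage : Te [] ι → Te [] ι
    stage s = rec′ ∙ s ∙ 0q ∙ lam (lam (rec′ ∙ ⌈ Big b₁ (su b₀) (clo Y) ⌉ ∙ b₁ ∙ lam (lam (b₃ +q 2⁻ᵗ (su b₂)))))

    SEQ-stage : ∀ s → Φ ⊩ SEQ ∙ s ≈ stage s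
    SEQ-stage s = beta (rec′ ∙ b₀ ∙ 0q ∙ lam (lam (rec′ ∙ ⌈ Big b₁ (su b₀) (clo Y) ⌉ ∙ b₁ ∙ lam (lam (b₃ +q 2⁻ᵗ (su b₂)))))) s

  SEQ-zero : Φ ⊩ SEQ ∙ 𝟎 ≈ 0q
  SEQ-zero = ≈trans (SEQ-stage 𝟎) rec-zero

  SEQ-suc : ∀ s → Φ ⊩ (Big (SEQ ∙ s) (su s) Y ∧′ SEQ ∙ su s ≈ SEQ ∙ s)
                    ∨′ (¬′ Big (SEQ ∙ s) (su s) Y ∧′ SEQ ∙ su s ≈ SEQ ∙ s +q 2⁻ᵗ (su s))
  SEQ-suc s = replace ((Big b₀ (su (clo s)) (clo Y) ∧′ clo (SEQ ∙ su s) ≈ b₀)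
                   ∨′ (¬′ Big b₀ (su (clo s)) (clo Y) ∧′ clo (SEQ ∙ su s) ≈ b₀ +q 2⁻ᵗ (su (clo s)))) (≈sym (SEQ-stage s))
    (em (Big (stage s) (su s) Y)
      (λ p → left (p & ≈trans e (≈trans (ctx (rec′ ∙ b₀ ∙ clo (stage s) ∙ clo (lam (lam (clo (stage s) +q 2⁻ᵗ (su (clo s))))))
                (π₁ (charac (Big (stage s) (su s) Y)) ▹ p)) rec-zero)))
      (λ p → right (p & ≈trans e (≈trans (ctx (rec′ ∙ b₀ ∙ clo (stage s) ∙ clo (lam (lam (clo (stage s) +q 2⁻ᵗ (su (clo s))))))
                (pos-elim (assume λ z → w p ▹ (π₂ (charac (Big (stage s) (su s) Y)) ▹ z)))) (rec-step (clo (stage s) +q 2⁻ᵗ (su (clo s))))))))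
    where
    e : ∀ {Ψ} → Ψ ⊩ SEQ ∙ su s ≈ rec′ ∙ ⌈ Big (stage s) (su s) Y ⌉ ∙ stage s ∙ lam (lam (clo (stage s) +q 2⁻ᵗ (su (clo s))))
    e = ≈trans (SEQ-stage (su s)) (rec-step (rec′ ∙ ⌈ Big b₁ (su b₀) (clo Y) ⌉ ∙ b₁ ∙ lam (lam (b₃ +q 2⁻ᵗ (su b₂)))))

  SEQ-big : Φ ⊩ InUnit Y → ∀ s → Φ ⊩ Big (SEQ ∙ s) s Y
  SEQ-big inu = ind (Big (clo SEQ ∙ b₀) b₀ (clo Y)) (replace (Big b₀ (clo 𝟎) (clo Y)) (≈sym SEQ-zero) (Big-zero inu))
    λ s g → cases (SEQ-suc s)
      (λ p → replace (Big b₀ (su (clo s)) (clo Y)) (≈sym (π₂ p)) (π₁ p))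
      (λ p → replace (Big b₀ (su (clo s)) (clo Y)) (≈sym (π₂ p)) (cases (Big-split (w² inu) _ s (w g))
        (λ e → absurd (π₁ (w p) ▹ e)) (λ e → e)))

  SEQ-lower : ∀ s k → Φ ⊩ SEQ ∙ s ≤q SEQ ∙ (s ⊹ k)
  SEQ-lower s = ind (clo SEQ ∙ clo s ≤q clo SEQ ∙ (clo s ⊹ b₀)) (proj₂ (idx-cong +-zero))
    λ k g → ≤q-trans g (≤q-trans (cases (SEQ-suc (s ⊹ k))
      (λ p → proj₂ (≈⇒≈q (π₂ p)))
      (λ p → ≤q-trans (linear (0≤half (su (s ⊹ k))) (solveq 2 (λ a b → a :⊕ b ⊜ (a :⊕ b) :⊕ :0) ≈q-refl _ _)) (proj₂ (≈⇒≈q (π₂ p)))))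
      (proj₂ (idx-cong +-suc)))

  SEQ-upper : ∀ s k → Φ ⊩ SEQ ∙ (s ⊹ k) +q 2⁻ᵗ (s ⊹ k) ≤q SEQ ∙ s +q 2⁻ᵗ s
  SEQ-upper s = ind (clo SEQ ∙ (clo s ⊹ b₀) +q 2⁻ᵗ (clo s ⊹ b₀) ≤q clo SEQ ∙ clo s +q 2⁻ᵗ (clo s))
    (+q-mono (proj₁ (idx-cong +-zero)) (proj₁ (≈⇒≈q (un-cong halfᵘ +-zero))))
    λ k g → let i = s ⊹ k
                u = 2⁻ᵗ (su i)
      in ≤q-trans (+q-mono (proj₁ (idx-cong +-suc)) (proj₁ (≈⇒≈q (un-cong halfᵘ +-suc)))) (≤q-trans (cases (SEQ-suc i)
      (λ p → linear (proj₁ (≈⇒≈q (π₂ p)) ⊕q half+half i ⊕q 0≤half (su i))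
        (solveq 4 (λ a b u v → (b :⊕ u) :⊕ a :⊕ v :⊕ u ⊜ (a :⊕ v) :⊕ b :⊕ (u :⊕ u) :⊕ :0) ≈q-refl (SEQ ∙ i) (SEQ ∙ su i) u (2⁻ᵗ i)))
      (λ p → linear (proj₁ (≈⇒≈q (π₂ p)) ⊕q half+half i)
        (solveq 4 (λ a b u v → (b :⊕ u) :⊕ (a :⊕ u) :⊕ v ⊜ (a :⊕ v) :⊕ b :⊕ (u :⊕ u)) ≈q-refl (SEQ ∙ i) (SEQ ∙ su i) u (2⁻ᵗ i)))) g)

  -- Regularity asks for a strict bound. Nestedness provides it, since an endpoint moves from stage
  -- `s` to stage `s ⊹ k` by at most 2⁻ˢ - 2⁻⁽ˢ⁺ᵏ⁾.
  SEQ-real : Φ ⊩ Real′ SEQ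
  SEQ-real = fold (gen λ s → gen λ k → ≰⇒lt (assume λ e →
    let d = 2⁻ᵗ s -q 2⁻ᵗ (s ⊹ k)
    in half≰0 (s ⊹ k) (linear
      (≤q-trans e (dist-intro {s = d}
        (linear (SEQ-lower s k ⊕q half-mono s k ⊕q proj₂ (sub-+ (2⁻ᵗ s) (2⁻ᵗ (s ⊹ k))))
          (solveq 5 (λ a b d u v → a :⊕ b :⊕ u :⊕ (d :⊕ v) ⊜ (b :⊕ d) :⊕ a :⊕ v :⊕ u) ≈q-refl (SEQ ∙ s) (SEQ ∙ (s ⊹ k)) d (2⁻ᵗ s) (2⁻ᵗ (s ⊹ k))))
        (linear (SEQ-upper s k ⊕q proj₂ (sub-+ (2⁻ᵗ s) (2⁻ᵗ (s ⊹ k))))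
          (solveq 5 (λ a b d u v → b :⊕ (a :⊕ u) :⊕ (d :⊕ v) ⊜ (a :⊕ d) :⊕ (b :⊕ v) :⊕ u) ≈q-refl (SEQ ∙ s) (SEQ ∙ (s ⊹ k)) d (2⁻ᵗ s) (2⁻ᵗ (s ⊹ k)))))
       ⊕q proj₁ (sub-+ (2⁻ᵗ s) (2⁻ᵗ (s ⊹ k))))
      (solveq 3 (λ d u v → v :⊕ d :⊕ u ⊜ :0 :⊕ u :⊕ (d :⊕ v)) ≈q-refl d (2⁻ᵗ s) (2⁻ᵗ (s ⊹ k))))))

  SEQ-I : Φ ⊩ I SEQ
  SEQ-I = I-intro SEQ-real
    (rat-≤ᵣ {φ = ⊥′ ⇒′ ⊥′} (λ n _ → ≤q-trans (proj₂ (≈⇒≈q SEQ-zero)) (≤q-trans (SEQ-lower 𝟎 n) (proj₁ (idx-cong (+-zeroˡ n))))) (assume λ e → e))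
    (≤ᵣ-rat {φ = ⊥′ ⇒′ ⊥′} (λ n _ → linear
      (proj₂ (idx-cong (+-zeroˡ n)) ⊕q SEQ-upper 𝟎 n ⊕q proj₁ (≈⇒≈q SEQ-zero) ⊕q 0≤half (𝟎 ⊹ n) ⊕q nonneg-intro half-val (rat-val rfl rfl) (≈⇒≤ (rfl ×c ≈sym two-zero)))
      (solveq 6 (λ a a' z u v o → a :⊕ a' :⊕ (z :⊕ v) :⊕ :0 :⊕ u :⊕ o ⊜ o :⊕ a :⊕ (a' :⊕ u) :⊕ z :⊕ :0 :⊕ v) ≈q-refl
        (SEQ ∙ n) (SEQ ∙ (𝟎 ⊹ n)) (SEQ ∙ 𝟎) (2⁻ᵗ (𝟎 ⊹ n)) (2⁻ᵗ 𝟎) (rat′ 𝟏′ 𝟎 𝟎))) (assume λ e → e))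

  -- One half of the tolerance covers the length of the interval, strictly because that length is a
  -- quarter; the other half covers the distance from the endpoint to the limit.
  J-near : Φ ⊩ Real′ y → ∀ s → Φ ⊩ J (SEQ ∙ su (su s)) (su (su s)) y → Φ ⊩ Nearᵣ y SEQ s
  J-near {y = y} ry s h = near-intro
    (≤-lt ry (real-rat _) (π₂ j) (lt-trans
       (lt-rat (assume λ e → half-strict (su s) (linear e (solveq 3 (λ a u v → u :⊕ (a :⊕ v) ⊜ v :⊕ (a :⊕ u)) ≈q-refl Q (2⁻ᵗ (su s)) (2⁻ᵗ (su (su s)))))))
       (approx-> SEQ-real (su s)) (half+half s)))
    (lt-weak (lt-≤ (real-rat _) ry (approx-< SEQ-real (su s)) (π₁ j)) (linear (half+half s ⊕q 0≤half (su s))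
       (solveq 2 (λ u v → v :⊕ u :⊕ v ⊜ u :⊕ (v :⊕ v) :⊕ :0) ≈q-refl (2⁻ᵗ s) (2⁻ᵗ (su s)))))
    where
    Q : Te [] ι
    Q = SEQ ∙ su (su s)
    j = unfold h

  -- Bigness is used with the bound two. Both indices belong to the same list, because members of
  -- different lists may coincide.
  accumulate : Φ ⊩ InUnit Y → ∀ s → Φ ⊩ ∃′ ι (∃′ ι (∃′ ι (su b₁ ≤ₙ b₀ ∧′ (b₀ ≤ₙ b₂ ∧′
                 (Nearᵣ (clo Y ∙ b₂ ∙ b₁) (clo SEQ) (clo s) ∧′ Nearᵣ (clo Y ∙ b₂ ∙ b₀) (clo SEQ) (clo s))))))
  accumulate inu s = obtain (unfold (SEQ-big inu (su (su s))) at su 𝟏′) λ N p →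
    pick (cnt-two {h = hJ (SEQ ∙ su (su s)) (su (su s)) N} p) λ i g → obtain g λ j e →
      let iu = unfold (w³ inu)
          j≤N = su-mono⁻ (π₁ (π₂ e))
      in witness N (witness i (witness j (π₁ e & j≤N &
           J-near (I-real (iu at N at i ▹ ≤-trans′ n≤suc (≤-trans′ (π₁ e) j≤N))) s (hJ-elim (π₁ (π₂ (π₂ e)))) &
           J-near (I-real (iu at N at j ▹ j≤N)) s (hJ-elim (π₂ (π₂ (π₂ e)))))))

private variable
  N' : Te [] ι

-- Restricting the oscillation to rational points makes it arithmetical; for a
-- regulated f nothing is lost.

OscP : Fo (𝟏 ⇒ 𝟏 ∷ ι ∷ 𝟏 ∷ [])
OscP = ∀′ ι (∃′ ι (I (ratᵣ b₀) ∧′ (Nearᵣ (ratᵣ b₀) b₄ b₁ ∧′ ¬′ Nearᵣ (b₂ ∙ ratᵣ b₀) (b₂ ∙ b₄) b₃)))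

Osc : ∀ {Δ} → Te Δ (𝟏 ⇒ 𝟏) → Te Δ ι → Te Δ 𝟏 → Fo Δ
Osc f k x = atom OscP (f ∷ᵃ k ∷ᵃ x ∷ᵃ ∅ᵃ)

-- The limit condition at a single scale, with the limit itself existentially quantified: the
-- arguments below only compare two values through it.
LimKP : Side → Fo (𝟏 ⇒ 𝟏 ∷ 𝟏 ∷ ι ∷ ι ∷ [])
LimKP κ = ∃′ 𝟏 (Real′ b₀ ∧′ ∀′ 𝟏 (I b₀ ∧′ (side κ b₀ b₃ ∧′ Nearᵣ b₀ b₃ b₅)
            ⇒′ Nearᵣ (b₂ ∙ b₀) b₁ b₄))

LimK : ∀ {Δ} → Side → Te Δ (𝟏 ⇒ 𝟏) → Te Δ 𝟏 → Te Δ ι → Te Δ ι → Fo Δ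
LimK κ f x k N = atom (LimKP κ) (f ∷ᵃ x ∷ᵃ k ∷ᵃ N ∷ᵃ ∅ᵃ)

fun-real : Φ ⊩ Fun f → Φ ⊩ I x → Φ ⊩ Real′ (f ∙ x)
fun-real {x = x} hf ix = π₁ (unfold hf) at x ▹ ix

fun-ext : Φ ⊩ Fun f → Φ ⊩ I x → Φ ⊩ I y → Φ ⊩ x ≐ᵣ y → Φ ⊩ f ∙ x ≐ᵣ f ∙ y
fun-ext {x = x} {y} hf ix iy e = π₂ (unfold hf) at x at y ▹ (ix & iy & e)

lims : Φ ⊩ Reg f → Φ ⊩ I x → ∀ k → Φ ⊩ ∃′ ι (LimK L (clo f) (clo x) (clo k) b₀ ∧′ LimK R′ (clo f) (clo x) (clo k) b₀)
lims {f = f} {x} reg ix k =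
  obtain (π₁ (unfold reg at x ▹ ix)) λ y₁ l₁ → obtain (unfold (π₂ l₁) at k) λ N₁ g₁ →
  obtain (π₂ (unfold (w² reg) at x ▹ w² ix)) λ y₂ l₂ → obtain (unfold (π₂ l₂) at k) λ N₂ g₂ →
  let rx = I-real (w⁴ ix) in
  witness (N₁ ⊹ N₂) (
    exhibit y₁ (π₁ (w³ l₁) & gen (λ z → assume λ p → w³ g₁ at z ▹ (π₁ p & π₁ (π₂ p) & near-mono (I-real (π₁ p)) (w rx) s≤s+t (π₂ (π₂ p))))) &
    exhibit y₂ (π₁ (w l₂) & gen (λ z → assume λ p → w g₂ at z ▹ (π₁ p & π₁ (π₂ p) & near-mono (I-real (π₁ p)) (w rx) t≤s+t (π₂ (π₂ p))))))

choose-side : ∀ κ → Φ ⊩ LimK L f x k' N' ∧′ LimK R′ f x k' N' → Φ ⊩ LimK κ f x k' N'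
choose-side L  p = π₁ p
choose-side R′ p = π₂ p

-- Between x and a nearby z there is a rational point q, and f z ≈ f q ≈ f x,
-- the first because both are close to the one-sided limit.

side-cont : ∀ κ → Φ ⊩ Fun f → Φ ⊩ I x → Φ ⊩ I z → ∀ {k M N} → Φ ⊩ LimK κ f x (su (su k)) N →
            Φ ⊩ ∀′ ι (I (ratᵣ b₀) ∧′ Nearᵣ (ratᵣ b₀) (clo x) (clo M) ⇒′ Nearᵣ (clo f ∙ ratᵣ b₀) (clo f ∙ clo x) (clo (su (su k)))) →
            Φ ⊩ side κ z x → Φ ⊩ Nearᵣ z x N → Φ ⊩ Nearᵣ (f ∙ z) (f ∙ x) k
side-cont {x = x} {z} κ hf ix iz {k} {M} {N} lim hq sd near = pick lim λ y l →
  side-dense κ (w iz) (w ix) (w sd) (M ⊹ N) λ q →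
    let p = h₀
        iq = π₁ p
        rq = real-rat q
        rx = I-real (w² ix)
        ffx = fun-real (w² hf) (w² ix)
        ffq = fun-real (w² hf) iq
        ffz = fun-real (w² hf) (w² iz)
        ry = π₁ (w l)
    in near-trans ffz ffq ffx
         (near-trans ffz ry ffq (π₂ (w l) at z ▹ (w² iz & w² sd & w² near))
           (near-sym ffq ry (π₂ (w l) at ratᵣ q ▹ (iq & π₁ (π₂ p) & near-mono rq rx t≤s+t (π₂ (π₂ p))))))
         (near-mono ffq ffx n≤suc (w² hq at q ▹ (iq & near-mono rq rx s≤s+t (π₂ (π₂ p)))))

-- Without oscillation over rational points, values at rationals near `x` are close to the value at
-- `x`, and one-sided limits carry this over to all points. The tolerance is quartered since the way
-- from `f ∙ z` to `f ∙ x` passes through the limit and a rational point.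
osc-exists : Φ ⊩ Fun f → Φ ⊩ Reg f → Φ ⊩ I x → Φ ⊩ ¬′ Cont f x → Φ ⊩ ∃′ ι (Osc (clo f) b₀ (clo x))
osc-exists {Φ} {f} {x} hf reg ix nc = byContra λ nex → w nc ▹ fold (gen λ k →
  obtain (small nex k) λ M hq → obtain (lims (w² reg) (w² ix) (su (su k))) λ N l →
  witness (M ⊹ N) (gen λ z → assume λ p →
    by-side z x
      (λ κ sd → side-cont κ (w⁵ hf) (w⁵ ix) (π₁ (w p)) {k} {M} {N} (choose-side κ (w² l)) (w³ hq) sd
                  (near-mono (I-real (π₁ (w p))) (I-real (w⁵ ix)) t≤s+t (π₂ (w p))))
      (λ e → ≐-near (fun-real (w⁵ hf) (π₁ (w p))) (fun-real (w⁵ hf) (w⁵ ix)) (fun-ext (w⁵ hf) (π₁ (w p)) (w⁵ ix) e) k)))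
  where
  small : ∀ {Ψ} → Ψ ⊩ ¬′ ∃′ ι (Osc (clo f) b₀ (clo x)) → ∀ k → Ψ ⊩ ∃′ ι (∀′ ι (I (ratᵣ b₀) ∧′ Nearᵣ (ratᵣ b₀) (clo x) b₁
            ⇒′ Nearᵣ (clo f ∙ ratᵣ b₀) (clo f ∙ clo x) (clo (su (su k)))))
  small nex k = byContra λ n₁ → w nex ▹ witness (su (su k)) (fold (gen λ N → byContra λ n₂ → w n₁ ▹ witness N (gen λ q → assume λ p →
    byContra λ n₃ → w² n₂ ▹ witness q (π₁ (w p) & π₂ (w p) & n₃))))

-- From oscillation to a height function

osc-ext : Φ ⊩ Fun f → Φ ⊩ I x → Φ ⊩ I y → Φ ⊩ x ≐ᵣ y → Φ ⊩ Osc f k' x → Φ ⊩ Osc f k' y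
osc-ext {x = x} {y} hf ix iy e o = fold (gen λ N → obtain (unfold o at N) λ q p →
  witness q (π₁ p & near-respʳ (real-rat q) (I-real (w ix)) (I-real (w iy)) (w e) (π₁ (π₂ p)) & assume λ g →
    π₂ (π₂ (w p)) ▹ near-respʳ (fun-real (w² hf) (π₁ (w p))) (fun-real (w² hf) (w² iy)) (fun-real (w² hf) (w² ix))
      (≐-sym (fun-ext (w² hf) (w² ix) (w² iy) (w² e))) g))

osc-mono : Φ ⊩ Fun f → Φ ⊩ I x → Φ ⊩ n ≤ₙ m → Φ ⊩ Osc f n x → Φ ⊩ Osc f m x
osc-mono hf ix l o = fold (gen λ N → obtain (unfold o at N) λ q p →
  witness q (π₁ p & π₁ (π₂ p) & assume λ g →
    π₂ (π₂ (w p)) ▹ near-mono (fun-real (w² hf) (π₁ (w p))) (fun-real (w² hf) (w² ix)) (w² l) g))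

-- Least number principle, by arithmetical induction on the length of an initial segment without
-- solutions.
least-osc : Φ ⊩ ∃′ ι (Osc (clo f) b₀ (clo x)) →
            Φ ⊩ ∃′ ι (Osc (clo f) b₀ (clo x) ∧′ ∀′ ι (su b₀ ≤ₙ b₁ ⇒′ ¬′ Osc (clo f) b₀ (clo x)))
least-osc {f = f} {x} h = byContra λ nex → obtain (w h) λ k o → none (w nex) (su k) at k ▹ ≤-refl′ ▹ o
  where
  none : ∀ {Ψ} → Ψ ⊩ ¬′ ∃′ ι (Osc (clo f) b₀ (clo x) ∧′ ∀′ ι (su b₀ ≤ₙ b₁ ⇒′ ¬′ Osc (clo f) b₀ (clo x))) →
         ∀ n → Ψ ⊩ ∀′ ι (su b₀ ≤ₙ clo n ⇒′ ¬′ Osc (clo f) b₀ (clo x))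
  none nex = ind (∀′ ι (su b₀ ≤ₙ b₁ ⇒′ ¬′ Osc (clo f) b₀ (clo x)))
    (gen λ i → assume λ l → absurd (su≢0 (≤0⇒≈0 l)))
    λ n g → gen λ i → assume λ l → cases (≤-or-> n i)
      (λ l' → assume λ o → w⁴ nex ▹ witness i (o & gen λ j → assume λ lj →
          w⁴ g at j ▹ ≤-trans′ lj (su-mono⁻ (w³ l))))
      (λ l' → w² g at i ▹ l')

-- Least exponent inside the interval, default 0 outside: this determines every value, and
-- `height-ext` derives from it that equal reals have the same height.
HeightSpecP : Fo (𝟏 ⇒ 𝟏 ∷ 𝟐 ∷ [])
HeightSpecP = ∀′ 𝟏 ((I b₀ ⇒′ Osc b₁ (b₂ ∙ b₀) b₀ ∧′ ∀′ ι (su b₀ ≤ₙ b₃ ∙ b₁ ⇒′ ¬′ Osc b₂ b₀ b₁)) ∧′ (¬′ I b₀ ⇒′ b₂ ∙ b₀ ≈ 𝟎))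

HeightSpec : ∀ {Δ} → Te Δ (𝟏 ⇒ 𝟏) → Te Δ 𝟐 → Fo Δ
HeightSpec f H = atom HeightSpecP (f ∷ᵃ H ∷ᵃ ∅ᵃ)

height-exists : Φ ⊩ Fun f → Φ ⊩ Reg f → Φ ⊩ ¬′ ∃′ 𝟏 (I b₀ ∧′ Cont (clo f) b₀) → Φ ⊩ ∃′ 𝟐 (HeightSpec (clo f) b₀)
height-exists {f = f} hf reg nc = obtain (ac₁₀
    ((I b₁ ⇒′ Osc (clo f) b₀ b₁ ∧′ ∀′ ι (su b₀ ≤ₙ b₁ ⇒′ ¬′ Osc (clo f) b₀ b₂)) ∧′ (¬′ I b₁ ⇒′ b₀ ≈ 𝟎))
    (gen λ x → em (I x)
      (λ ix → obtain (least-osc (osc-exists (w hf) (w reg) ix (assume λ c → w² nc ▹ witness x (w ix & c)))) λ k o →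
        witness k ((assume λ _ → w o) & (assume λ ni → absurd (ni ▹ w² ix))))
      (λ ni → witness 𝟎 ((assume λ ix → absurd (w ni ▹ ix)) & (assume λ _ → rfl)))))
  λ H g → witness H (fold g)

height-ext : Φ ⊩ Fun f → Φ ⊩ HeightSpec f H → Φ ⊩ Ext H
height-ext {Φ} {f} {H} hf spec = fold (gen λ x → gen λ y → assume λ p →
  em (I x)
    (λ ix → let iy = I-between (π₁ (π₂ (w p))) ix ix (≐-≤ (π₂ (π₂ (w p)))) (≐-≤ (≐-sym (π₂ (π₂ (w p))))) in
       ≤-antisym (least (w² hf) (w² spec) iy ix (≐-sym (π₂ (π₂ (w p))))) (least (w² hf) (w² spec) ix iy (π₂ (π₂ (w p)))))
    (λ nx → ≈trans (π₂ (unfold (w² spec) at x) ▹ nx) (≈sym (π₂ (unfold (w² spec) at y) ▹ assume λ iy →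
       w nx ▹ I-between (π₁ (w² p)) iy iy (≐-≤ (≐-sym (π₂ (π₂ (w² p))))) (≐-≤ (π₂ (π₂ (w² p))))))))
  where
  least : ∀ {Ψ x y} → Ψ ⊩ Fun f → Ψ ⊩ HeightSpec f H → Ψ ⊩ I x → Ψ ⊩ I y → Ψ ⊩ x ≐ᵣ y → Ψ ⊩ H ∙ y ≤ₙ H ∙ x
  least {x = x} {y} hf spec ix iy e = cases (≤-or-> (H ∙ y) (H ∙ x)) (λ l → l) λ l →
    absurd (π₂ (π₁ (unfold (w spec) at y) ▹ w iy) at (H ∙ x) ▹ l ▹
      osc-ext (w hf) (w ix) (w iy) (w e) (π₁ (π₁ (unfold (w spec) at x) ▹ w ix)))

-- Points of large oscillation are finite in number

ListP : Fo (ι ⇒ 𝟏 ∷ ι ∷ ι ∷ 𝟐 ∷ [])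
ListP = Reals b₀ b₁ ∧′ (Distinct b₀ b₁ ∧′ ∀′ ι (b₀ ≤ₙ b₂ ⇒′ I (b₁ ∙ b₀) ∧′ su (b₄ ∙ (b₁ ∙ b₀)) ≤ₙ b₃))

Listing : ∀ {Δ} → Te Δ (ι ⇒ 𝟏) → Te Δ ι → Te Δ ι → Te Δ 𝟐 → Fo Δ
Listing s N n H = atom ListP (s ∷ᵃ N ∷ᵃ n ∷ᵃ H ∷ᵃ ∅ᵃ)

-- Failure of finiteness gives a list for each `N`, but choice returns a function on numbers. A list
-- is coded by pairing: the value at `pair i m` is the `m`-th approximation of its `i`-th point.
choose-lists : Φ ⊩ ¬′ Fin′ n H → Φ ⊩ ∃′ (ι ⇒ ι ⇒ 𝟏) (∀′ ι (Listing (b₁ ∙ b₀) b₀ (clo n) (clo H)))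
choose-lists {n = n} {H} nf = obtain (ac₀₁ (Listing (lam (lam (b₂ ∙ pair b₁ b₀))) b₁ (clo n) (clo H))
    (gen λ N → byContra λ nex → w nf ▹ exhibit N (gen λ s → assume λ p → byContra λ nex₂ → w² nex ▹
      (let g = lam (clo s ∙ un fstᵘ b₀ ∙ un sndᵘ b₀)
           e : ∀ {Ψ} → Ψ ⊩ Eq′ (ι ⇒ 𝟏) s (lam (lam (clo g ∙ pair b₁ b₀)))
           e = gen λ i → gen λ m → ≈sym (≈trans (beta (lam (clo g ∙ pair b₁ b₀)) i at m) (≈trans (beta (clo g ∙ pair (clo i) b₀) m)
                 (≈trans (beta (clo s ∙ un fstᵘ b₀ ∙ un sndᵘ b₀) (pair i m))
                   (≈trans (ctx (clo s ∙ b₀ ∙ clo (un sndᵘ (pair i m))) fst-pair) (ctx (clo (s ∙ i) ∙ b₀) snd-pair)))))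
       in witness g (ext-replace (Listing b₀ (clo N) (clo n) (clo H)) e
            (fold (π₁ (w p) & π₂ (w p) & gen λ i → assume λ l → byContra λ e → w² nex₂ ▹ witness i (w l & e))))))))
  λ G hG → let Y = lam (lam (lam (clo G ∙ b₂ ∙ pair b₁ b₀))) in
    witness Y (gen λ N → ext-replace (Listing b₀ (clo N) (clo n) (clo H))
      (gen λ i → gen λ m → ≈sym (beta (lam (lam (clo G ∙ b₂ ∙ pair b₁ b₀))) N at i at m)) (hG at N))

-- The rational points that witness the oscillation at z lie on the same side of
-- x as z, where f is nearly constant.

side-contra : ∀ κ → Φ ⊩ Fun f → Φ ⊩ I x → Φ ⊩ I z → ∀ {k N} → Φ ⊩ LimK κ f x (su k) N → Φ ⊩ Osc f k z →
              Φ ⊩ side κ z x → Φ ⊩ Nearᵣ z x N → Φ ⊩ ⊥′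
side-contra {x = x} {z} κ hf ix iz {k} {N} lim osc sd near = pick lim λ y l →
  obtain (side-open κ (w (I-real iz)) (w (I-real ix)) (w sd) (w near)) λ M o → obtain (unfold (w² osc) at M) λ q p →
    let iq = π₁ p
        o' = w o at ratᵣ q ▹ (real-rat q & π₁ (π₂ p))
        ry = π₁ (w² l)
        ffq = fun-real (w³ hf) iq
        ffz = fun-real (w³ hf) (w³ iz)
    in π₂ (π₂ p) ▹ near-trans ffq ry ffz (π₂ (w² l) at ratᵣ q ▹ (iq & π₁ o' & π₂ o'))
         (near-sym ffz ry (π₂ (w² l) at z ▹ (w³ iz & w³ sd & w³ near)))

height-fin : Φ ⊩ Fun f → Φ ⊩ Reg f → Φ ⊩ HeightSpec f H → ∀ n → Φ ⊩ Fin′ n H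
height-fin {Φ} {f} {H} hf reg spec n = byContra λ nf → obtain (choose-lists nf) λ Y hY →
  let inu : ∀ {Ψ} → Ψ ⊩ ∀′ ι (Listing (clo Y ∙ b₀) b₀ (clo n) (clo H)) → Ψ ⊩ InUnit Y
      inu hY = fold (gen λ N → gen λ i → assume λ l → π₁ (π₂ (π₂ (unfold (w hY at N))) at i ▹ l))
      x = SEQ Y
      isolated : ∀ {Ψ N i M} → Ψ ⊩ Fun f → Ψ ⊩ HeightSpec f H → Ψ ⊩ LimK L f x (su n) M ∧′ LimK R′ f x (su n) M →
                 Ψ ⊩ Listing (Y ∙ N) N n H → Ψ ⊩ i ≤ₙ N → Ψ ⊩ Nearᵣ (Y ∙ N ∙ i) x M → Ψ ⊩ ¬′ (Y ∙ N ∙ i ≐ᵣ x) → Ψ ⊩ ⊥′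
      isolated {N = N} {i} hf spec lim li l near ne =
        let a = π₂ (π₂ (unfold li)) at i ▹ l
            z = Y ∙ N ∙ i
            -- Each point oscillates at the exponent given by its own height; as that height is
            -- below `n`, the exponent `n` serves for all of them. Limits are taken at `su n`
            -- because two values are compared through the limit.
            osc = osc-mono hf (π₁ a) (≤-trans′ n≤suc (π₂ a)) (π₁ (π₁ (unfold spec at z) ▹ π₁ a))
        in by-side z x (λ κ sd → side-contra κ (w hf) (SEQ-I Y) (w (π₁ a)) (choose-side κ (w lim)) (w osc) sd (w near))
             (λ e → w ne ▹ e)
  in obtain (lims (w² reg) (SEQ-I Y) (su n)) λ M lim → obtain (accumulate Y (inu (w hY)) M) λ N p → obtain p λ i p → obtain p λ j p →
    let li = w⁴ hY at N
        hf' = w (w⁵ hf)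
        spec' = w (w⁵ spec)
        i<j = π₁ p
        j≤N = π₁ (π₂ p)
        i≤N = ≤-trans′ n≤suc (≤-trans′ i<j j≤N)
        real : ∀ {Ψ k} → Ψ ⊩ Listing (Y ∙ N) N n H → Ψ ⊩ k ≤ₙ N → Ψ ⊩ Real′ (Y ∙ N ∙ k)
        real li l = unfold (π₁ (unfold li)) at _ ▹ l
    -- At most one of two distinct points equals `x`; the other lies strictly on one side of it.
    in em (Y ∙ N ∙ i ≐ᵣ x)
      (λ e → isolated {M = M} (w hf') (w spec') (w⁴ lim) (w li) (w j≤N) (w (π₂ (π₂ (π₂ p)))) (assume λ e' →
         unfold (π₁ (π₂ (unfold (w² li)))) at i at j ▹ (w² i<j & w² j≤N) ▹
           ≐-trans (real (w² li) (w² i≤N)) (SEQ-real Y) (real (w² li) (w² j≤N)) (w e) (≐-sym e')))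
      (λ ne → isolated {M = M} (w hf') (w spec') (w⁴ lim) (w li) (w i≤N) (w (π₁ (π₂ (π₂ p)))) ne)

NIN⇒regulated : Φ ⊩ ¬′ HeightP → Φ ⊩ NotDiscP
NIN⇒regulated nin = gen λ f → assume λ p → byContra λ nex →
  obtain (height-exists (w (π₁ p)) (w (π₂ p)) nex) λ H spec →
    w³ nin ▹ witness H (height-ext (w² (π₁ p)) spec & gen λ n → height-fin (w² (π₁ p)) (w² (π₂ p)) spec n)

-- Evaluation returns the formulas of Defs.  Normal forms of the rational
-- operations are huge, so the comparisons keep these folded.

opaque
  unfolding ⟦_⟧ᵘ ⟦_⟧ᵇ ⟦_⟧ʳ

  ⟦lt⟧ : ∀ {Γ} {a a' b b' : Tm Γ ι} → a ≡ a' → b ≡ b' → ⟦ ltʳ ⟧ʳ a b ≡ (a' <ℚ b')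
  ⟦lt⟧ p q = cong₂ _<ℚ_ p q

  ⟦le⟧ : ∀ {Γ} {a a' b b' : Tm Γ ι} → a ≡ a' → b ≡ b' → ⟦ leʳ ⟧ʳ a b ≡ (a' ≤ℚ b')
  ⟦le⟧ p q = cong₂ _≤ℚ_ p q

  ⟦sub⟧ : ∀ {Γ} {a a' b b' : Tm Γ ι} → a ≡ a' → b ≡ b' → ⟦ subᵇ ⟧ᵇ a b ≡ (a' -ℚ b')
  ⟦sub⟧ p q = cong₂ _-ℚ_ p q

  ⟦plus⟧ : ∀ {Γ} (a b : Tm Γ ι) → ⟦ plusᵇ ⟧ᵇ a b ≡ (a ⊕ b)
  ⟦plus⟧ a b = refl

  ⟦pair⟧ : ∀ {Γ} (a b : Tm Γ ι) → ⟦ pairᵇ ⟧ᵇ a b ≡ ⟪ a , b ⟫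
  ⟦pair⟧ a b = refl

  ⟦abs⟧ : ∀ {Γ} {a a' : Tm Γ ι} → a ≡ a' → ⟦ absᵘ ⟧ᵘ a ≡ absℚ a'
  ⟦abs⟧ p = cong absℚ p

  ⟦half⟧ : ∀ {Γ} (a : Tm Γ ι) → ⟦ halfᵘ ⟧ᵘ a ≡ 2⁻ a
  ⟦half⟧ a = refl

  ⟦dbl⟧ : ∀ {Γ} (a : Tm Γ ι) → ⟦ dblᵘ ⟧ᵘ a ≡ 2⁻⁺ a
  ⟦dbl⟧ a = refl

Real≡ : ∀ {Γ} (x : Tm Γ 𝟏) →
        (∀[ ι ] ∀[ ι ] ⟦ ltʳ ⟧ʳ (⟦ absᵘ ⟧ᵘ (⟦ subᵇ ⟧ᵇ (x ↑² · v₁) (x ↑² · ⟦ plusᵇ ⟧ᵇ v₁ v₀))) (⟦ halfᵘ ⟧ᵘ v₁)) ≡ Real x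
Real≡ x = cong (λ φ → ∀[ ι ] ∀[ ι ] φ) (⟦lt⟧ (⟦abs⟧ (⟦sub⟧ refl (cong (x ↑² ·_) (⟦plus⟧ v₁ v₀)))) (⟦half⟧ v₁))

=ℝ≡ : ∀ {Γ} (x y : Tm Γ 𝟏) → (∀[ ι ] ⟦ leʳ ⟧ʳ (⟦ absᵘ ⟧ᵘ (⟦ subᵇ ⟧ᵇ (x ↑ · v₀) (y ↑ · v₀))) (⟦ dblᵘ ⟧ᵘ v₀)) ≡ (x =ℝ y)
=ℝ≡ x y = cong (λ φ → ∀[ ι ] φ) (⟦le⟧ (⟦abs⟧ (⟦sub⟧ refl refl)) (⟦dbl⟧ v₀))

<ℝ≡ : ∀ {Γ} (x y : Tm Γ 𝟏) → (∃[ ι ] ⟦ ltʳ ⟧ʳ (⟦ dblᵘ ⟧ᵘ v₀) (⟦ subᵇ ⟧ᵇ (y ↑ · v₀) (x ↑ · v₀))) ≡ (x <ℝ y)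
<ℝ≡ x y = cong (λ φ → ∃[ ι ] φ) (⟦lt⟧ (⟦dbl⟧ v₀) (⟦sub⟧ refl refl))

absℝ≡ : ∀ {Γ} (x : Tm Γ 𝟏) → (ƛ ƛ ⟦ absᵘ ⟧ᵘ (v₁ · v₀)) · x ≡ absℝ x
absℝ≡ x = cong (λ u → (ƛ ƛ u) · x) (⟦abs⟧ {a' = v₁ · v₀} refl)

-ℝ≡ : ∀ {Γ} (x y : Tm Γ 𝟏) → (ƛ ƛ ƛ ⟦ subᵇ ⟧ᵇ (v₂ · (S · v₀)) (v₁ · (S · v₀))) · x · y ≡ (x -ℝ y)
-ℝ≡ x y = cong (λ u → (ƛ ƛ ƛ u) · x · y) (⟦sub⟧ {a' = v₂ · (S · v₀)} {b' = v₁ · (S · v₀)} refl refl)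

ratℝ≡ : ∀ {Γ} (k : Tm Γ ι) → (ƛ ƛ v₁) · ⟦ halfᵘ ⟧ᵘ k ≡ ratℝ (2⁻ k)
ratℝ≡ k = cong (λ u → (ƛ ƛ v₁) · u) (⟦half⟧ k)

module _ {Γ : Ctx} (ε : Env Γ) where
  ev-RealP : (δ : Sub (𝟏 ∷ []) Γ) → ∀ a → δ (here refl) ≡ a → evalF ε δ RealP ≡ Real a
  ev-RealP δ _ refl = Real≡ (δ (here refl))

  ev-EqP : (δ : Sub (𝟏 ∷ 𝟏 ∷ []) Γ) → ∀ a b → δ (here refl) ≡ a → δ (there (here refl)) ≡ b → evalF ε δ EqP ≡ (a =ℝ b)
  ev-EqP δ _ _ refl refl = =ℝ≡ (δ (here refl)) (δ (there (here refl)))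

  ev-LtP : (δ : Sub (𝟏 ∷ 𝟏 ∷ []) Γ) → ∀ a b → δ (here refl) ≡ a → δ (there (here refl)) ≡ b → evalF ε δ LtP ≡ (a <ℝ b)
  ev-LtP δ _ _ refl refl = <ℝ≡ (δ (here refl)) (δ (there (here refl)))

  ev-NearP : (δ : Sub (𝟏 ∷ 𝟏 ∷ ι ∷ []) Γ) → ∀ a b k → δ (here refl) ≡ a → δ (there (here refl)) ≡ b → δ (there (there (here refl))) ≡ k →
             evalF ε δ NearP ≡ Near a b k
  ev-NearP δ a b k p q r = ev-LtP (evals ε δ (absᵣ (b₀ -ᵣ b₁) ∷ᵃ ratᵣ (2⁻ᵗ b₂) ∷ᵃ ∅ᵃ)) (absℝ (a -ℝ b)) (ratℝ (2⁻ k)) dist bd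
    where
    dist : eval ε δ (absᵣ (b₀ -ᵣ b₁)) ≡ absℝ (a -ℝ b)
    dist = trans (absℝ≡ (eval ε δ (b₀ -ᵣ b₁))) (cong absℝ (trans (-ℝ≡ _ _) (cong₂ _-ℝ_ p q)))
    bd : eval ε δ (ratᵣ (2⁻ᵗ b₂)) ≡ ratℝ (2⁻ k)
    bd = trans (ratℝ≡ _) (cong (λ k → ratℝ (2⁻ k)) r)

  0ᵣ≡ : (δ : Sub [] Γ) → eval ε δ 0ᵣ ≡ 0ℝ
  0ᵣ≡ δ = cong ((ƛ ƛ v₁) ·_) (trans (⟦pair⟧ _ _) (cong ⟪ O ,_⟫ (⟦pair⟧ _ _)))

  1ᵣ≡ : (δ : Sub [] Γ) → eval ε δ 1ᵣ ≡ 1ℝ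
  1ᵣ≡ δ = cong ((ƛ ƛ v₁) ·_) (trans (⟦pair⟧ _ _) (cong ⟪ S · O ,_⟫ (⟦pair⟧ _ _)))

  ev-InP : (δ : Sub (𝟏 ∷ []) Γ) → ∀ a → δ (here refl) ≡ a → evalF ε δ InP ≡ ∈I a
  ev-InP δ a p = cong₂ _∧_ (ev-RealP (evals ε δ (b₀ ∷ᵃ ∅ᵃ)) a p) (cong₂ _∧_
    (cong ~_ (ev-LtP (evals ε δ (b₀ ∷ᵃ clo 0ᵣ ∷ᵃ ∅ᵃ)) a 0ℝ p (0ᵣ≡ ∅ˢ)))
    (cong ~_ (ev-LtP (evals ε δ (clo 1ᵣ ∷ᵃ b₀ ∷ᵃ ∅ᵃ)) 1ℝ a (1ᵣ≡ ∅ˢ) p)))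

module _ {Γ Δ : Ctx} (ε : Env Γ) (δ : Sub Δ Γ) where
  ev-Real : ∀ t a → eval ε δ t ≡ a → evalF ε δ (Real′ t) ≡ Real a
  ev-Real t = ev-RealP ε (evals ε δ (t ∷ᵃ ∅ᵃ))

  ev-≐ : ∀ s t a b → eval ε δ s ≡ a → eval ε δ t ≡ b → evalF ε δ (s ≐ᵣ t) ≡ (a =ℝ b)
  ev-≐ s t = ev-EqP ε (evals ε δ (s ∷ᵃ t ∷ᵃ ∅ᵃ))

  ev-Near : ∀ s t n a b k → eval ε δ s ≡ a → eval ε δ t ≡ b → eval ε δ n ≡ k → evalF ε δ (Nearᵣ s t n) ≡ Near a b k
  ev-Near s t n = ev-NearP ε (evals ε δ (s ∷ᵃ t ∷ᵃ n ∷ᵃ ∅ᵃ))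

  ev-I : ∀ t a → eval ε δ t ≡ a → evalF ε δ (I t) ≡ ∈I a
  ev-I t = ev-InP ε (evals ε δ (t ∷ᵃ ∅ᵃ))

module _ {Γ : Ctx} (ε : Env Γ) where
  private
    ε₁ : ∀ {τ} → Env (τ ∷ Γ)
    ε₁ = ε ⇑
    ε₂ : ∀ {τ τ'} → Env (τ ∷ τ' ∷ Γ)
    ε₂ = ε ⇑ ⇑
    ε₃ : ∀ {τ τ' τ″} → Env (τ ∷ τ' ∷ τ″ ∷ Γ)
    ε₃ = ε ⇑ ⇑ ⇑

  ev-FunP : (δ : Sub (𝟏 ⇒ 𝟏 ∷ []) Γ) → evalF ε δ FunP ≡ Function (δ (here refl))
  ev-FunP δ = cong₂ _∧_
    (cong (∀[ 𝟏 ]_) (cong₂ _⊃_ (ev-I ε₁ (extˢ δ) b₀ v₀ refl) (ev-Real ε₁ (extˢ δ) (b₁ ∙ b₀) (δ (here refl) ↑ · v₀) refl)))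
    (cong (λ φ → ∀[ 𝟏 ] ∀[ 𝟏 ] φ) (cong₂ _⊃_
      (cong₂ _∧_ (ev-I ε₂ δ₂ b₁ v₁ refl) (cong₂ _∧_ (ev-I ε₂ δ₂ b₀ v₀ refl) (ev-≐ ε₂ δ₂ b₁ b₀ v₁ v₀ refl refl)))
      (ev-≐ ε₂ δ₂ (b₂ ∙ b₁) (b₂ ∙ b₀) (δ (here refl) ↑² · v₁) (δ (here refl) ↑² · v₀) refl refl)))
    where
    δ₂ : Sub (𝟏 ∷ 𝟏 ∷ 𝟏 ⇒ 𝟏 ∷ []) (𝟏 ∷ 𝟏 ∷ Γ)
    δ₂ = extˢ (extˢ δ)

  module _ (δ : Sub (𝟏 ⇒ 𝟏 ∷ 𝟏 ∷ 𝟏 ∷ []) Γ) where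
    private
      δ₃ : Sub (𝟏 ∷ ι ∷ ι ∷ 𝟏 ⇒ 𝟏 ∷ 𝟏 ∷ 𝟏 ∷ []) (𝟏 ∷ ι ∷ ι ∷ Γ)
      δ₃ = extˢ (extˢ (extˢ δ))
      concl : evalF ε₃ δ₃ (Nearᵣ (b₃ ∙ b₀) b₅ b₂) ≡ Near (δ (here refl) ↑³ · v₀) (δ (there (there (here refl))) ↑³) v₂
      concl = ev-Near ε₃ δ₃ (b₃ ∙ b₀) b₅ b₂ (δ (here refl) ↑³ · v₀) (δ (there (there (here refl))) ↑³) v₂ refl refl refl
      near : evalF ε₃ δ₃ (Nearᵣ b₀ b₄ b₁) ≡ Near v₀ (δ (there (here refl)) ↑³) v₁
      near = ev-Near ε₃ δ₃ b₀ b₄ b₁ v₀ (δ (there (here refl)) ↑³) v₁ refl refl refl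

    ev-LeftP : evalF ε δ (LimP L) ≡ LeftLimit (δ (here refl)) (δ (there (here refl))) (δ (there (there (here refl))))
    ev-LeftP = cong (λ φ → ∀[ ι ] ∃[ ι ] ∀[ 𝟏 ] φ) (cong₂ _⊃_ (cong₂ _∧_ (ev-I ε₃ δ₃ b₀ v₀ refl) (cong₂ _∧_
      (ev-LtP ε₃ (evals ε₃ (evals ε₃ δ₃ (b₀ ∷ᵃ b₄ ∷ᵃ ∅ᵃ)) (b₀ ∷ᵃ b₁ ∷ᵃ ∅ᵃ)) v₀ (δ (there (here refl)) ↑³) refl refl) near)) concl)

    ev-RightP : evalF ε δ (LimP R′) ≡ RightLimit (δ (here refl)) (δ (there (here refl))) (δ (there (there (here refl))))
    ev-RightP = cong (λ φ → ∀[ ι ] ∃[ ι ] ∀[ 𝟏 ] φ) (cong₂ _⊃_ (cong₂ _∧_ (ev-I ε₃ δ₃ b₀ v₀ refl) (cong₂ _∧_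
      (ev-LtP ε₃ (evals ε₃ (evals ε₃ δ₃ (b₀ ∷ᵃ b₄ ∷ᵃ ∅ᵃ)) (b₁ ∷ᵃ b₀ ∷ᵃ ∅ᵃ)) (δ (there (here refl)) ↑³) v₀ refl refl) near)) concl)

  ev-ContP : (δ : Sub (𝟏 ⇒ 𝟏 ∷ 𝟏 ∷ []) Γ) → evalF ε δ ContP ≡ ContinuousAt (δ (here refl)) (δ (there (here refl)))
  ev-ContP δ = cong (λ φ → ∀[ ι ] ∃[ ι ] ∀[ 𝟏 ] φ) (cong₂ _⊃_ (cong₂ _∧_ (ev-I ε₃ δ₃ b₀ v₀ refl)
      (ev-Near ε₃ δ₃ b₀ b₄ b₁ v₀ (δ (there (here refl)) ↑³) v₁ refl refl refl))
      (ev-Near ε₃ δ₃ (b₃ ∙ b₀) (b₃ ∙ b₄) b₂ (δ (here refl) ↑³ · v₀) (δ (here refl) ↑³ · δ (there (here refl)) ↑³) v₂ refl refl refl))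
    where
    δ₃ : Sub (𝟏 ∷ ι ∷ ι ∷ 𝟏 ⇒ 𝟏 ∷ 𝟏 ∷ []) (𝟏 ∷ ι ∷ ι ∷ Γ)
    δ₃ = extˢ (extˢ (extˢ δ))

module _ {Γ : Ctx} (ε : Env Γ) (δ : Sub (𝟏 ⇒ 𝟏 ∷ 𝟏 ∷ 𝟏 ∷ []) Γ) where
  ev-Left : ∀ f x y → δ (here refl) ≡ f → δ (there (here refl)) ≡ x → δ (there (there (here refl))) ≡ y →
            evalF ε δ (LimP L) ≡ LeftLimit f x y
  ev-Left _ _ _ refl refl refl = ev-LeftP ε δ

  ev-Right : ∀ f x y → δ (here refl) ≡ f → δ (there (here refl)) ≡ x → δ (there (there (here refl))) ≡ y →
             evalF ε δ (LimP R′) ≡ RightLimit f x y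
  ev-Right _ _ _ refl refl refl = ev-RightP ε δ

ev-RegP : ∀ {Γ} (ε : Env Γ) (δ : Sub (𝟏 ⇒ 𝟏 ∷ []) Γ) → evalF ε δ RegP ≡ Regulated (δ (here refl))
ev-RegP {Γ} ε δ = cong (∀[ 𝟏 ]_) (cong₂ _⊃_ (ev-I (ε ⇑) (extˢ δ) b₀ v₀ refl) (cong₂ _∧_
    (cong (∃[ 𝟏 ]_) (cong₂ _∧_ (ev-Real (ε ⇑ ⇑) δ₂ b₀ v₀ refl) (ev-Left (ε ⇑ ⇑) δ₃ (δ (here refl) ↑²) v₁ v₀ refl refl refl)))
    (cong (∃[ 𝟏 ]_) (cong₂ _∧_ (ev-Real (ε ⇑ ⇑) δ₂ b₀ v₀ refl) (ev-Right (ε ⇑ ⇑) δ₃ (δ (here refl) ↑²) v₁ v₀ refl refl refl)))))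
  where
  δ₂ : Sub (𝟏 ∷ 𝟏 ∷ 𝟏 ⇒ 𝟏 ∷ []) (𝟏 ∷ 𝟏 ∷ Γ)
  δ₂ = extˢ (extˢ δ)
  δ₃ : Sub (𝟏 ⇒ 𝟏 ∷ 𝟏 ∷ 𝟏 ∷ []) (𝟏 ∷ 𝟏 ∷ Γ)
  δ₃ = evals (ε ⇑ ⇑) δ₂ (b₂ ∷ᵃ b₁ ∷ᵃ b₀ ∷ᵃ ∅ᵃ)

module _ {Γ : Ctx} (ε : Env Γ) where
  private
    fun : (δ : Sub (𝟏 ⇒ 𝟏 ∷ []) Γ) → ∀ f → δ (here refl) ≡ f → evalF ε δ FunP ≡ Function f
    fun δ _ refl = ev-FunP ε δ

    reg : (δ : Sub (𝟏 ⇒ 𝟏 ∷ []) Γ) → ∀ f → δ (here refl) ≡ f → evalF ε δ RegP ≡ Regulated f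
    reg δ _ refl = ev-RegP ε δ

    con : (δ : Sub (𝟏 ⇒ 𝟏 ∷ 𝟏 ∷ []) Γ) → ∀ f x → δ (here refl) ≡ f → δ (there (here refl)) ≡ x → evalF ε δ ContP ≡ ContinuousAt f x
    con δ _ _ refl refl = ev-ContP ε δ

  ev-Fun : ∀ {Δ} (δ : Sub Δ Γ) t f → eval ε δ t ≡ f → evalF ε δ (Fun t) ≡ Function f
  ev-Fun δ t = fun (evals ε δ (t ∷ᵃ ∅ᵃ))

  ev-Reg : ∀ {Δ} (δ : Sub Δ Γ) t f → eval ε δ t ≡ f → evalF ε δ (Reg t) ≡ Regulated f
  ev-Reg δ t = reg (evals ε δ (t ∷ᵃ ∅ᵃ))

  ev-Cont : ∀ {Δ} (δ : Sub Δ Γ) t u f x → eval ε δ t ≡ f → eval ε δ u ≡ x → evalF ε δ (Cont t u) ≡ ContinuousAt f x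
  ev-Cont δ t u = con (evals ε δ (t ∷ᵃ u ∷ᵃ ∅ᵃ))

ev-NotDiscP : (ε : Env []) → ⟦ NotDiscP ⟧ ε ≡ RegulatedNotTotallyDiscontinuous
ev-NotDiscP ε = cong (∀[ 𝟏 ⇒ 𝟏 ]_) (cong₂ _⊃_
  (cong₂ _∧_ (ev-Fun (ε ⇑) (extˢ ∅ˢ) b₀ v₀ refl) (ev-Reg (ε ⇑) (extˢ ∅ˢ) b₀ v₀ refl))
  (cong (∃[ 𝟏 ]_) (cong₂ _∧_ (ev-I (ε ⇑ ⇑) (extˢ (extˢ ∅ˢ)) b₀ v₀ refl) (ev-Cont (ε ⇑ ⇑) (extˢ (extˢ ∅ˢ)) b₁ b₀ v₁ v₀ refl refl))))

-- Name-free formulas still need some assignment to be evaluated; constant zero functionals exist at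
-- every type and in every context.
closed : ∀ {Γ} → Env Γ
closed σ n = go σ
  where
  go : ∀ {Γ} σ → Tm Γ σ
  go ι       = O
  go (σ ⇒ τ) = ƛ go τ

-- A detour through the second syntax: the formula is an evaluation of `InP`, and evaluation
-- commutes with substitution, so its large normal form is never traversed.
subF-∈I : ∀ {Γ Δ} (θ : Sub Γ Δ) φ a b → φ ≡ ∈I a → sub θ a ≡ b → subF θ φ ≡ ∈I b
subF-∈I {Γ} {Δ} θ φ a b e p = trans (cong (subF {Γ} {Δ} θ) (trans e (sym (ev-InP closed (∅ˢ ,ₛ a) a refl))))
  (trans (subF-evalF θ closed (∅ˢ ,ₛ a) InP) (ev-InP (λ σ n → sub θ (closed σ n)) (λ x → sub θ ((∅ˢ ,ₛ a) x)) b p))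

renF-∈I : ∀ {Γ Δ} (ρ : Ren Γ Δ) φ a b → φ ≡ ∈I a → ren ρ a ≡ b → renF ρ φ ≡ ∈I b
renF-∈I {Γ} {Δ} ρ φ a b e p = trans (cong (renF {Γ} {Δ} ρ) (trans e (sym (ev-InP closed (∅ˢ ,ₛ a) a refl))))
  (trans (renF-evalF ρ closed (∅ˢ ,ₛ a) InP) (ev-InP (λ σ n → ren ρ (closed σ n)) (λ x → ren ρ ((∅ˢ ,ₛ a) x)) b p))

-- Here and below contexts are written out and let is used so that Agda compares
-- the formulas of Defs without unfolding them.

Finite′ : ∀ {Γ} → Fm (ι ∷ (ι ⇒ 𝟏) ∷ ι ∷ Γ) → Fm Γ
Finite′ B = ∃[ ι ] ∀[ ι ⇒ 𝟏 ]
  (∀[ ι ] v₀ ≤̇ v₂ ⊃ Real (v₁ · v₀))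
  ∧ (∀[ ι ] ∀[ ι ] v₁ <̇ v₀ ∧ v₀ ≤̇ v₃ ⊃ ~ (v₂ · v₁ =ℝ v₂ · v₀))
  ⊃ (∃[ ι ] v₀ ≤̇ v₂ ∧ ~ B)

Finite≡ : ∀ {Γ} (A : Fm (𝟏 ∷ Γ)) B →
          (∀ (θ : Sub (𝟏 ∷ Γ) (ι ∷ (ι ⇒ 𝟏) ∷ ι ∷ Γ)) → θ (here refl) ≡ v₁ · v₀ →
             (∀ {σ} (x : σ ∈ Γ) → θ (there x) ≡ var (there (there (there x)))) → subF θ A ≡ B) →
          Finite A ≡ Finite′ B
Finite≡ A B h = cong Finite′ (h _ refl (λ _ → refl))

small : Fm (ι ∷ (ι ⇒ 𝟏) ∷ ι ∷ ι ∷ 𝟐 ∷ [])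
small = ∈I (v₁ · v₀) ∧ var (there (there (there (there (here refl))))) · (v₁ · v₀) <̇ v₃

sub-small : (A : Fm (𝟏 ∷ ι ∷ 𝟐 ∷ [])) → A ≡ ∈I v₀ → (θ : Sub (𝟏 ∷ ι ∷ 𝟐 ∷ []) (ι ∷ (ι ⇒ 𝟏) ∷ ι ∷ ι ∷ 𝟐 ∷ [])) →
            θ (here refl) ≡ v₁ · v₀ → (∀ {σ} (x : σ ∈ ι ∷ 𝟐 ∷ []) → θ (there x) ≡ var (there (there (there x)))) →
            subF θ (A ∧ v₂ · v₀ <̇ v₁) ≡ small
sub-small A e θ p q = trans
  (cong (subF θ A ∧_) (cong₂ _<̇_ (cong₂ _·_ (q (there (here refl))) p) (q (here refl))))
  (cong (λ φ → φ ∧ var (there (there (there (there (here refl))))) · (v₁ · v₀) <̇ v₃) (subF-∈I θ A v₀ (v₁ · v₀) e p))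

smallA : Fm (𝟏 ∷ []) → Fm (𝟏 ∷ ι ∷ 𝟐 ∷ [])
smallA A = renF (extᴿ (λ x → there (there x))) A ∧ v₂ · v₀ <̇ v₁

Finite-small : (A : Fm (𝟏 ∷ [])) → A ≡ ∈I v₀ → Finite {ι ∷ 𝟐 ∷ []} (smallA A) ≡ Finite′ {ι ∷ 𝟐 ∷ []} small
Finite-small A e = Finite≡ {ι ∷ 𝟐 ∷ []} (smallA A) small
  (sub-small (renF (extᴿ (λ x → there (there x))) A) (renF-∈I (extᴿ (λ x → there (there x))) A v₀ v₀ e refl))

HeightForm : Fm (ι ∷ 𝟐 ∷ []) → Fm []
HeightForm F = ∃[ 𝟐 ] (∀[ 𝟏 ] ∀[ 𝟏 ] Real v₁ ∧ Real v₀ ∧ v₁ =ℝ v₀ ⊃ v₂ · v₁ ≐ v₂ · v₀) ∧ (∀[ ι ] F)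

opaque
  unfolding ⟦_⟧ᵇ

  ev-≤ₙ : ∀ {Γ Δ} (ε : Env Γ) (δ : Sub Δ Γ) s t → evalF ε δ (s ≤ₙ t) ≡ (eval ε δ s ≤̇ eval ε δ t)
  ev-≤ₙ ε δ s t = refl

module _ (ε : Env []) where
  private
    εF : Env (ι ∷ 𝟐 ∷ [])
    εF = ε ⇑ ⇑
    δF : Sub (ι ∷ 𝟐 ∷ []) (ι ∷ 𝟐 ∷ [])
    δF = evals εF (extˢ (extˢ ∅ˢ)) (b₀ ∷ᵃ b₁ ∷ᵃ ∅ᵃ)
    ε₂ : Env ((ι ⇒ 𝟏) ∷ ι ∷ ι ∷ 𝟐 ∷ [])
    ε₂ = εF ⇑ ⇑
    δ₂ : Sub ((ι ⇒ 𝟏) ∷ ι ∷ ι ∷ 𝟐 ∷ []) ((ι ⇒ 𝟏) ∷ ι ∷ ι ∷ 𝟐 ∷ [])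
    δ₂ = extˢ (extˢ δF)
    δs : Sub ((ι ⇒ 𝟏) ∷ ι ∷ []) ((ι ⇒ 𝟏) ∷ ι ∷ ι ∷ 𝟐 ∷ [])
    δs = evals ε₂ δ₂ (b₀ ∷ᵃ b₁ ∷ᵃ ∅ᵃ)

  ev-FinP : evalF εF δF FinP ≡ Finite′ {ι ∷ 𝟐 ∷ []} small
  ev-FinP = cong (λ φ → ∃[ ι ] ∀[ ι ⇒ 𝟏 ] φ) (cong₂ _⊃_ (cong₂ _∧_
      (cong (∀[ ι ]_) (cong₂ _⊃_ (ev-≤ₙ (ε₂ ⇑) (extˢ δs) b₀ b₂) (ev-Real (ε₂ ⇑) (extˢ δs) (b₁ ∙ b₀) (v₁ · v₀) refl)))
      (cong (λ φ → ∀[ ι ] ∀[ ι ] φ) (cong₂ _⊃_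
        (cong₂ _∧_ (ev-≤ₙ (ε₂ ⇑ ⇑) (extˢ (extˢ δs)) (su b₁) b₀) (ev-≤ₙ (ε₂ ⇑ ⇑) (extˢ (extˢ δs)) b₀ b₃))
        (cong ~_ (ev-≐ (ε₂ ⇑ ⇑) (extˢ (extˢ δs)) (b₂ ∙ b₁) (b₂ ∙ b₀) (v₂ · v₁) (v₂ · v₀) refl refl)))))
    (cong (∃[ ι ]_) (cong₂ _∧_ (ev-≤ₙ (ε₂ ⇑) (extˢ δ₂) b₀ b₂) (cong ~_ (cong₂ _∧_
      (ev-I (ε₂ ⇑) (extˢ δ₂) (b₁ ∙ b₀) (v₁ · v₀) refl) (ev-≤ₙ (ε₂ ⇑) (extˢ δ₂) (su (b₄ ∙ (b₁ ∙ b₀))) b₃))))))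

  ev-ExtP : (δ : Sub (𝟐 ∷ []) (𝟐 ∷ [])) → δ (here refl) ≡ v₀ →
            evalF (ε ⇑) δ ExtP ≡ (∀[ 𝟏 ] ∀[ 𝟏 ] Real v₁ ∧ Real v₀ ∧ v₁ =ℝ v₀ ⊃ v₂ · v₁ ≐ v₂ · v₀)
  ev-ExtP δ p = cong (λ φ → ∀[ 𝟏 ] ∀[ 𝟏 ] φ) (cong₂ _⊃_ (cong₂ _∧_ (ev-Real (ε ⇑ ⇑ ⇑) (extˢ (extˢ δ)) b₁ v₁ refl)
      (cong₂ _∧_ (ev-Real (ε ⇑ ⇑ ⇑) (extˢ (extˢ δ)) b₀ v₀ refl) (ev-≐ (ε ⇑ ⇑ ⇑) (extˢ (extˢ δ)) b₁ b₀ v₁ v₀ refl refl)))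
      (cong (λ h → h ↑² · v₁ ≐ h ↑² · v₀) p))

  ev-HeightForm : ∀ F → F ≡ Finite′ {ι ∷ 𝟐 ∷ []} small → ⟦ HeightP ⟧ ε ≡ HeightForm F
  ev-HeightForm F e = cong (∃[ 𝟐 ]_) (cong₂ _∧_ (ev-ExtP (evals (ε ⇑) (extˢ ∅ˢ) (b₀ ∷ᵃ ∅ᵃ)) refl) (cong (∀[ ι ]_) (trans ev-FinP (sym e))))

height-form : ∀ A → HeightForm (Finite {ι ∷ 𝟐 ∷ []} (smallA A)) ≡ HeightCountable A
height-form A = refl

ev-HeightP : (ε : Env []) (A : Fm (𝟏 ∷ [])) → A ≡ ∈I v₀ → ⟦ HeightP ⟧ ε ≡ HeightCountable A
ev-HeightP ε A e =
  let fin  = Finite-small A e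
      ev   = ev-HeightForm ε (Finite {ι ∷ 𝟐 ∷ []} (smallA A)) fin
      form = height-form A
      r    = trans ev form
  in r

theorem3p6 : (ACA₀ω +ᵀ QF-AC⁰¹) ∣ [] ⊢ (RegulatedNotTotallyDiscontinuous ⊃⊂ NIN-alt)
theorem3p6 = transfer (ev-NotDiscP closed) (ev-HeightP closed (∈I v₀) refl)
  where
  -- With variables for the two formulas of the statement the equations can be matched on, and
  -- neither side has to be normalised.
  transfer : ∀ {R N} → ⟦ NotDiscP ⟧ closed ≡ R → ⟦ HeightP ⟧ closed ≡ N → 𝕋 ∣ [] ⊢ (R ⊃⊂ ~ N)
  transfer refl refl = ⊩-closed (NotDiscP ⇔′ ¬′ HeightP) refl (assume regulated⇒NIN & assume NIN⇒regulated) closed
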